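{- For each integer $r \geq 2$, there exists a constant $C = C(r) > 0$ such that the following holds. Let $n, k$ be positive integers with $n \geq 2k + C k^{2/3}$, and let $\mathcal{F} \subset \binom{[n]}{k}$ be a union of at most $r$ intersecting families (i.e.\ $\mathcal{F} = \mathcal{F}_1 \cup \cdots \cup \mathcal{F}_m$ with $m \leq r$, where each $\mathcal{F}_i \subset \binom{[n]}{k}$ is intersecting). Then $$|\mathcal{F}| \leq \binom{n}{k} - \binom{n-r}{k},$$ and equality holds only if $\mathcal{F} = \{S \in \binom{[n]}{k} : S \cap R \neq \emptyset\}$ for some $R \in \binom{[n]}{r}$.
   Context: $[n] = \{1,\ldots,n\}$ and $\binom{[n]}{k}$ is the set of $k$-element subsets of $[n]$. A family of sets is intersecting if any two of its members have nonempty intersection. -}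

module Defs where

open import Data.Nat using (ℕ; zero; suc; _+_)
open import Data.Bool using (Bool; true; false; if_then_else_)
open import Data.List using (List; []; _∷_; map; _++_; length; filter)
open import Data.Vec using (_∷_; [])
open import Data.Fin using (Fin)
open import Data.Fin.Subset using (Subset; outside; inside; _∩_; Nonempty; ∣_∣)
open import Data.Product using (_×_)
open import Relation.Binary.PropositionalEquality using (_≡_)

Family : ℕ → Set
Family n = Subset n → Bool

allSubsets : (n : ℕ) → List (Subset n)
allSubsets zero    = [] ∷ []
allSubsets (suc n) = map (outside ∷_) (allSubsets n) ++ map (inside ∷_) (allSubsets n)

card : {n : ℕ} → Family n → ℕ
card {n} F = length (filter (λ S → Data.Bool._≟_ (F S) true) (allSubsets n))
  where import Data.Bool

Uniform : {n : ℕ} → ℕ → Family n → Set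
Uniform k F = ∀ S → F S ≡ true → ∣ S ∣ ≡ k

Intersecting : {n : ℕ} → Family n → Set
Intersecting F = ∀ A B → F A ≡ true → F B ≡ true → Nonempty (A ∩ B)

anyFin : (m : ℕ) → (Fin m → Bool) → Bool
anyFin zero    f = false
anyFin (suc m) f = if f Fin.zero then true else anyFin m (λ i → f (Fin.suc i))

⋃ : {n m : ℕ} → (Fin m → Family n) → Family n
⋃ {m = m} Fs S = anyFin m (λ i → Fs i S)

{-# OPTIONS --safe #-}
-- Replace every family by its up-closure M_i and measure it by the product measure of a p strictly between k/n and 1/2,
-- p ≥ 2/5, at distance of order (n - 2k)/n from both.  If the union is at least as large as claimed, the
-- Kruskal–Katona theorem transfers this from level k to all higher levels, so the complement of ⋃ M_i has measure at
-- most (1 - p)^r + τ, with τ a binomial tail.  Harris' inequality and μ(M_i) ≤ p then force μ(M_i) ≥ p - O(τ) for each i.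
-- Writing e for the measure of the section of M_i at x_j = 0, a two-point induction bounds p - μ(M_i) below by a multiple
-- of e(p - e), and a Poincaré inequality yields a coordinate j_i where e is not close to p; hence e is tiny,
-- i.e. M_i is nearly the star at j_i, and the j_i are distinct.  Let R = {j_1, ..., j_r}.  A family of sets
-- missing j_i as sparse as this section forces more than 2r times as many sets containing j_i out of F_i, again by
-- Kruskal–Katona.  This is where n - 2k ≥ C k^(2/3) enters: τ ≈ exp(-(n - 2k)²/n) must beat exp(-n/(n - 2k)).  So sets
-- of F outside {S : S ∩ R ≠ ∅} always cost more than they bring.
module Submission where

open import Defs
open import Data.Nat using (ℕ; _+_; _*_; _∸_; _^_; _≤_; _<_)
open import Data.Nat.Combinatorics using (_C_)
open import Data.Fin using (Fin)
open import Data.Fin.Subset using (Subset; _∩_; Nonempty; ∣_∣)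
open import Data.Bool using (true)
open import Data.Product using (Σ; _×_; _,_)
open import Relation.Binary.PropositionalEquality using (_≡_)

open import Data.Nat using (zero; suc; z≤n; s≤s; _≡ᵇ_; _≤?_; >-nonZero)
open import Data.Nat.Properties
open import Data.Nat.Combinatorics using (nCk+nC[k+1]≡[n+1]C[k+1]; nCk≡nC[n∸k]; k>n⇒nCk≡0)
open import Data.Nat.DivMod using (_/_; _%_; m≡m%n+[m/n]*n; m%n<n; m/n*n≤m)
open import Data.Nat.Tactic.RingSolver using (solve-∀)
open import Data.Fin using (zero; suc; punchIn; punchOut)
open import Data.Fin.Properties using (punchIn-punchOut)
open import Data.Fin.Subset using (inside; outside; ∁)
open import Data.Fin.Subset.Properties using (∣p∣≤n; x∈p∩q⁺; x∈p∩q⁻)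
open import Data.Bool using (Bool; false; _∧_; _∨_; not; if_then_else_)
open import Data.Vec using ([]; _∷_; lookup; _[_]≔_)
open import Data.Vec.Properties using (lookup-map; []=⇒lookup; lookup⇒[]=; lookup∘update; lookup∘update′)
open import Data.List using (List; length; filter; map)
open import Data.List.Properties using (filter-++; length-++)
open import Data.Product using (proj₁; proj₂)
open import Data.Sum using (_⊎_; inj₁; inj₂)
open import Data.Empty using (⊥; ⊥-elim)
open import Relation.Nullary using (Dec; yes; no; ¬_)
open import Relation.Binary.PropositionalEquality using (refl; sym; trans; cong; cong₂; subst; subst₂; module ≡-Reasoning)
import Data.Bool
import Data.Fin
import Data.Fin.Subset
import Data.List as List

-- Finite sums

-- The bound and the equality case come from one implication: a union at least as large as claimed
-- is a hitting family. The measure must sit at p < 1/2, because at 1/2 every maximal intersecting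
-- family is as large as a star, and p must exceed k/n so that little mass lies below level k; when
-- n - 2k is o(n) both distances are small and expansion is weak, of order (n - 2k)/n. A
-- polynomially small error in the approximation by stars would not do: in the last step
-- Kruskal-Katona multiplies a family by more than 2r through a descent of rt levels, where t is
-- about 2n/(n - 2k) and a level gains a factor 1 + (n - 2k)/n. That needs a family smaller than a
-- binomial coefficient with upper index n - c, c = r + 1 + rt, hence sections of density below
-- about 3^(-c). So τ has to be below 2^(-w) with w at least of order c, while every factor 2 uses
-- up t of the (n - 2k)/4 levels available: t² can be at most of order n - 2k, and this is the
-- exponent 2/3. The inequalities are homogeneous and over ℕ: weights α and β with α + β = 10n
-- replace p and 1 - p, and n - 2k ≥ C k^(2/3) is cubed.

∑ : ∀ {n} → (Subset n → ℕ) → ℕ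
∑ {zero}  f = f []
∑ {suc n} f = ∑ (λ S → f (outside ∷ S)) + ∑ (λ S → f (inside ∷ S))

∑F : ∀ {m} → (Fin m → ℕ) → ℕ
∑F {zero}  f = 0
∑F {suc m} f = f zero + ∑F (λ i → f (suc i))

∑< : ℕ → (ℕ → ℕ) → ℕ
∑< zero    f = 0
∑< (suc m) f = f 0 + ∑< m (λ l → f (suc l))

+-interchange : ∀ a b c d → (a + b) + (c + d) ≡ (a + c) + (b + d)
+-interchange = solve-∀

∑-cong : ∀ {n} {f g : Subset n → ℕ} → (∀ S → f S ≡ g S) → ∑ f ≡ ∑ g
∑-cong {zero}  h = h []
∑-cong {suc n} h = cong₂ _+_ (∑-cong {n} (λ S → h (outside ∷ S))) (∑-cong {n} (λ S → h (inside ∷ S)))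

∑-mono : ∀ {n} {f g : Subset n → ℕ} → (∀ S → f S ≤ g S) → ∑ f ≤ ∑ g
∑-mono {zero}  h = h []
∑-mono {suc n} h = +-mono-≤ (∑-mono {n} (λ S → h (outside ∷ S))) (∑-mono {n} (λ S → h (inside ∷ S)))

∑-+ : ∀ {n} (f g : Subset n → ℕ) → ∑ (λ S → f S + g S) ≡ ∑ f + ∑ g
∑-+ {zero}  f g = refl
∑-+ {suc n} f g = trans (cong₂ _+_ (∑-+ {n} _ _) (∑-+ {n} _ _))
  (+-interchange (∑ (λ S → f (outside ∷ S))) (∑ (λ S → g (outside ∷ S))) _ _)

∑-*ˡ : ∀ {n} c (f : Subset n → ℕ) → ∑ (λ S → c * f S) ≡ c * ∑ f
∑-*ˡ {zero}  c f = refl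
∑-*ˡ {suc n} c f = trans (cong₂ _+_ (∑-*ˡ {n} c _) (∑-*ˡ {n} c _)) (sym (*-distribˡ-+ c (∑ (λ S → f (outside ∷ S))) _))

∑-zero : ∀ {n} → ∑ {n} (λ _ → 0) ≡ 0
∑-zero {zero}  = refl
∑-zero {suc n} = cong₂ _+_ (∑-zero {n}) (∑-zero {n})

∑-lower : ∀ {n} (f : Subset n → ℕ) S → f S ≤ ∑ f
∑-lower f [] = ≤-refl
∑-lower f (outside ∷ S) = ≤-trans (∑-lower (λ S → f (outside ∷ S)) S) (m≤m+n _ _)
∑-lower f (inside ∷ S)  = ≤-trans (∑-lower (λ S → f (inside ∷ S)) S) (m≤n+m _ _)

∑F-cong : ∀ {m} {f g : Fin m → ℕ} → (∀ i → f i ≡ g i) → ∑F f ≡ ∑F g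
∑F-cong {zero}  h = refl
∑F-cong {suc m} h = cong₂ _+_ (h zero) (∑F-cong (λ i → h (suc i)))

∑F-mono : ∀ {m} {f g : Fin m → ℕ} → (∀ i → f i ≤ g i) → ∑F f ≤ ∑F g
∑F-mono {zero}  h = z≤n
∑F-mono {suc m} h = +-mono-≤ (h zero) (∑F-mono (λ i → h (suc i)))

∑F-+ : ∀ {m} (f g : Fin m → ℕ) → ∑F (λ i → f i + g i) ≡ ∑F f + ∑F g
∑F-+ {zero}  f g = refl
∑F-+ {suc m} f g = trans (cong (f zero + g zero +_) (∑F-+ (λ i → f (suc i)) (λ i → g (suc i))))
  (+-interchange (f zero) _ _ _)

∑F-*ˡ : ∀ {m} c (f : Fin m → ℕ) → ∑F (λ i → c * f i) ≡ c * ∑F f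
∑F-*ˡ {zero}  c f = sym (*-zeroʳ c)
∑F-*ˡ {suc m} c f = trans (cong (c * f zero +_) (∑F-*ˡ c (λ i → f (suc i))))
  (sym (*-distribˡ-+ c (f zero) _))

∑F-const : ∀ m c → ∑F {m} (λ _ → c) ≡ m * c
∑F-const zero    c = refl
∑F-const (suc m) c = cong (c +_) (∑F-const m c)

∑F-upper : ∀ {m} {f : Fin m → ℕ} {c} → (∀ i → f i ≤ c) → ∑F f ≤ m * c
∑F-upper {m} {f} {c} h = ≤-trans (∑F-mono h) (≤-reflexive (∑F-const m c))

∑F-lower : ∀ {m} (f : Fin m → ℕ) i → f i ≤ ∑F f
∑F-lower f zero    = m≤m+n _ _
∑F-lower f (suc i) = ≤-trans (∑F-lower (λ i → f (suc i)) i) (m≤n+m _ _)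

∑F-∑ : ∀ {m n} (f : Fin m → Subset n → ℕ) → ∑F (λ i → ∑ (f i)) ≡ ∑ (λ S → ∑F (λ i → f i S))
∑F-∑ {zero}  {n} f = sym (∑-zero {n})
∑F-∑ {suc m} f = trans (cong (∑ (f zero) +_) (∑F-∑ (λ i → f (suc i))))
  (sym (∑-+ (f zero) _))

∑<-cong : ∀ m {f g : ℕ → ℕ} → (∀ l → l < m → f l ≡ g l) → ∑< m f ≡ ∑< m g
∑<-cong zero    h = refl
∑<-cong (suc m) h = cong₂ _+_ (h 0 (s≤s z≤n)) (∑<-cong m (λ l l< → h (suc l) (s≤s l<)))

∑<-mono : ∀ m {f g : ℕ → ℕ} → (∀ l → l < m → f l ≤ g l) → ∑< m f ≤ ∑< m g
∑<-mono zero    h = z≤n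
∑<-mono (suc m) h = +-mono-≤ (h 0 (s≤s z≤n)) (∑<-mono m (λ l l< → h (suc l) (s≤s l<)))

∑<-+ : ∀ m (f g : ℕ → ℕ) → ∑< m (λ l → f l + g l) ≡ ∑< m f + ∑< m g
∑<-+ zero    f g = refl
∑<-+ (suc m) f g = trans (cong (f 0 + g 0 +_) (∑<-+ m (λ l → f (suc l)) (λ l → g (suc l))))
  (+-interchange (f 0) _ _ _)

∑<-*ˡ : ∀ m c (f : ℕ → ℕ) → ∑< m (λ l → c * f l) ≡ c * ∑< m f
∑<-*ˡ zero    c f = sym (*-zeroʳ c)
∑<-*ˡ (suc m) c f = trans (cong (c * f 0 +_) (∑<-*ˡ m c (λ l → f (suc l))))
  (sym (*-distribˡ-+ c (f 0) _))

∑<-zero : ∀ m → ∑< m (λ _ → 0) ≡ 0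
∑<-zero zero    = refl
∑<-zero (suc m) = ∑<-zero m

∑<-split : ∀ m j (f : ℕ → ℕ) → ∑< (m + j) f ≡ ∑< m f + ∑< j (λ l → f (m + l))
∑<-split zero    j f = refl
∑<-split (suc m) j f = trans (cong (f 0 +_) (∑<-split m j (λ l → f (suc l)))) (sym (+-assoc (f 0) _ _))

∑<-∑ : ∀ m {n} (f : ℕ → Subset n → ℕ) → ∑< m (λ l → ∑ (f l)) ≡ ∑ (λ S → ∑< m (λ l → f l S))
∑<-∑ zero {n} f = sym (∑-zero {n})
∑<-∑ (suc m) f = trans (cong (∑ (f 0) +_) (∑<-∑ m (λ l → f (suc l)))) (sym (∑-+ (f 0) _))

-- Levels of a family

ind : Bool → ℕ
ind true  = 1
ind false = 0

ind-mono : ∀ {a b} → (a ≡ true → b ≡ true) → ind a ≤ ind b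
ind-mono {false} h = z≤n
ind-mono {true}  h rewrite h refl = ≤-refl

ind≤1 : ∀ a → ind a ≤ 1
ind≤1 true  = ≤-refl
ind≤1 false = z≤n

ind-not : ∀ a → ind (not a) + ind a ≡ 1
ind-not true  = refl
ind-not false = refl

lev : ∀ {n} → ℕ → Family n → ℕ
lev l F = ∑ (λ S → ind (∣ S ∣ ≡ᵇ l) * ind (F S))

≡ᵇ-refl : ∀ n → (n ≡ᵇ n) ≡ true
≡ᵇ-refl zero = refl
≡ᵇ-refl (suc n) = ≡ᵇ-refl n

≡ᵇ-sound : ∀ m n → (m ≡ᵇ n) ≡ true → m ≡ n
≡ᵇ-sound zero zero h = refl
≡ᵇ-sound (suc m) (suc n) h = cong suc (≡ᵇ-sound m n h)

ind-lev-cong : ∀ m l {x y : ℕ} → (m ≡ l → x ≡ y) → ind (m ≡ᵇ l) * x ≡ ind (m ≡ᵇ l) * y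
ind-lev-cong m l h with m ≡ᵇ l in eq
... | true  = cong (1 *_) (h (≡ᵇ-sound m l eq))
... | false = refl

ind-lev-mono : ∀ m l {x y : ℕ} → (m ≡ l → x ≤ y) → ind (m ≡ᵇ l) * x ≤ ind (m ≡ᵇ l) * y
ind-lev-mono m l h with m ≡ᵇ l in eq
... | true  = *-monoʳ-≤ 1 (h (≡ᵇ-sound m l eq))
... | false = z≤n

lev-mono : ∀ {n} l {F G : Family n} → (∀ S → ∣ S ∣ ≡ l → F S ≡ true → G S ≡ true) → lev l F ≤ lev l G
lev-mono {n} l h = ∑-mono {n} (λ S → ind-lev-mono ∣ S ∣ l (λ e → ind-mono (h S e)))

lev-pos : ∀ {n} (F : Family n) S → F S ≡ true → 1 ≤ lev ∣ S ∣ F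
lev-pos F S h = ≤-trans (≤-reflexive eq) (∑-lower (λ T → ind (∣ T ∣ ≡ᵇ ∣ S ∣) * ind (F T)) S)
  where
  eq : 1 ≡ ind (∣ S ∣ ≡ᵇ ∣ S ∣) * ind (F S)
  eq rewrite ≡ᵇ-refl ∣ S ∣ | h = refl

lev-+ : ∀ {n} l (F G : Family n) → ∑ (λ S → ind (∣ S ∣ ≡ᵇ l) * (ind (F S) + ind (G S))) ≡ lev l F + lev l G
lev-+ {n} l F G = trans (∑-cong {n} (λ S → *-distribˡ-+ (ind (∣ S ∣ ≡ᵇ l)) _ _)) (∑-+ {n} (λ S → ind (∣ S ∣ ≡ᵇ l) * ind (F S)) (λ S → ind (∣ S ∣ ≡ᵇ l) * ind (G S)))

all : ∀ {n} → Family n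
all _ = true

lev-compl : ∀ {n} l (F : Family n) → lev l (λ S → not (F S)) + lev l F ≡ lev {n} l all
lev-compl {n} l F = trans (sym (lev-+ l (λ S → not (F S)) F))
  (∑-cong {n} (λ S → cong (ind (∣ S ∣ ≡ᵇ l) *_) (ind-not (F S))))

lev-outside : ∀ {n} (F : Family (suc n)) → lev 0 F ≡ lev 0 (λ S → F (outside ∷ S))
lev-outside {n} F = trans (cong (lev 0 (λ S → F (outside ∷ S)) +_) (∑-zero {n})) (+-identityʳ _)

filter-map-length : ∀ {n} (F : Family (suc n)) x (xs : List (Subset n)) →
  length (filter (λ S → F S Data.Bool.≟ true) (map (x ∷_) xs)) ≡ length (filter (λ S → F (x ∷ S) Data.Bool.≟ true) xs)
filter-map-length F x List.[] = refl
filter-map-length F x (S List.∷ xs) with F (x ∷ S)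
... | true  = cong suc (filter-map-length F x xs)
... | false = filter-map-length F x xs

card≡∑ : ∀ {n} (F : Family n) → card F ≡ ∑ (λ S → ind (F S))
card≡∑ {zero} F with F []
... | true  = refl
... | false = refl
card≡∑ {suc n} F = trans (cong length (filter-++ (λ S → F S Data.Bool.≟ true) (map (outside ∷_) (allSubsets n)) (map (inside ∷_) (allSubsets n))))
  (trans (length-++ (filter (λ S → F S Data.Bool.≟ true) (map (outside ∷_) (allSubsets n))))
  (cong₂ _+_ (trans (filter-map-length F outside (allSubsets n)) (card≡∑ (λ S → F (outside ∷ S))))
             (trans (filter-map-length F inside (allSubsets n)) (card≡∑ (λ S → F (inside ∷ S))))))

ind-≡ᵇ-∑ : ∀ m j → j < m → ∑< m (λ l → ind (j ≡ᵇ l)) ≡ 1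
ind-≡ᵇ-∑ (suc m) zero    h = cong suc (∑<-zero m)
ind-≡ᵇ-∑ (suc m) (suc j) (s≤s h) = ind-≡ᵇ-∑ m j h

∑-by-size : ∀ {n} (f : Subset n → ℕ) → ∑ f ≡ ∑< (suc n) (λ l → ∑ (λ S → ind (∣ S ∣ ≡ᵇ l) * f S))
∑-by-size {n} f = sym (trans (∑<-∑ (suc n) (λ l S → ind (∣ S ∣ ≡ᵇ l) * f S)) (∑-cong pt))
  where
  pt : ∀ S → ∑< (suc n) (λ l → ind (∣ S ∣ ≡ᵇ l) * f S) ≡ f S
  pt S = begin
    ∑< (suc n) (λ l → ind (∣ S ∣ ≡ᵇ l) * f S) ≡⟨ ∑<-cong (suc n) (λ l _ → *-comm (ind (∣ S ∣ ≡ᵇ l)) (f S)) ⟩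
    ∑< (suc n) (λ l → f S * ind (∣ S ∣ ≡ᵇ l)) ≡⟨ ∑<-*ˡ (suc n) (f S) (λ l → ind (∣ S ∣ ≡ᵇ l)) ⟩
    f S * ∑< (suc n) (λ l → ind (∣ S ∣ ≡ᵇ l)) ≡⟨ cong (f S *_) (ind-≡ᵇ-∑ (suc n) ∣ S ∣ (s≤s (∣p∣≤n S))) ⟩
    f S * 1 ≡⟨ *-identityʳ (f S) ⟩
    f S ∎
    where open ≡-Reasoning

card-uniform : ∀ {n} k (F : Family n) → Uniform k F → card F ≡ lev k F
card-uniform k F u = trans (card≡∑ F) (∑-cong pt)
  where
  pt : ∀ S → ind (F S) ≡ ind (∣ S ∣ ≡ᵇ k) * ind (F S)
  pt S with F S in eq
  ... | false = sym (*-zeroʳ (ind (∣ S ∣ ≡ᵇ k)))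
  ... | true rewrite u S eq | ≡ᵇ-refl k = refl

-- Binomial coefficients

C-zero : ∀ n → n C 0 ≡ 1
C-zero zero = refl
C-zero (suc n) = refl

C-pascal : ∀ n k → suc n C suc k ≡ n C k + n C suc k
C-pascal n k = sym (nCk+nC[k+1]≡[n+1]C[k+1] n k)

C-absorb : ∀ n k → suc k * (suc n C suc k) ≡ suc n * (n C k)
C-absorb zero zero = refl
C-absorb zero (suc k) = *-zeroʳ k
C-absorb (suc n) zero = begin
  1 * (suc (suc n) C 1) ≡⟨ cong (1 *_) (C-pascal (suc n) 0) ⟩
  1 * (suc n C 0 + suc n C 1) ≡⟨ cong (λ z → 1 * (z + suc n C 1)) (C-zero (suc n)) ⟩
  1 * (1 + suc n C 1) ≡⟨ lem (suc n C 1) ⟩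
  1 + 1 * (suc n C 1) ≡⟨ cong suc (C-absorb n 0) ⟩
  1 + suc n * (n C 0) ≡⟨ cong (λ z → 1 + suc n * z) (C-zero n) ⟩
  suc (suc n) * 1 ≡⟨ cong (suc (suc n) *_) (sym (C-zero (suc n))) ⟩
  suc (suc n) * (suc n C 0) ∎
  where
  open ≡-Reasoning
  lem : ∀ x → 1 * (1 + x) ≡ 1 + 1 * x
  lem = solve-∀
C-absorb (suc n) (suc k) = begin
  suc (suc k) * (suc (suc n) C suc (suc k)) ≡⟨ cong (suc (suc k) *_) (C-pascal (suc n) (suc k)) ⟩
  suc (suc k) * (suc n C suc k + suc n C suc (suc k)) ≡⟨ lem k (suc n C suc k) (suc n C suc (suc k)) ⟩
  suc k * (suc n C suc k) + suc n C suc k + suc (suc k) * (suc n C suc (suc k)) ≡⟨ cong₂ (λ a b → a + suc n C suc k + b) (C-absorb n k) (C-absorb n (suc k)) ⟩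
  suc n * (n C k) + suc n C suc k + suc n * (n C suc k) ≡⟨ lem2 n (n C k) (n C suc k) (suc n C suc k) ⟩
  suc n * (n C k + n C suc k) + suc n C suc k ≡⟨ cong (λ z → suc n * z + suc n C suc k) (sym (C-pascal n k)) ⟩
  suc n * (suc n C suc k) + suc n C suc k ≡⟨ +-comm (suc n * (suc n C suc k)) _ ⟩
  suc (suc n) * (suc n C suc k) ∎
  where
  open ≡-Reasoning
  lem : ∀ k x y → suc (suc k) * (x + y) ≡ suc k * x + x + suc (suc k) * y
  lem = solve-∀
  lem2 : ∀ n x y z → suc n * x + z + suc n * y ≡ suc n * (x + y) + z
  lem2 = solve-∀

C-step+ : ∀ n k → suc k * (n C suc k) + k * (n C k) ≡ n * (n C k)
C-step+ zero zero = refl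
C-step+ zero (suc k) = trans (cong (_+ suc k * 0) (*-zeroʳ k)) (*-zeroʳ k)
C-step+ (suc n) zero = trans (+-identityʳ _) (trans (C-absorb n 0) (cong (suc n *_) (trans (C-zero n) (sym (C-zero (suc n))))))
C-step+ (suc n) (suc k) = begin
  suc (suc k) * (suc n C suc (suc k)) + suc k * (suc n C suc k) ≡⟨ cong₂ _+_ (C-absorb n (suc k)) (C-absorb n k) ⟩
  suc n * (n C suc k) + suc n * (n C k) ≡⟨ lem n (n C suc k) (n C k) ⟩
  suc n * (n C k + n C suc k) ≡⟨ cong (suc n *_) (sym (C-pascal n k)) ⟩
  suc n * (suc n C suc k) ∎
  where
  open ≡-Reasoning
  lem : ∀ n x y → suc n * x + suc n * y ≡ suc n * (y + x)
  lem = solve-∀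

C-step : ∀ n k → suc k * (n C suc k) ≡ (n ∸ k) * (n C k)
C-step n k = trans (sym (m+n∸n≡m _ (k * (n C k)))) (trans (cong (_∸ k * (n C k)) (C-step+ n k)) (sym (*-distribʳ-∸ (n C k) n k)))

C-top-step : ∀ n k → (suc n ∸ k) * (suc n C k) ≡ suc n * (n C k)
C-top-step n k = trans (sym (C-step (suc n) k)) (C-absorb n k)

C-pos : ∀ {n k} → k ≤ n → 1 ≤ n C k
C-pos {n} {zero} h = ≤-reflexive (sym (C-zero n))
C-pos {suc n} {suc k} (s≤s h) = ≤-trans (C-pos h) (≤-trans (m≤m+n _ _) (≤-reflexive (sym (C-pascal n k))))

lev-all : ∀ n l → lev {n} l all ≡ n C l
lev-all zero zero = refl
lev-all zero (suc l) = refl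
lev-all (suc n) zero = trans (lev-outside {n} all) (trans (lev-all n 0) (trans (C-zero n) (sym (C-zero (suc n)))))
lev-all (suc n) (suc l) = trans (cong₂ _+_ (lev-all n (suc l)) (lev-all n l)) (trans (+-comm (n C suc l) _) (sym (C-pascal n l)))

lev≤C : ∀ {n} l (F : Family n) → lev l F ≤ n C l
lev≤C {n} l F = ≤-trans (lev-mono {n} l {F} {all} (λ S _ _ → refl)) (≤-reflexive (lev-all n l))

-- Inclusion, links and the Kruskal-Katona theorem

infix 4 _⊑_

-- The constructors follow the outside/inside split by which `∑` and `μ` recurse: `keep` passes
-- monotonicity to both halves of a family, and `add` compares the halves with each other.
data _⊑_ : ∀ {n} → Subset n → Subset n → Set where
  []   : [] ⊑ []
  keep : ∀ {n} {A B : Subset n} x → A ⊑ B → (x ∷ A) ⊑ (x ∷ B)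
  add  : ∀ {n} {A B : Subset n} → A ⊑ B → (outside ∷ A) ⊑ (inside ∷ B)

⊑-refl : ∀ {n} (A : Subset n) → A ⊑ A
⊑-refl []      = []
⊑-refl (x ∷ A) = keep x (⊑-refl A)

⊑-trans : ∀ {n} {A B C : Subset n} → A ⊑ B → B ⊑ C → A ⊑ C
⊑-trans [] [] = []
⊑-trans (keep x h) (keep .x g) = keep x (⊑-trans h g)
⊑-trans (keep .outside h) (add g) = add (⊑-trans h g)
⊑-trans (add h) (keep .inside g) = add (⊑-trans h g)

⊑-size : ∀ {n} {A B : Subset n} → A ⊑ B → ∣ A ∣ ≤ ∣ B ∣
⊑-size [] = z≤n
⊑-size (keep false h) = ⊑-size h
⊑-size (keep true h) = s≤s (⊑-size h)
⊑-size (add h) = m≤n⇒m≤1+n (⊑-size h)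

⊑-size-≡ : ∀ {n} {A B : Subset n} → A ⊑ B → ∣ B ∣ ≤ ∣ A ∣ → A ≡ B
⊑-size-≡ [] _ = refl
⊑-size-≡ (keep false h) g = cong (false ∷_) (⊑-size-≡ h g)
⊑-size-≡ (keep true h) (s≤s g) = cong (true ∷_) (⊑-size-≡ h g)
⊑-size-≡ (add h) g = ⊥-elim (<-irrefl refl (≤-trans g (⊑-size h)))

empty⊑ : ∀ {n} (A B : Subset n) → ∣ A ∣ ≡ 0 → A ⊑ B
empty⊑ [] [] _ = []
empty⊑ (false ∷ A) (false ∷ B) h = keep false (empty⊑ A B h)
empty⊑ (false ∷ A) (true ∷ B)  h = add (empty⊑ A B h)
empty⊑ (true ∷ A) (_ ∷ B) ()

Up Down : ∀ {n} → Family n → Set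
Up   F = ∀ {A B} → A ⊑ B → F A ≡ true → F B ≡ true
Down F = ∀ {A B} → A ⊑ B → F B ≡ true → F A ≡ true

not-injective-true : ∀ {a} → not a ≡ true → a ≡ false
not-injective-true {false} _ = refl

not-Down : ∀ {n} {F : Family n} → Up F → Down (λ S → not (F S))
not-Down {F = F} u {A} {B} h e with F A in eq
... | false = refl
... | true with F B | u h eq
...   | true | _ = e

mem : ∀ {n} → Fin n → Subset n → Bool
mem v S = lookup S v

ins del : ∀ {n} → Fin n → Subset n → Subset n
ins v S = S [ v ]≔ inside
del v S = S [ v ]≔ outside

ins-⊒ : ∀ {n} (v : Fin n) S → S ⊑ ins v S
ins-⊒ zero (false ∷ S) = add (⊑-refl S)
ins-⊒ zero (true ∷ S) = ⊑-refl _
ins-⊒ (suc v) (x ∷ S) = keep x (ins-⊒ v S)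

del-⊑ : ∀ {n} (v : Fin n) S → del v S ⊑ S
del-⊑ zero (false ∷ S) = ⊑-refl _
del-⊑ zero (true ∷ S) = add (⊑-refl S)
del-⊑ (suc v) (x ∷ S) = keep x (del-⊑ v S)

ins-mono : ∀ {n} (v : Fin n) {A B} → A ⊑ B → ins v A ⊑ ins v B
ins-mono zero (keep x h) = keep true h
ins-mono zero (add h) = keep true h
ins-mono (suc v) (keep x h) = keep x (ins-mono v h)
ins-mono (suc v) (add h) = add (ins-mono v h)

del-mono : ∀ {n} (v : Fin n) {A B} → A ⊑ B → del v A ⊑ del v B
del-mono zero (keep x h) = keep false h
del-mono zero (add h) = keep false h
del-mono (suc v) (keep x h) = keep x (del-mono v h)
del-mono (suc v) (add h) = add (del-mono v h)

mem-mono : ∀ {n} (v : Fin n) {A B} → A ⊑ B → mem v A ≡ true → mem v B ≡ true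
mem-mono zero (keep x h) e = e
mem-mono zero (add h) e = refl
mem-mono (suc v) (keep x h) e = mem-mono v h e
mem-mono (suc v) (add h) e = mem-mono v h e

ins-size : ∀ {n} (v : Fin n) S → mem v S ≡ false → ∣ ins v S ∣ ≡ suc ∣ S ∣
ins-size zero (false ∷ S) h = refl
ins-size (suc v) (false ∷ S) h = ins-size v S h
ins-size (suc v) (true ∷ S) h = cong suc (ins-size v S h)

ind-∧ : ∀ a b → ind (a ∧ b) ≡ ind a * ind b
ind-∧ true b = sym (+-identityʳ _)
ind-∧ false b = refl

∧-left : ∀ {a b} → a ∧ b ≡ true → a ≡ true
∧-left {true} h = refl

∧-right : ∀ {a b} → a ∧ b ≡ true → b ≡ true
∧-right {true} h = h

∧-both : ∀ {a b} → a ≡ true → b ≡ true → a ∧ b ≡ true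
∧-both refl refl = refl

∑-ins : ∀ {n} (v : Fin n) (f : Subset n → ℕ) →
  ∑ (λ S → ind (not (mem v S)) * f (ins v S)) ≡ ∑ (λ S → ind (mem v S) * f S)
∑-ins {suc n} zero f = trans (cong (∑ (λ S → 1 * f (inside ∷ S)) +_) (∑-zero {n}))
  (trans (+-comm (∑ (λ S → 1 * f (inside ∷ S))) 0) (cong (_+ ∑ (λ S → 1 * f (inside ∷ S))) (sym (∑-zero {n}))))
∑-ins {suc n} (suc v) f = cong₂ _+_ (∑-ins {n} v (λ S → f (outside ∷ S))) (∑-ins {n} v (λ S → f (inside ∷ S)))

∑F-mem : ∀ {n} (S : Subset n) → ∑F (λ v → ind (mem v S)) ≡ ∣ S ∣
∑F-mem [] = refl
∑F-mem (false ∷ S) = ∑F-mem S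
∑F-mem (true ∷ S) = cong suc (∑F-mem S)

-- The link stays on the same ground set, as a family of sets missing v, so that the induction on
-- links needs no re-indexing of the cube.
link : ∀ {n} → Family n → Fin n → Family n
link G v S = not (mem v S) ∧ G (ins v S)

link-Down : ∀ {n} {G : Family n} → Down G → ∀ v → Down (link G v)
link-Down {G = G} d v {A} {B} h e = ∧-both (not-Down {F = mem v} (mem-mono v) h (∧-left e)) (d (ins-mono v h) (∧-right {not (mem v B)} e))

lev-link : ∀ {n} (G : Family n) v j → lev j (link G v) ≡ ∑ (λ S → ind (mem v S) * (ind (∣ S ∣ ≡ᵇ suc j) * ind (G S)))
lev-link {n} G v j = trans (∑-cong {n} pt) (∑-ins v (λ S → ind (∣ S ∣ ≡ᵇ suc j) * ind (G S)))
  where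
  pt : ∀ S → ind (∣ S ∣ ≡ᵇ j) * ind (link G v S) ≡ ind (not (mem v S)) * (ind (∣ ins v S ∣ ≡ᵇ suc j) * ind (G (ins v S)))
  pt S with mem v S in eq
  ... | true  = *-zeroʳ (ind (∣ S ∣ ≡ᵇ j))
  ... | false rewrite ins-size v S eq = sym (+-identityʳ _)

∑-lev-link : ∀ {n} (G : Family n) j → ∑F (λ v → lev j (link G v)) ≡ suc j * lev (suc j) G
∑-lev-link {n} G j = begin
  ∑F (λ v → lev j (link G v)) ≡⟨ ∑F-cong (λ v → lev-link G v j) ⟩
  ∑F (λ v → ∑ (λ S → ind (mem v S) * w S)) ≡⟨ ∑F-∑ (λ v S → ind (mem v S) * w S) ⟩
  ∑ (λ S → ∑F (λ v → ind (mem v S) * w S)) ≡⟨ ∑-cong {n} pt ⟩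
  ∑ (λ S → suc j * w S) ≡⟨ ∑-*ˡ (suc j) w ⟩
  suc j * lev (suc j) G ∎
  where
  open ≡-Reasoning
  w : Subset n → ℕ
  w S = ind (∣ S ∣ ≡ᵇ suc j) * ind (G S)
  pt : ∀ S → ∑F (λ v → ind (mem v S) * w S) ≡ suc j * w S
  pt S = begin
    ∑F (λ v → ind (mem v S) * w S) ≡⟨ ∑F-cong (λ v → *-comm (ind (mem v S)) (w S)) ⟩
    ∑F (λ v → w S * ind (mem v S)) ≡⟨ ∑F-*ˡ (w S) (λ v → ind (mem v S)) ⟩
    w S * ∑F (λ v → ind (mem v S)) ≡⟨ cong (w S *_) (∑F-mem S) ⟩
    w S * ∣ S ∣ ≡⟨ *-assoc (ind (∣ S ∣ ≡ᵇ suc j)) (ind (G S)) ∣ S ∣ ⟩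
    ind (∣ S ∣ ≡ᵇ suc j) * (ind (G S) * ∣ S ∣) ≡⟨ ind-lev-cong ∣ S ∣ (suc j) (λ e → cong (ind (G S) *_) e) ⟩
    ind (∣ S ∣ ≡ᵇ suc j) * (ind (G S) * suc j) ≡⟨ sym (*-assoc (ind (∣ S ∣ ≡ᵇ suc j)) (ind (G S)) (suc j)) ⟩
    w S * suc j ≡⟨ *-comm (w S) (suc j) ⟩
    suc j * w S ∎

-- If S misses v and S with v added is in G, then S itself is in G by closure; the members of G
-- through v correspond to level j of the link.
link-split : ∀ {n} (G : Family n) → Down G → ∀ v j → lev (suc j) (link G v) + lev j (link G v) ≤ lev (suc j) G
link-split {n} G d v j = begin
  lev (suc j) (link G v) + lev j (link G v) ≤⟨ +-mono-≤ (∑-mono {n} pt) (≤-reflexive (lev-link G v j)) ⟩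
  ∑ (λ S → ind (not (mem v S)) * w S) + ∑ (λ S → ind (mem v S) * w S) ≡⟨ sym (∑-+ (λ S → ind (not (mem v S)) * w S) (λ S → ind (mem v S) * w S)) ⟩
  ∑ (λ S → ind (not (mem v S)) * w S + ind (mem v S) * w S) ≡⟨ ∑-cong {n} (λ S → trans (sym (*-distribʳ-+ (w S) (ind (not (mem v S))) (ind (mem v S)))) (trans (cong (_* w S) (ind-not (mem v S))) (+-identityʳ (w S)))) ⟩
  lev (suc j) G ∎
  where
  open ≤-Reasoning
  w : Subset n → ℕ
  w S = ind (∣ S ∣ ≡ᵇ suc j) * ind (G S)
  pt : ∀ S → ind (∣ S ∣ ≡ᵇ suc j) * ind (link G v S) ≤ ind (not (mem v S)) * w S
  pt S with mem v S
  ... | true = ≤-reflexive (*-zeroʳ (ind (∣ S ∣ ≡ᵇ suc j)))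
  ... | false = ≤-trans (*-monoʳ-≤ (ind (∣ S ∣ ≡ᵇ suc j)) (ind-mono (d (ins-⊒ v S)))) (≤-reflexive (sym (+-identityʳ _)))

lev-zero : ∀ {n} j (G : Family n) → Down G → lev 0 G ≡ 0 → lev j G ≡ 0
lev-zero {n} j G d h = trans (∑-cong {n} pt) (∑-zero {n})
  where
  ∅ : ∀ n → Σ (Subset n) λ S → ∣ S ∣ ≡ 0
  ∅ zero = [] , refl
  ∅ (suc n) = outside ∷ proj₁ (∅ n) , proj₂ (∅ n)
  pt : ∀ S → ind (∣ S ∣ ≡ᵇ j) * ind (G S) ≡ 0
  pt S with G S in eq
  ... | false = *-zeroʳ (ind (∣ S ∣ ≡ᵇ j))
  ... | true = ⊥-elim (1+n≰n (≤-trans (subst (λ z → 1 ≤ lev z G) (proj₂ (∅ n)) (lev-pos G (proj₁ (∅ n)) (d (empty⊑ _ S (proj₂ (∅ n))) eq))) (≤-reflexive h)))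

-- Keevash's argument for the Lovász form of the Kruskal–Katona theorem: a vertex of large degree is handled by
-- link-split, a vertex of small degree by induction on its link.
shadow+ : ∀ {n} j X (G : Family n) → Down G → lev (suc j) G ≤ X C suc j →
  suc (suc j) * lev (suc (suc j)) G + suc j * lev (suc j) G ≤ X * lev (suc j) G
shadow+ {n} j X G d h = *-cancelˡ-≤ (suc j) (begin
    suc j * (suc (suc j) * lev (suc (suc j)) G + suc j * lev (suc j) G) ≡⟨ cong₂ (λ a b → suc j * (a + b)) (sym (∑-lev-link G (suc j))) (sym (∑-lev-link G j)) ⟩
    suc j * (∑F K + ∑F deg) ≡⟨ cong (suc j *_) (sym (∑F-+ K deg)) ⟩
    suc j * ∑F (λ v → K v + deg v) ≡⟨ sym (∑F-*ˡ (suc j) (λ v → K v + deg v)) ⟩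
    ∑F (λ v → suc j * (K v + deg v)) ≤⟨ ∑F-mono (vertex j X h) ⟩
    ∑F (λ v → X * deg v) ≡⟨ ∑F-*ˡ X deg ⟩
    X * ∑F deg ≡⟨ cong (X *_) (∑-lev-link G j) ⟩
    X * (suc j * lev (suc j) G) ≡⟨ swap X (suc j) (lev (suc j) G) ⟩
    suc j * (X * lev (suc j) G) ∎)
  where
  open ≤-Reasoning
  swap : ∀ a b c → a * (b * c) ≡ b * (a * c)
  swap = solve-∀
  K deg : Fin n → ℕ
  K v = lev (suc j) (link G v)
  deg v = lev j (link G v)
  -- For a degree of at least `X₁ C j`, absorption turns the bound on the whole level into a
  -- multiple of the degree.
  large : ∀ j X v → lev (suc j) G ≤ X C suc j → (∀ X₁ → X ≡ suc X₁ → X₁ C j ≤ lev j (link G v)) →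
    suc j * (lev (suc j) (link G v) + lev j (link G v)) ≤ X * lev j (link G v)
  large j zero v h _ = ≤-trans (*-monoʳ-≤ (suc j) (≤-trans (link-split G d v j) h)) (≤-reflexive (*-zeroʳ (suc j)))
  large j (suc X) v h g = begin
    suc j * (lev (suc j) (link G v) + lev j (link G v)) ≤⟨ *-monoʳ-≤ (suc j) (≤-trans (link-split G d v j) h) ⟩
    suc j * (suc X C suc j) ≡⟨ C-absorb X j ⟩
    suc X * (X C j) ≤⟨ *-monoʳ-≤ (suc X) (g X refl) ⟩
    suc X * lev j (link G v) ∎
  vertex : ∀ j X → lev (suc j) G ≤ X C suc j → ∀ v →
    suc j * (lev (suc j) (link G v) + lev j (link G v)) ≤ X * lev j (link G v)
  vertex j zero h v = large j zero v h (λ _ ())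
  vertex j (suc X) h v with X C j ≤? lev j (link G v)
  ... | yes g = large j (suc X) v h (λ { _ refl → g })
  -- Fewer than `X C 0` = 1 sets at level 0: the link is empty.
  vertex zero (suc X) h v | no g = ≤-trans (≤-reflexive (cong (1 *_) (cong₂ _+_ (lev-zero 1 (link G v) (link-Down d v) z) z))) z≤n
    where
    z : lev 0 (link G v) ≡ 0
    z = n<1⇒n≡0 (≤-trans (≰⇒> g) (≤-reflexive (C-zero X)))
  vertex (suc j) (suc X) h v | no g = begin
    suc (suc j) * (a + b) ≡⟨ lem j a b ⟩
    (suc (suc j) * a + suc j * b) + b ≤⟨ +-monoˡ-≤ b (shadow+ j X (link G v) (link-Down d v) (<⇒≤ (≰⇒> g))) ⟩
    X * b + b ≡⟨ +-comm (X * b) b ⟩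
    suc X * b ∎
    where
    a = lev (suc (suc j)) (link G v)
    b = lev (suc j) (link G v)
    lem : ∀ j a b → suc (suc j) * (a + b) ≡ (suc (suc j) * a + suc j * b) + b
    lem = solve-∀

shadow : ∀ {n} j X (G : Family n) → Down G → lev (suc j) G ≤ X C suc j →
  suc (suc j) * lev (suc (suc j)) G ≤ (X ∸ suc j) * lev (suc j) G
shadow j X G d h = ≤-trans (m+n≤o⇒m≤o∸n _ (shadow+ j X G d h)) (≤-reflexive (sym (*-distribʳ-∸ (lev (suc j) G) X (suc j))))

-- The two halves need each other: the bound by `X C _` licenses `shadow` at the next level, and
-- `shadow` makes the density relative to an X-point cube decrease, which preserves the bound.
shadow-chain : ∀ {n} j X (G : Family n) → Down G → lev (suc j) G ≤ X C suc j → ∀ i →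
  lev (i + suc j) G ≤ X C (i + suc j) × lev (i + suc j) G * (X C suc j) ≤ lev (suc j) G * (X C (i + suc j))
shadow-chain j X G d h zero = h , ≤-refl
shadow-chain {n} j X G d h (suc i) with shadow-chain j X G d h i
... | p , q = *-cancelˡ-≤ (suc l) a , *-cancelˡ-≤ (suc l) b
  where
  open ≤-Reasoning
  l = i + suc j
  st : suc l * lev (suc l) G ≤ (X ∸ l) * lev l G
  st = subst (λ z → suc z * lev (suc z) G ≤ (X ∸ z) * lev z G) (sym (+-suc i j))
         (shadow (i + j) X G d (subst (λ z → lev z G ≤ X C z) (+-suc i j) p))
  swap : ∀ a b c → a * (b * c) ≡ b * (a * c)
  swap = solve-∀
  a : suc l * lev (suc l) G ≤ suc l * (X C suc l)
  a = begin
    suc l * lev (suc l) G ≤⟨ st ⟩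
    (X ∸ l) * lev l G ≤⟨ *-monoʳ-≤ (X ∸ l) p ⟩
    (X ∸ l) * (X C l) ≡⟨ sym (C-step X l) ⟩
    suc l * (X C suc l) ∎
  b : suc l * (lev (suc l) G * (X C suc j)) ≤ suc l * (lev (suc j) G * (X C suc l))
  b = begin
    suc l * (lev (suc l) G * (X C suc j)) ≡⟨ sym (*-assoc (suc l) (lev (suc l) G) (X C suc j)) ⟩
    suc l * lev (suc l) G * (X C suc j) ≤⟨ *-monoˡ-≤ (X C suc j) st ⟩
    (X ∸ l) * lev l G * (X C suc j) ≡⟨ *-assoc (X ∸ l) (lev l G) (X C suc j) ⟩
    (X ∸ l) * (lev l G * (X C suc j)) ≤⟨ *-monoʳ-≤ (X ∸ l) q ⟩
    (X ∸ l) * (lev (suc j) G * (X C l)) ≡⟨ swap (X ∸ l) (lev (suc j) G) (X C l) ⟩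
    lev (suc j) G * ((X ∸ l) * (X C l)) ≡⟨ cong (lev (suc j) G *_) (sym (C-step X l)) ⟩
    lev (suc j) G * (suc l * (X C suc l)) ≡⟨ swap (lev (suc j) G) (suc l) (X C suc l) ⟩
    suc l * (lev (suc j) G * (X C suc l)) ∎

-- Product measures

-- Unnormalised: the weights of a point being in and out of the set are α and β, the total mass is (α + β) ^ n.
μ : ∀ {n} → ℕ → ℕ → Family n → ℕ
μ {zero}  α β F = ind (F [])
μ {suc n} α β F = β * μ α β (λ S → F (outside ∷ S)) + α * μ α β (λ S → F (inside ∷ S))

μ-mono : ∀ {n} α β {F G : Family n} → (∀ S → F S ≡ true → G S ≡ true) → μ α β F ≤ μ α β G
μ-mono {zero}  α β h = ind-mono (h [])
μ-mono {suc n} α β h = +-mono-≤ (*-monoʳ-≤ β (μ-mono {n} α β (λ S → h (outside ∷ S)))) (*-monoʳ-≤ α (μ-mono {n} α β (λ S → h (inside ∷ S))))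

μ-cong : ∀ {n} α β {F G : Family n} → (∀ S → F S ≡ G S) → μ α β F ≡ μ α β G
μ-cong {zero}  α β h = cong ind (h [])
μ-cong {suc n} α β h = cong₂ (λ x y → β * x + α * y) (μ-cong {n} α β (λ S → h (outside ∷ S))) (μ-cong {n} α β (λ S → h (inside ∷ S)))

μ-all : ∀ n α β → μ {n} α β all ≡ (α + β) ^ n
μ-all zero    α β = refl
μ-all (suc n) α β rewrite μ-all n α β = lem α β ((α + β) ^ n)
  where
  lem : ∀ α β t → β * t + α * t ≡ (α + β) * t
  lem = solve-∀

μ-compl : ∀ {n} α β (F : Family n) → μ α β (λ S → not (F S)) + μ α β F ≡ (α + β) ^ n
μ-compl {zero}  α β F = ind-not (F [])
μ-compl {suc n} α β F = trans (lem α β _ _ _ _) (trans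
  (cong₂ (λ x y → β * x + α * y) (μ-compl {n} α β (λ S → F (outside ∷ S))) (μ-compl {n} α β (λ S → F (inside ∷ S))))
  (lem2 α β ((α + β) ^ n)))
  where
  lem : ∀ α β a b c d → (β * a + α * b) + (β * c + α * d) ≡ β * (a + c) + α * (b + d)
  lem = solve-∀
  lem2 : ∀ α β t → β * t + α * t ≡ (α + β) * t
  lem2 = solve-∀

μ≤total : ∀ {n} α β (F : Family n) → μ α β F ≤ (α + β) ^ n
μ≤total {n} α β F = ≤-trans (μ-mono {n} α β {F} {all} (λ _ _ → refl)) (≤-reflexive (μ-all n α β))

μ-∁ : ∀ {n} α β (F : Family n) → μ α β (λ S → F (∁ S)) ≡ μ β α F
μ-∁ {zero}  α β F = refl
μ-∁ {suc n} α β F = trans (cong₂ (λ x y → β * x + α * y) (μ-∁ {n} α β (λ S → F (inside ∷ S))) (μ-∁ {n} α β (λ S → F (outside ∷ S)))) (+-comm (β * μ β α (λ S → F (inside ∷ S))) _)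

μ-∨ : ∀ {n} α β (F G : Family n) → μ α β (λ S → F S ∨ G S) ≤ μ α β F + μ α β G
μ-∨ {zero} α β F G with F [] | G []
... | true  | _ = s≤s z≤n
... | false | _ = ≤-refl
μ-∨ {suc n} α β F G = ≤-trans (+-mono-≤ (*-monoʳ-≤ β (μ-∨ {n} α β (λ S → F (outside ∷ S)) (λ S → G (outside ∷ S)))) (*-monoʳ-≤ α (μ-∨ {n} α β (λ S → F (inside ∷ S)) (λ S → G (inside ∷ S)))))
  (≤-reflexive (lem α β _ _ _ _))
  where
  lem : ∀ α β a b c d → β * (a + b) + α * (c + d) ≡ β * a + α * c + (β * b + α * d)
  lem = solve-∀

-- Sections are families on all n points that ignore v, so they have the same total mass as F; this
-- accounts for the factor α + β.
μ-coord : ∀ {n} α β (F : Family n) (v : Fin n) →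
  α * μ α β (λ S → F (ins v S)) + β * μ α β (λ S → F (del v S)) ≡ (α + β) * μ α β F
μ-coord {suc n} α β F zero = lem α β (μ α β (λ S → F (outside ∷ S))) (μ α β (λ S → F (inside ∷ S)))
  where
  lem : ∀ α β x y → α * (β * y + α * y) + β * (β * x + α * x) ≡ (α + β) * (β * x + α * y)
  lem = solve-∀
μ-coord {suc n} α β F (suc v) = trans (lem α β _ _ _ _)
  (trans (cong₂ (λ x y → β * x + α * y) (μ-coord {n} α β (λ S → F (outside ∷ S)) v) (μ-coord {n} α β (λ S → F (inside ∷ S)) v))
   (lem2 α β (μ α β (λ S → F (outside ∷ S))) (μ α β (λ S → F (inside ∷ S)))))
  where
  lem : ∀ α β a b c d → α * (β * a + α * b) + β * (β * c + α * d) ≡ β * (α * a + β * c) + α * (α * b + β * d)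
  lem = solve-∀
  lem2 : ∀ α β a b → β * ((α + β) * a) + α * ((α + β) * b) ≡ (α + β) * (β * a + α * b)
  lem2 = solve-∀

-- Two-point inductions: Harris, Poincaré, expansion

Up-tail : ∀ {n} {F : Family (suc n)} → Up F → ∀ x → Up (λ S → F (x ∷ S))
Up-tail u x h = u (keep x h)

Down-tail : ∀ {n} {F : Family (suc n)} → Down F → ∀ x → Down (λ S → F (x ∷ S))
Down-tail u x h = u (keep x h)

μ-Up : ∀ {n} α β (F : Family (suc n)) → Up F → μ α β (λ S → F (outside ∷ S)) ≤ μ α β (λ S → F (inside ∷ S))
μ-Up {n} α β F u = μ-mono {n} α β (λ S → u (add (⊑-refl S)))

μ-Down : ∀ {n} α β (F : Family (suc n)) → Down F → μ α β (λ S → F (inside ∷ S)) ≤ μ α β (λ S → F (outside ∷ S))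
μ-Down {n} α β F u = μ-mono {n} α β (λ S → u (add (⊑-refl S)))

-- Chebyshev's inequality on two points: with y and z the drops of u and v, the slack is exactly
-- αβyz.
harris-step : ∀ α β t u₀ u₁ v₀ v₁ x₀ x₁ → u₁ ≤ u₀ → v₁ ≤ v₀ → u₀ * v₀ ≤ t * x₀ → u₁ * v₁ ≤ t * x₁ →
  (β * u₀ + α * u₁) * (β * v₀ + α * v₁) ≤ (α + β) * t * (β * x₀ + α * x₁)
harris-step α β t u₀ u₁ v₀ v₁ x₀ x₁ hu hv h₀ h₁ with m≤n⇒∃[o]m+o≡n hu | m≤n⇒∃[o]m+o≡n hv
... | (y , refl) | (z , refl) = begin
  (β * (u₁ + y) + α * u₁) * (β * (v₁ + z) + α * v₁) ≤⟨ m≤m+n _ (α * β * (y * z)) ⟩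
  (β * (u₁ + y) + α * u₁) * (β * (v₁ + z) + α * v₁) + α * β * (y * z) ≡⟨ lem α β u₁ y v₁ z ⟩
  (α + β) * (β * ((u₁ + y) * (v₁ + z)) + α * (u₁ * v₁)) ≤⟨ *-monoʳ-≤ (α + β) (+-mono-≤ (*-monoʳ-≤ β h₀) (*-monoʳ-≤ α h₁)) ⟩
  (α + β) * (β * (t * x₀) + α * (t * x₁)) ≡⟨ lem2 α β t x₀ x₁ ⟩
  (α + β) * t * (β * x₀ + α * x₁) ∎
  where
  open ≤-Reasoning
  lem : ∀ α β u y v z → (β * (u + y) + α * u) * (β * (v + z) + α * v) + α * β * (y * z) ≡ (α + β) * (β * ((u + y) * (v + z)) + α * (u * v))
  lem = solve-∀
  lem2 : ∀ α β t x₀ x₁ → (α + β) * (β * (t * x₀) + α * (t * x₁)) ≡ (α + β) * t * (β * x₀ + α * x₁)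
  lem2 = solve-∀

harris : ∀ {n} α β (F G : Family n) → Down F → Down G → μ α β F * μ α β G ≤ (α + β) ^ n * μ α β (λ S → F S ∧ G S)
harris {zero} α β F G dF dG = ≤-reflexive (trans (sym (ind-∧ (F []) (G []))) (sym (+-identityʳ _)))
harris {suc n} α β F G dF dG = harris-step α β ((α + β) ^ n) _ _ _ _ _ _ (μ-Down α β F dF) (μ-Down α β G dG)
  (harris {n} α β (λ S → F (outside ∷ S)) (λ S → G (outside ∷ S)) (Down-tail dF outside) (Down-tail dG outside))
  (harris {n} α β (λ S → F (inside ∷ S)) (λ S → G (inside ∷ S)) (Down-tail dF inside) (Down-tail dG inside))

-- With z = u₁ - u₀, the first coordinate adds pq z² to the variance and pq z t to the influence
-- term; what is left over, z (t - z) = z (u₀ + w), is the slack.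
poincare-step : ∀ α β m t u₀ u₁ s₀ s₁ → u₀ ≤ u₁ → u₁ ≤ t →
  (α + β) * u₀ * t + β * t * s₀ ≤ (α + β) * u₀ * u₀ + β * t * (m * u₀) →
  (α + β) * u₁ * t + β * t * s₁ ≤ (α + β) * u₁ * u₁ + β * t * (m * u₁) →
  (α + β) * (β * u₀ + α * u₁) * ((α + β) * t) + β * ((α + β) * t) * ((β * u₀ + α * u₀) + (β * s₀ + α * s₁)) ≤
  (α + β) * (β * u₀ + α * u₁) * (β * u₀ + α * u₁) + β * ((α + β) * t) * (suc m * (β * u₀ + α * u₁))
poincare-step α β m t u₀ u₁ s₀ s₁ hu ht h₀ h₁ with m≤n⇒∃[o]m+o≡n hu | m≤n⇒∃[o]m+o≡n ht
... | (z , refl) | (w , refl) = +-cancelʳ-≤ ((α + β) * β * R₀ + (α + β) * α * R₁) _ _ (begin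
  L + ((α + β) * β * R₀ + (α + β) * α * R₁) ≤⟨ m≤m+n _ (α * β * (α + β) * (z * (u₀ + w))) ⟩
  L + ((α + β) * β * R₀ + (α + β) * α * R₁) + α * β * (α + β) * (z * (u₀ + w)) ≡⟨ lem α β m u₀ z w s₀ s₁ ⟩
  R + ((α + β) * β * L₀ + (α + β) * α * L₁) ≤⟨ +-monoʳ-≤ R (+-mono-≤ (*-monoʳ-≤ ((α + β) * β) h₀) (*-monoʳ-≤ ((α + β) * α) h₁)) ⟩
  R + ((α + β) * β * R₀ + (α + β) * α * R₁) ∎)
  where
  open ≤-Reasoning
  T₁ = u₀ + z + w
  L₀ = (α + β) * u₀ * T₁ + β * T₁ * s₀
  R₀ = (α + β) * u₀ * u₀ + β * T₁ * (m * u₀)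
  L₁ = (α + β) * (u₀ + z) * T₁ + β * T₁ * s₁
  R₁ = (α + β) * (u₀ + z) * (u₀ + z) + β * T₁ * (m * (u₀ + z))
  L = (α + β) * (β * u₀ + α * (u₀ + z)) * ((α + β) * T₁) + β * ((α + β) * T₁) * ((β * u₀ + α * u₀) + (β * s₀ + α * s₁))
  R = (α + β) * (β * u₀ + α * (u₀ + z)) * (β * u₀ + α * (u₀ + z)) + β * ((α + β) * T₁) * (suc m * (β * u₀ + α * (u₀ + z)))
  lem : ∀ α β m u₀ z w s₀ s₁ →
    (α + β) * (β * u₀ + α * (u₀ + z)) * ((α + β) * (u₀ + z + w)) + β * ((α + β) * (u₀ + z + w)) * ((β * u₀ + α * u₀) + (β * s₀ + α * s₁))
     + ((α + β) * β * ((α + β) * u₀ * u₀ + β * (u₀ + z + w) * (m * u₀)) + (α + β) * α * ((α + β) * (u₀ + z) * (u₀ + z) + β * (u₀ + z + w) * (m * (u₀ + z))))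
     + α * β * (α + β) * (z * (u₀ + w))
    ≡ (α + β) * (β * u₀ + α * (u₀ + z)) * (β * u₀ + α * (u₀ + z)) + β * ((α + β) * (u₀ + z + w)) * (suc m * (β * u₀ + α * (u₀ + z)))
     + ((α + β) * β * ((α + β) * u₀ * (u₀ + z + w) + β * (u₀ + z + w) * s₀) + (α + β) * α * ((α + β) * (u₀ + z) * (u₀ + z + w) + β * (u₀ + z + w) * s₁))
  lem = solve-∀

-- Normalised, m (1 - m) ≤ q ∑ (m - e_v), where e_v is the measure of the section at x_v = 0. As m -
-- e_v is p times the influence of v, this bounds the variance by pq times the total influence.
poincare : ∀ {n} α β (F : Family n) → Up F →
  (α + β) * μ α β F * (α + β) ^ n + β * (α + β) ^ n * ∑F (λ v → μ α β (λ S → F (del v S))) ≤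
  (α + β) * μ α β F * μ α β F + β * (α + β) ^ n * (n * μ α β F)
poincare {zero} α β F u with F []
... | true  = ≤-refl
... | false = ≤-reflexive (cong (λ z → z + β * 1 * 0) (lem α β))
  where
  lem : ∀ α β → (α + β) * 0 * 1 ≡ (α + β) * 0 * 0
  lem = solve-∀
poincare {suc n} α β F u = subst (λ s → (α + β) * μ α β F * (α + β) ^ suc n + β * (α + β) ^ suc n * (β * U₀ + α * U₀ + s) ≤ (α + β) * μ α β F * μ α β F + β * (α + β) ^ suc n * (suc n * μ α β F)) s-eq
  (poincare-step α β n ((α + β) ^ n) U₀ U₁ _ _ (μ-Up α β F u) (μ≤total {n} α β (λ S → F (inside ∷ S)))
    (poincare {n} α β (λ S → F (outside ∷ S)) (Up-tail u outside)) (poincare {n} α β (λ S → F (inside ∷ S)) (Up-tail u inside)))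
  where
  U₀ = μ α β (λ S → F (outside ∷ S))
  U₁ = μ α β (λ S → F (inside ∷ S))
  s-eq : β * ∑F (λ v → μ α β (λ S → F (outside ∷ del v S))) + α * ∑F (λ v → μ α β (λ S → F (inside ∷ del v S))) ≡
         ∑F (λ v → β * μ α β (λ S → F (outside ∷ del v S)) + α * μ α β (λ S → F (inside ∷ del v S)))
  s-eq = sym (trans (∑F-+ (λ v → β * μ α β (λ S → F (outside ∷ del v S))) (λ v → α * μ α β (λ S → F (inside ∷ del v S))))
          (cong₂ _+_ (∑F-*ˡ β (λ v → μ α β (λ S → F (outside ∷ del v S)))) (∑F-*ˡ α (λ v → μ α β (λ S → F (inside ∷ del v S))))))

*-swap : ∀ a b c → a * (b * c) ≡ b * (a * c)
*-swap = solve-∀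

^-pos : ∀ {b} n → 1 ≤ b → 1 ≤ b ^ n
^-pos {b} n h = subst (_≤ b ^ n) (^-zeroˡ n) (^-monoˡ-≤ n h)

^-distribʳ-* : ∀ n a b → (a * b) ^ n ≡ a ^ n * b ^ n
^-distribʳ-* zero    a b = refl
^-distribʳ-* (suc n) a b = trans (cong (a * b *_) (^-distribʳ-* n a b)) (lem a b (a ^ n) (b ^ n))
  where
  lem : ∀ a b x y → a * b * (x * y) ≡ a * x * (b * y)
  lem = solve-∀

*-pos : ∀ {a b} → 1 ≤ a → 1 ≤ b → 1 ≤ a * b
*-pos h g = *-mono-≤ h g

*-cancelˡ-≤-pos : ∀ a {b c} → 1 ≤ a → a * b ≤ a * c → b ≤ c
*-cancelˡ-≤-pos (suc a) _ h = *-cancelˡ-≤ (suc a) h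

-- With p = α/(α + β) and q = 1 - p, expansion says pq (μ_q(F) - μ_p(F)) ≥ (q - p) μ_p(F) (1 - μ_p(F)).  The induction
-- needs α² ≥ αγ + γ², that is p² - 3p + 1 ≤ 0, which 2γ ≤ α guarantees.

expansion-step : ∀ γ σ t e₀ e₁ n₀ n₁ → let α = 2 * γ + σ ; β = α + γ in
  e₀ ≤ e₁ → e₁ ≤ t →
  α * β * t * e₀ + γ * (α + β) * e₀ * t ≤ α * β * t * n₀ + γ * (α + β) * e₀ * e₀ →
  α * β * t * e₁ + γ * (α + β) * e₁ * t ≤ α * β * t * n₁ + γ * (α + β) * e₁ * e₁ →
  α * β * ((α + β) * t) * (β * e₀ + α * e₁) + γ * (α + β) * (β * e₀ + α * e₁) * ((α + β) * t) ≤
  α * β * ((α + β) * t) * (α * n₀ + β * n₁) + γ * (α + β) * (β * e₀ + α * e₁) * (β * e₀ + α * e₁)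
expansion-step γ σ t e₀ e₁ n₀ n₁ he ht h₀ h₁ with m≤n⇒∃[o]m+o≡n he | m≤n⇒∃[o]m+o≡n ht
... | (z , refl) | (w , refl) = +-cancelʳ-≤ (b * α * R₀ + b * β * R₁) _ _ (begin
  -- The coefficient of e₀ is α² - αγ - γ² expanded in γ and σ; writing α as 2γ + σ makes it visibly
  -- nonnegative.
  L + (b * α * R₀ + b * β * R₁) ≤⟨ m≤m+n _ (γ * b * z * ((γ * γ + 3 * γ * σ + σ * σ) * e₀ + (α * β + b * γ) * w)) ⟩
  L + (b * α * R₀ + b * β * R₁) + γ * b * z * ((γ * γ + 3 * γ * σ + σ * σ) * e₀ + (α * β + b * γ) * w) ≡⟨ lem γ σ e₀ z w n₀ n₁ ⟩
  R + (b * α * L₀ + b * β * L₁) ≤⟨ +-monoʳ-≤ R (+-mono-≤ (*-monoʳ-≤ (b * α) h₀) (*-monoʳ-≤ (b * β) h₁)) ⟩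
  R + (b * α * R₀ + b * β * R₁) ∎)
  where
  open ≤-Reasoning
  α = 2 * γ + σ
  β = α + γ
  b = α + β
  T₁ = e₀ + z + w
  E₁ = e₀ + z
  E = β * e₀ + α * E₁
  L₀ = α * β * T₁ * e₀ + γ * b * e₀ * T₁
  R₀ = α * β * T₁ * n₀ + γ * b * e₀ * e₀
  L₁ = α * β * T₁ * E₁ + γ * b * E₁ * T₁
  R₁ = α * β * T₁ * n₁ + γ * b * E₁ * E₁
  L = α * β * (b * T₁) * E + γ * b * E * (b * T₁)
  R = α * β * (b * T₁) * (α * n₀ + β * n₁) + γ * b * E * E
  lem : ∀ γ σ e₀ z w n₀ n₁ → let
      α = 2 * γ + σ
      β = α + γ
      b = α + β
      T₁ = e₀ + z + w
      E₁ = e₀ + z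
      E = β * e₀ + α * E₁
      L₀ = α * β * T₁ * e₀ + γ * b * e₀ * T₁
      R₀ = α * β * T₁ * n₀ + γ * b * e₀ * e₀
      L₁ = α * β * T₁ * E₁ + γ * b * E₁ * T₁
      R₁ = α * β * T₁ * n₁ + γ * b * E₁ * E₁
      L = α * β * (b * T₁) * E + γ * b * E * (b * T₁)
      R = α * β * (b * T₁) * (α * n₀ + β * n₁) + γ * b * E * E
    in L + (b * α * R₀ + b * β * R₁) + γ * b * z * ((γ * γ + 3 * γ * σ + σ * σ) * e₀ + (α * β + b * γ) * w) ≡ R + (b * α * L₀ + b * β * L₁)
  lem = solve-∀

expansion : ∀ {n} γ σ (F : Family n) → Up F → let α = 2 * γ + σ ; β = α + γ in
  α * β * (α + β) ^ n * μ α β F + γ * (α + β) * μ α β F * (α + β) ^ n ≤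
  α * β * (α + β) ^ n * μ β α F + γ * (α + β) * μ α β F * μ α β F
expansion {zero} γ σ F u with F []
... | true = ≤-refl
... | false = ≤-reflexive (lem ((2 * γ + σ) * (2 * γ + σ + γ) * 1) (γ * (2 * γ + σ + (2 * γ + σ + γ))))
  where
  lem : ∀ x y → x * 0 + y * 0 * 1 ≡ x * 0 + y * 0 * 0
  lem = solve-∀
expansion {suc n} γ σ F u = expansion-step γ σ ((α + β) ^ n) _ _ _ _ (μ-Up α β F u) (μ≤total {n} α β (λ S → F (inside ∷ S)))
    (expansion {n} γ σ (λ S → F (outside ∷ S)) (Up-tail u outside)) (expansion {n} γ σ (λ S → F (inside ∷ S)) (Up-tail u inside))
  where
  α = 2 * γ + σ
  β = α + γ

-- Intersecting families in a product measure

-- For an up-set this is the intersecting property, in the form that suits measures: complementation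
-- exchanges the weights α and β.
Complement-free : ∀ {n} → Family n → Set
Complement-free M = ∀ A → M A ≡ true → M (∁ A) ≡ true → ⊥

not-true : ∀ {a} → (a ≡ true → ⊥) → not a ≡ true
not-true {true} h = ⊥-elim (h refl)
not-true {false} h = refl

μ-disjoint : ∀ {n} α β (F G : Family n) → (∀ S → F S ≡ true → G S ≡ true → ⊥) → μ α β F + μ α β G ≤ (α + β) ^ n
μ-disjoint {n} α β F G h = ≤-trans (+-monoˡ-≤ (μ α β G) (μ-mono {n} α β (λ S f → not-true (h S f)))) (≤-reflexive (μ-compl α β G))

-- As β = α + γ, inserting N ≤ T - E into the expansion inequality and multiplying by b makes it
-- factor as κ (αT - bE) ≥ 0. Here κ = bβT - γbE, defined below as a sum so that its positivity is
-- evident.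
ekr-poly : ∀ α γ T E N → let β = α + γ ; b = α + β in 1 ≤ α → 1 ≤ T → E ≤ T → E + N ≤ T →
  α * β * T * E + γ * b * E * T ≤ α * β * T * N + γ * b * E * E → b * E ≤ α * T
ekr-poly α γ T E N α>0 T>0 E≤T EN q = *-cancelˡ-≤-pos κ κ>0 (+-cancelʳ-≤ (γ * u * u + γ * u * (α * T)) _ _ (begin
    κ * u + (γ * u * u + γ * u * (α * T)) ≡⟨ l1 κ (γ * u) u (α * T) ⟩
    (γ * u + κ) * u + γ * u * (α * T) ≡⟨ cong (λ z → z * u + γ * u * (α * T)) κ-eq ⟩
    b * β * T * u + γ * u * (α * T) ≡⟨ l2 α γ T E ⟩
    b * (α * β * T * E + γ * b * E * T + α * β * T * E) ≤⟨ *-monoʳ-≤ b (begin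
      α * β * T * E + γ * b * E * T + α * β * T * E ≤⟨ +-monoˡ-≤ (α * β * T * E) q ⟩
      α * β * T * N + γ * b * E * E + α * β * T * E ≡⟨ l3 (α * β * T) N (γ * b * E * E) E ⟩
      α * β * T * (E + N) + γ * b * E * E ≤⟨ +-monoˡ-≤ (γ * b * E * E) (*-monoʳ-≤ (α * β * T) EN) ⟩
      α * β * T * T + γ * b * E * E ∎) ⟩
    b * (α * β * T * T + γ * b * E * E) ≡⟨ l4 α β γ b T E ⟩
    b * β * T * (α * T) + γ * u * u ≡⟨ cong (λ z → z * (α * T) + γ * u * u) (sym κ-eq) ⟩
    (γ * u + κ) * (α * T) + γ * u * u ≡⟨ l5 κ (γ * u) u (α * T) ⟩
    κ * (α * T) + (γ * u * u + γ * u * (α * T)) ∎))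
  where
  open ≤-Reasoning
  β = α + γ
  b = α + β
  u = b * E
  κ = b * α * T + γ * b * (T ∸ E)
  κ>0 : 1 ≤ κ
  κ>0 = ≤-trans (*-pos (*-pos (≤-trans α>0 (m≤m+n α β)) α>0) T>0) (m≤m+n _ _)
  κ-eq : γ * u + κ ≡ b * β * T
  κ-eq = trans (l0 γ b α E (T ∸ E) T) (trans (cong (λ z → b * α * T + γ * b * z) (m+[n∸m]≡n E≤T)) (l00 γ b α T))
    where
    l0 : ∀ γ b α E d T → γ * (b * E) + (b * α * T + γ * b * d) ≡ b * α * T + γ * b * (E + d)
    l0 = solve-∀
    l00 : ∀ γ b α T → b * α * T + γ * b * T ≡ b * (α + γ) * T
    l00 = solve-∀
  l1 : ∀ κ g u a → κ * u + (g * u + g * a) ≡ (g + κ) * u + g * a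
  l1 = solve-∀
  l2 : ∀ α γ T E → let β = α + γ ; b = α + β in b * β * T * (b * E) + γ * (b * E) * (α * T) ≡ b * (α * β * T * E + γ * b * E * T + α * β * T * E)
  l2 = solve-∀
  l3 : ∀ x N y E → x * N + y + x * E ≡ x * (E + N) + y
  l3 = solve-∀
  l4 : ∀ α β γ b T E → b * (α * β * T * T + γ * b * E * E) ≡ b * β * T * (α * T) + γ * (b * E) * (b * E)
  l4 = solve-∀
  l5 : ∀ κ g u a → (g + κ) * a + g * u ≡ κ * a + (g * u + g * a)
  l5 = solve-∀

ekr : ∀ {n} γ σ (M : Family n) → 1 ≤ γ → Up M → Complement-free M → let α = 2 * γ + σ ; β = α + γ in
  (α + β) * μ α β M ≤ α * (α + β) ^ n
ekr {n} γ σ M γ>0 u c = ekr-poly α γ ((α + β) ^ n) (μ α β M) (μ β α M) α>0 (^-pos n (≤-trans α>0 (m≤m+n α β))) (μ≤total α β M)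
    (subst (λ z → μ α β M + z ≤ (α + β) ^ n) (μ-∁ α β M) (μ-disjoint α β M (λ S → M (∁ S)) c))
    (expansion γ σ M u)
  where
  α = 2 * γ + σ
  β = α + γ
  α>0 : 1 ≤ α
  α>0 = ≤-trans γ>0 (≤-trans (m≤m+n γ _) (m≤m+n _ σ))

average : ∀ {n} (f : Fin (suc n) → ℕ) → Σ (Fin (suc n)) λ v → suc n * f v ≤ ∑F f
average {n} f with least n f
  where
  least : ∀ n (f : Fin (suc n) → ℕ) → Σ (Fin (suc n)) λ v → ∀ w → f v ≤ f w
  least zero f = zero , λ { zero → ≤-refl }
  least (suc n) f with least n (λ i → f (suc i))
  ... | v , h with f zero ≤? f (suc v)
  ...   | yes p = zero , λ { zero → ≤-refl ; (suc w) → ≤-trans p (h w) }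
  ...   | no p = suc v , λ { zero → <⇒≤ (≰⇒> p) ; (suc w) → h w }
... | v , h = v , ≤-trans (≤-reflexive (sym (∑F-const (suc n) (f v)))) (∑F-mono h)

-- Since μ(M) ≤ p, the complement T - m is at least βT/b, so Poincaré bounds the sum of all m - e_v
-- below by m. A coordinate with smallest section therefore has e ≤ (1 - 1/n) m.
influence-poly : ∀ α β n T m e s → 1 ≤ β → 1 ≤ T → m ≤ T → (α + β) * m ≤ α * T → n * e ≤ s →
  (α + β) * m * T + β * T * s ≤ (α + β) * m * m + β * T * (n * m) → n * e + m ≤ n * m
influence-poly α β n T m e s β>0 T>0 m≤T hm hs hp = *-cancelˡ-≤-pos (β * T) (*-pos β>0 T>0) (+-cancelʳ-≤ (b * m * m) _ _ (begin
    β * T * (n * e + m) + b * m * m ≡⟨ l1 (β * T) (n * e) m (b * m * m) ⟩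
    (m * (β * T) + b * m * m) + β * T * (n * e) ≤⟨ +-mono-≤ (+-monoˡ-≤ (b * m * m) (*-monoʳ-≤ m c≥)) (*-monoʳ-≤ (β * T) hs) ⟩
    (m * (b * c) + b * m * m) + β * T * s ≡⟨ cong (_+ β * T * s) (l2 b m c) ⟩
    b * m * (m + c) + β * T * s ≡⟨ cong (λ z → b * m * z + β * T * s) (m+[n∸m]≡n m≤T) ⟩
    b * m * T + β * T * s ≤⟨ hp ⟩
    b * m * m + β * T * (n * m) ≡⟨ +-comm (b * m * m) _ ⟩
    β * T * (n * m) + b * m * m ∎))
  where
  open ≤-Reasoning
  b = α + β
  c = T ∸ m
  c≥ : β * T ≤ b * c
  c≥ = +-cancelˡ-≤ (b * m) _ _ (begin
    b * m + β * T ≤⟨ +-monoˡ-≤ (β * T) hm ⟩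
    α * T + β * T ≡⟨ sym (*-distribʳ-+ T α β) ⟩
    b * T ≡⟨ cong (b *_) (sym (m+[n∸m]≡n m≤T)) ⟩
    b * (m + c) ≡⟨ *-distribˡ-+ b m c ⟩
    b * m + b * c ∎)
  l1 : ∀ x y m z → x * (y + m) + z ≡ (m * x + z) + x * y
  l1 = solve-∀
  l2 : ∀ b m c → m * (b * c) + b * m * m ≡ b * m * (m + c)
  l2 = solve-∀

dictator-poly : ∀ α γ n T A N e m ξ → let β = α + γ ; b = α + β in 1 ≤ T →
  α * A + β * e ≡ b * m → A + N ≤ T → α * β * T * e + γ * b * e * T ≤ α * β * T * N + γ * b * e * e →
  α * T ≤ b * m + ξ → b * m ≤ α * T → n * e + m ≤ n * m → 2 * ξ ≤ α * T → γ * α * e ≤ 2 * n * β * ξ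
dictator-poly α γ n T A N e m ξ T>0 hA hAN hQ hξ hE hP h2 = *-cancelˡ-≤-pos T T>0 (begin
    T * (γ * α * e) ≡⟨ l5 T γ α e ⟩
    γ * e * (α * T) ≤⟨ *-monoʳ-≤ (γ * e) αT≤ ⟩
    γ * e * (2 * (b * m)) ≡⟨ l6 γ e b m ⟩
    2 * (γ * b * e * m) ≤⟨ *-monoʳ-≤ 2 s2 ⟩
    2 * (n * (β * T * ξ)) ≡⟨ l7 n β T ξ ⟩
    T * (2 * n * β * ξ) ∎)
  where
  open ≤-Reasoning
  β = α + γ
  b = α + β
  -- That is, γ e (αT - be) ≤ βTξ. Expansion puts N above e, `hAN` then pushes A down, and by `hA`
  -- this is a loss of bm against αT, which `hξ` limits to ξ.
  s1 : γ * e * (α * T) ≤ γ * b * e * e + β * T * ξ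
  s1 = +-cancelʳ-≤ (β * β * T * e + α * β * T * A) _ _ (begin
    γ * e * (α * T) + (β * β * T * e + α * β * T * A) ≡⟨ l1 α γ T e A ⟩
    α * β * T * e + γ * b * e * T + α * β * T * A ≤⟨ +-monoˡ-≤ (α * β * T * A) hQ ⟩
    α * β * T * N + γ * b * e * e + α * β * T * A ≡⟨ l2 (α * β * T) N A (γ * b * e * e) ⟩
    α * β * T * (A + N) + γ * b * e * e ≤⟨ +-monoˡ-≤ (γ * b * e * e) (*-monoʳ-≤ (α * β * T) hAN) ⟩
    α * β * T * T + γ * b * e * e ≡⟨ cong (_+ γ * b * e * e) (l3 α β T) ⟩
    β * T * (α * T) + γ * b * e * e ≤⟨ +-monoˡ-≤ (γ * b * e * e) (*-monoʳ-≤ (β * T) hξ) ⟩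
    β * T * (b * m + ξ) + γ * b * e * e ≡⟨ cong (λ z → β * T * (z + ξ) + γ * b * e * e) (sym hA) ⟩
    β * T * (α * A + β * e + ξ) + γ * b * e * e ≡⟨ l4 α β T A e ξ (γ * b * e * e) ⟩
    γ * b * e * e + β * T * ξ + (β * β * T * e + α * β * T * A) ∎)
    where
    l1 : ∀ α γ T e A → let β = α + γ ; b = α + β in γ * e * (α * T) + (β * β * T * e + α * β * T * A) ≡ α * β * T * e + γ * b * e * T + α * β * T * A
    l1 = solve-∀
    l2 : ∀ x N A y → x * N + y + x * A ≡ x * (A + N) + y
    l2 = solve-∀
    l3 : ∀ α β T → α * β * T * T ≡ β * T * (α * T)
    l3 = solve-∀
    l4 : ∀ α β T A e ξ y → β * T * (α * A + β * e + ξ) + y ≡ y + β * T * ξ + (β * β * T * e + α * β * T * A)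
    l4 = solve-∀
  -- By `hE` and `hP`, αT - be is at least bm - be, hence at least bm/n: e is the small root.
  s2 : γ * b * e * m ≤ n * (β * T * ξ)
  s2 = +-cancelˡ-≤ (γ * b * e * (n * e)) _ _ (begin
    γ * b * e * (n * e) + γ * b * e * m ≡⟨ sym (*-distribˡ-+ (γ * b * e) (n * e) m) ⟩
    γ * b * e * (n * e + m) ≤⟨ *-monoʳ-≤ (γ * b * e) hP ⟩
    γ * b * e * (n * m) ≡⟨ l1 γ b e n m ⟩
    n * (γ * e * (b * m)) ≤⟨ *-monoʳ-≤ n (≤-trans (*-monoʳ-≤ (γ * e) hE) s1) ⟩
    n * (γ * b * e * e + β * T * ξ) ≡⟨ l2 n (γ * b * e) e (β * T * ξ) ⟩
    γ * b * e * (n * e) + n * (β * T * ξ) ∎)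
    where
    l1 : ∀ γ b e n m → γ * b * e * (n * m) ≡ n * (γ * e * (b * m))
    l1 = solve-∀
    l2 : ∀ n x e y → n * (x * e + y) ≡ x * (n * e) + n * y
    l2 = solve-∀
  αT≤ : α * T ≤ 2 * (b * m)
  αT≤ = +-cancelʳ-≤ (α * T) _ _ (begin
    α * T + α * T ≤⟨ +-mono-≤ hξ hξ ⟩
    b * m + ξ + (b * m + ξ) ≡⟨ l (b * m) ξ ⟩
    2 * (b * m) + 2 * ξ ≤⟨ +-monoʳ-≤ (2 * (b * m)) h2 ⟩
    2 * (b * m) + α * T ∎)
    where
    l : ∀ x ξ → x + ξ + (x + ξ) ≡ 2 * x + 2 * ξ
    l = solve-∀
  l5 : ∀ T γ α e → T * (γ * α * e) ≡ γ * e * (α * T)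
  l5 = solve-∀
  l6 : ∀ γ e b m → γ * e * (2 * (b * m)) ≡ 2 * (γ * b * e * m)
  l6 = solve-∀
  l7 : ∀ n β T ξ → 2 * (n * (β * T * ξ)) ≡ T * (2 * n * β * ξ)
  l7 = solve-∀

∁-ins : ∀ {n} (v : Fin n) S → ∁ (del v (∁ S)) ≡ ins v S
∁-ins zero (x ∷ S) = cong (true ∷_) (∁∁ S)
  where
  ∁∁ : ∀ {n} (S : Subset n) → ∁ (∁ S) ≡ S
  ∁∁ [] = refl
  ∁∁ (true ∷ S) = cong (true ∷_) (∁∁ S)
  ∁∁ (false ∷ S) = cong (false ∷_) (∁∁ S)
∁-ins (suc v) (true ∷ S) = cong (true ∷_) (∁-ins v S)
∁-ins (suc v) (false ∷ S) = cong (false ∷_) (∁-ins v S)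

-- Stability: expansion of the section S ↦ M (del v S) bounds e (αT - be), so e is close to 0 or to its
-- maximum αT/b; the Poincaré inequality supplies a coordinate for which it is not close to the maximum.
dictator : ∀ {n} γ σ (M : Family n) ξ → 1 ≤ n → 1 ≤ γ → Up M → Complement-free M → let α = 2 * γ + σ ; β = α + γ in
  α * (α + β) ^ n ≤ (α + β) * μ α β M + ξ → 2 * ξ ≤ α * (α + β) ^ n →
  Σ (Fin n) λ v → γ * α * μ α β (λ S → M (del v S)) ≤ 2 * n * β * ξ
dictator {suc n} γ σ M ξ _ γ>0 u c hξ h2 with average (λ v → μ (2 * γ + σ) (2 * γ + σ + γ) (λ S → M (del v S)))
... | v , hv = v , dictator-poly α γ (suc n) T (μ α β (λ S → M (ins v S))) (μ β α V) (μ α β V) (μ α β M) ξ T>0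
    (μ-coord α β M v)
    -- `ins v S` and `del v (∁ S)` are complementary, so the section at x_v = 1 is disjoint from the
    -- reflection of the section at x_v = 0.
    (subst (λ z → μ α β (λ S → M (ins v S)) + z ≤ T) (μ-∁ α β V)
      (μ-disjoint α β (λ S → M (ins v S)) (λ S → V (∁ S)) (λ S p q → c (del v (∁ S)) q (subst (λ z → M z ≡ true) (sym (∁-ins v S)) p))))
    (expansion γ σ V (λ h → u (del-mono v h)))
    hξ bm
    (influence-poly α β (suc n) T (μ α β M) (μ α β V) _ (≤-trans α>0 (m≤m+n α γ)) T>0 (μ≤total α β M) bm hv (poincare α β M u))
    h2
  where
  α = 2 * γ + σ
  β = α + γ
  T = (α + β) ^ suc n
  V = λ S → M (del v S)
  bm = ekr γ σ M γ>0 u c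
  α>0 : 1 ≤ α
  α>0 = ≤-trans γ>0 (≤-trans (m≤m+n γ _) (m≤m+n _ σ))
  T>0 : 1 ≤ T
  T>0 = ^-pos (suc n) (≤-trans α>0 (m≤m+n α β))

-- Harris' inequality for several families

⋂ : ∀ {n m} → (Fin m → Family n) → Family n
⋂ {m = zero}  A S = true
⋂ {m = suc m} A S = A zero S ∧ ⋂ (λ i → A (suc i)) S

⋂-Down : ∀ {n m} (A : Fin m → Family n) → (∀ i → Down (A i)) → Down (⋂ A)
⋂-Down {m = zero}  A d h e = refl
⋂-Down {m = suc m} A d {_} {S} h e = ∧-both (d zero h (∧-left e)) (⋂-Down (λ i → A (suc i)) (λ i → d (suc i)) h (∧-right {A zero S} e))

⋂-elim : ∀ {n m} (A : Fin m → Family n) S → ⋂ A S ≡ true → ∀ i → A i S ≡ true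
⋂-elim A S h zero = ∧-left h
⋂-elim A S h (suc i) = ⋂-elim (λ i → A (suc i)) S (∧-right {A zero S} h) i

⋂-intro : ∀ {n m} (A : Fin m → Family n) S → (∀ i → A i S ≡ true) → ⋂ A S ≡ true
⋂-intro {m = zero}  A S h = refl
⋂-intro {m = suc m} A S h = ∧-both (h zero) (⋂-intro (λ i → A (suc i)) S (λ i → h (suc i)))

harris-⋂ : ∀ {n m} α β (A : Fin m → Family n) → 1 ≤ α → (∀ i → Down (A i)) →
  (∀ i → β * (α + β) ^ n ≤ (α + β) * μ α β (A i)) → β ^ m * (α + β) ^ n ≤ (α + β) ^ m * μ α β (⋂ A)
harris-⋂ {n} {zero} α β A α>0 d h = ≤-reflexive (cong (1 *_) (sym (μ-all n α β)))
harris-⋂ {n} {suc m} α β A α>0 d h = *-cancelˡ-≤-pos T (^-pos n (≤-trans α>0 (m≤m+n α β))) (begin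
  T * (β * β ^ m * T) ≡⟨ l1 T β (β ^ m) ⟩
  (β * T) * (β ^ m * T) ≤⟨ *-mono-≤ (h zero) (harris-⋂ α β (λ i → A (suc i)) α>0 (λ i → d (suc i)) (λ i → h (suc i))) ⟩
  (b * μ α β (A zero)) * (b ^ m * μ α β (⋂ (λ i → A (suc i)))) ≡⟨ l2 b (μ α β (A zero)) (b ^ m) _ ⟩
  b * b ^ m * (μ α β (A zero) * μ α β (⋂ (λ i → A (suc i)))) ≤⟨ *-monoʳ-≤ (b * b ^ m) (harris α β (A zero) (⋂ (λ i → A (suc i))) (d zero) (⋂-Down _ (λ i → d (suc i)))) ⟩
  b * b ^ m * (T * μ α β (⋂ A)) ≡⟨ *-swap (b * b ^ m) T _ ⟩
  T * (b * b ^ m * μ α β (⋂ A)) ∎)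
  where
  open ≤-Reasoning
  b = α + β
  T = b ^ n
  l1 : ∀ T β x → T * (β * x * T) ≡ (β * T) * (x * T)
  l1 = solve-∀
  l2 : ∀ b u x v → (b * u) * (x * v) ≡ b * x * (u * v)
  l2 = solve-∀

-- Only the other m factors are replaced by their lower bound q. An upper bound on the intersection
-- thus becomes an upper bound on each single `A i`.
harris-⋂-at : ∀ {n m} α β (A : Fin (suc m) → Family n) → 1 ≤ α → (∀ i → Down (A i)) →
  (∀ i → β * (α + β) ^ n ≤ (α + β) * μ α β (A i)) → ∀ i → β ^ m * μ α β (A i) ≤ (α + β) ^ m * μ α β (⋂ A)
harris-⋂-at {n} {m} α β A α>0 d h zero = *-cancelˡ-≤-pos T (^-pos n (≤-trans α>0 (m≤m+n α β))) (begin
  T * (β ^ m * μ α β (A zero)) ≡⟨ l1 T (β ^ m) _ ⟩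
  μ α β (A zero) * (β ^ m * T) ≤⟨ *-monoʳ-≤ (μ α β (A zero)) (harris-⋂ α β (λ i → A (suc i)) α>0 (λ i → d (suc i)) (λ i → h (suc i))) ⟩
  μ α β (A zero) * (b ^ m * μ α β (⋂ (λ i → A (suc i)))) ≡⟨ *-swap (μ α β (A zero)) (b ^ m) _ ⟩
  b ^ m * (μ α β (A zero) * μ α β (⋂ (λ i → A (suc i)))) ≤⟨ *-monoʳ-≤ (b ^ m) (harris α β (A zero) (⋂ (λ i → A (suc i))) (d zero) (⋂-Down _ (λ i → d (suc i)))) ⟩
  b ^ m * (T * μ α β (⋂ A)) ≡⟨ *-swap (b ^ m) T _ ⟩
  T * (b ^ m * μ α β (⋂ A)) ∎)
  where
  open ≤-Reasoning
  b = α + β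
  T = b ^ n
  l1 : ∀ T x u → T * (x * u) ≡ u * (x * T)
  l1 = solve-∀
harris-⋂-at {n} {suc m} α β A α>0 d h (suc i) = *-cancelˡ-≤-pos T (^-pos n (≤-trans α>0 (m≤m+n α β))) (begin
  T * (β * β ^ m * μ α β (A (suc i))) ≡⟨ l1 T β (β ^ m) _ ⟩
  (β * T) * (β ^ m * μ α β (A (suc i))) ≤⟨ *-mono-≤ (h zero) (harris-⋂-at α β (λ i → A (suc i)) α>0 (λ i → d (suc i)) (λ i → h (suc i)) i) ⟩
  (b * μ α β (A zero)) * (b ^ m * μ α β (⋂ (λ i → A (suc i)))) ≡⟨ l2 b (μ α β (A zero)) (b ^ m) _ ⟩
  b * b ^ m * (μ α β (A zero) * μ α β (⋂ (λ i → A (suc i)))) ≤⟨ *-monoʳ-≤ (b * b ^ m) (harris α β (A zero) (⋂ (λ i → A (suc i))) (d zero) (⋂-Down _ (λ i → d (suc i)))) ⟩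
  b * b ^ m * (T * μ α β (⋂ A)) ≡⟨ *-swap (b * b ^ m) T _ ⟩
  T * (b * b ^ m * μ α β (⋂ A)) ∎)
  where
  open ≤-Reasoning
  b = α + β
  T = b ^ n
  l1 : ∀ T β x u → T * (β * x * u) ≡ (β * T) * (x * u)
  l1 = solve-∀
  l2 : ∀ b u x v → (b * u) * (x * v) ≡ b * x * (u * v)
  l2 = solve-∀

-- Level decomposition of the measure

wt : ℕ → ℕ → ℕ → ℕ → ℕ
wt α β n l = α ^ l * β ^ (n ∸ l)

μ≡∑ : ∀ {n} α β (F : Family n) → μ α β F ≡ ∑ (λ S → wt α β n ∣ S ∣ * ind (F S))
μ≡∑ {zero} α β F = sym (+-identityʳ _)
μ≡∑ {suc n} α β F = cong₂ _+_
  (trans (cong (β *_) (μ≡∑ {n} α β (λ S → F (outside ∷ S)))) (trans (sym (∑-*ˡ {n} β _)) (∑-cong {n} out)))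
  (trans (cong (α *_) (μ≡∑ {n} α β (λ S → F (inside ∷ S)))) (trans (sym (∑-*ˡ {n} α _)) (∑-cong {n} inn)))
  where
  l1 : ∀ β x y z → β * (x * y * z) ≡ x * (β * y) * z
  l1 = solve-∀
  l2 : ∀ α x y z → α * (x * y * z) ≡ α * x * y * z
  l2 = solve-∀
  out : ∀ S → β * (wt α β n ∣ S ∣ * ind (F (outside ∷ S))) ≡ wt α β (suc n) ∣ S ∣ * ind (F (outside ∷ S))
  out S = trans (l1 β (α ^ ∣ S ∣) (β ^ (n ∸ ∣ S ∣)) _) (cong (λ z → α ^ ∣ S ∣ * β ^ z * ind (F (outside ∷ S))) (sym (+-∸-assoc 1 (∣p∣≤n S))))
  inn : ∀ S → α * (wt α β n ∣ S ∣ * ind (F (inside ∷ S))) ≡ wt α β (suc n) (suc ∣ S ∣) * ind (F (inside ∷ S))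
  inn S = l2 α (α ^ ∣ S ∣) (β ^ (n ∸ ∣ S ∣)) _

μ-levels : ∀ {n} α β (F : Family n) → μ α β F ≡ ∑< (suc n) (λ l → wt α β n l * lev l F)
μ-levels {n} α β F = trans (μ≡∑ α β F) (trans (∑-by-size {n} (λ S → wt α β n ∣ S ∣ * ind (F S))) (∑<-cong (suc n) (λ l _ → pt l)))
  where
  pt : ∀ l → ∑ (λ S → ind (∣ S ∣ ≡ᵇ l) * (wt α β n ∣ S ∣ * ind (F S))) ≡ wt α β n l * lev l F
  pt l = trans (∑-cong {n} (λ S → trans (ind-lev-cong ∣ S ∣ l (λ e → cong (λ z → wt α β n z * ind (F S)) e)) (*-swap (ind (∣ S ∣ ≡ᵇ l)) (wt α β n l) (ind (F S)))))
    (∑-*ˡ {n} (wt α β n l) (λ S → ind (∣ S ∣ ≡ᵇ l) * ind (F S)))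

binomial-theorem : ∀ n α β → ∑< (suc n) (λ l → wt α β n l * (n C l)) ≡ (α + β) ^ n
binomial-theorem n α β = trans (∑<-cong (suc n) (λ l _ → cong (wt α β n l *_) (sym (lev-all n l)))) (trans (sym (μ-levels {n} α β all)) (μ-all n α β))

tail : ℕ → ℕ → ℕ → ℕ → ℕ
tail α β n k = ∑< k (λ l → wt α β n l * (n C l))

∑<-≤ : ∀ {m n} (f : ℕ → ℕ) → m ≤ n → ∑< m f ≤ ∑< n f
∑<-≤ f h with m≤n⇒∃[o]m+o≡n h
∑<-≤ {m} f h | j , refl = ≤-trans (m≤m+n _ _) (≤-reflexive (sym (∑<-split m j f)))

∑<-shift : ∀ m k (f : ℕ → ℕ) → ∑< k (λ l → f (m + l)) ≤ ∑< (m + k) f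
∑<-shift m k f = ≤-trans (m≤n+m _ _) (≤-reflexive (sym (∑<-split m k f)))

-- The value is the mass of the sets missing r given points, the extremal q^r; levels above n
-- contribute binomial coefficients equal to 0.
binomial-narrow : ∀ r n α β → ∑< (suc (r + n)) (λ l → wt α β (r + n) l * (n C l)) ≡ β ^ r * (α + β) ^ n
binomial-narrow r n α β = begin
  ∑< (suc (r + n)) f ≡⟨ cong (λ z → ∑< (suc z) f) (+-comm r n) ⟩
  ∑< (suc n + r) f ≡⟨ ∑<-split (suc n) r f ⟩
  ∑< (suc n) f + ∑< r (λ l → f (suc n + l)) ≡⟨ cong₂ _+_ (∑<-cong (suc n) low) (trans (∑<-cong r high) (∑<-zero r)) ⟩
  ∑< (suc n) (λ l → β ^ r * (wt α β n l * (n C l))) + 0 ≡⟨ +-identityʳ _ ⟩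
  ∑< (suc n) (λ l → β ^ r * (wt α β n l * (n C l))) ≡⟨ ∑<-*ˡ (suc n) (β ^ r) (λ l → wt α β n l * (n C l)) ⟩
  β ^ r * ∑< (suc n) (λ l → wt α β n l * (n C l)) ≡⟨ cong (β ^ r *_) (binomial-theorem n α β) ⟩
  β ^ r * (α + β) ^ n ∎
  where
  open ≡-Reasoning
  f = λ l → wt α β (r + n) l * (n C l)
  high : ∀ l → l < r → f (suc n + l) ≡ 0
  high l _ = trans (cong (wt α β (r + n) (suc n + l) *_) (k>n⇒nCk≡0 (s≤s (m≤m+n n l)))) (*-zeroʳ (wt α β (r + n) (suc n + l)))
  l1 : ∀ a b c d → a * (b * c) * d ≡ b * (a * c * d)
  l1 = solve-∀
  low : ∀ l → l < suc n → f l ≡ β ^ r * (wt α β n l * (n C l))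
  low l (s≤s l≤n) = begin
    α ^ l * β ^ (r + n ∸ l) * (n C l) ≡⟨ cong (λ z → α ^ l * β ^ z * (n C l)) (+-∸-assoc r l≤n) ⟩
    α ^ l * β ^ (r + (n ∸ l)) * (n C l) ≡⟨ cong (λ z → α ^ l * z * (n C l)) (^-distribˡ-+-* β r (n ∸ l)) ⟩
    α ^ l * (β ^ r * β ^ (n ∸ l)) * (n C l) ≡⟨ l1 (α ^ l) (β ^ r) (β ^ (n ∸ l)) (n C l) ⟩
    β ^ r * (wt α β n l * (n C l)) ∎

μ-small-levels : ∀ r n k α β (G : Family (r + n)) → k ≤ r + n → (∀ i → lev (k + i) G ≤ n C (k + i)) →
  μ α β G ≤ β ^ r * (α + β) ^ n + tail α β (r + n) k
μ-small-levels r n k α β G k≤ h with m≤n⇒∃[o]m+o≡n (m≤n⇒m≤1+n k≤)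
... | j , eq = begin
  μ α β G ≡⟨ μ-levels α β G ⟩
  ∑< (suc (r + n)) g ≡⟨ cong (λ z → ∑< z g) (sym eq) ⟩
  ∑< (k + j) g ≡⟨ ∑<-split k j g ⟩
  ∑< k g + ∑< j (λ l → g (k + l)) ≤⟨ +-mono-≤ (∑<-mono k (λ l _ → *-monoʳ-≤ (wt α β (r + n) l) (lev≤C l G))) (∑<-mono j (λ l _ → *-monoʳ-≤ (wt α β (r + n) (k + l)) (h l))) ⟩
  tail α β (r + n) k + ∑< j (λ l → f (k + l)) ≤⟨ +-monoʳ-≤ (tail α β (r + n) k) (∑<-shift k j f) ⟩
  tail α β (r + n) k + ∑< (k + j) f ≡⟨ cong (λ z → tail α β (r + n) k + ∑< z f) eq ⟩
  tail α β (r + n) k + ∑< (suc (r + n)) f ≡⟨ cong (tail α β (r + n) k +_) (binomial-narrow r n α β) ⟩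
  tail α β (r + n) k + β ^ r * (α + β) ^ n ≡⟨ +-comm (tail α β (r + n) k) _ ⟩
  β ^ r * (α + β) ^ n + tail α β (r + n) k ∎
  where
  open ≤-Reasoning
  g = λ l → wt α β (r + n) l * lev l G
  f = λ l → wt α β (r + n) l * (n C l)

-- The case X = n of `shadow-chain`, whose hypothesis then holds for any family, applied to the
-- complement of V.
lym : ∀ {n} j i (V : Family n) → Up V → lev (suc j) V * (n C (suc j + i)) ≤ lev (suc j + i) V * (n C suc j)
lym {n} j i V u = +-cancelˡ-≤ (g k * (n C l)) _ _ (begin
  g k * (n C l) + v k * (n C l) ≡⟨ sym (*-distribʳ-+ (n C l) (g k) (v k)) ⟩
  (g k + v k) * (n C l) ≡⟨ cong (_* (n C l)) (gv k) ⟩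
  (n C k) * (n C l) ≡⟨ *-comm (n C k) (n C l) ⟩
  (n C l) * (n C k) ≡⟨ cong (_* (n C k)) (sym (gv l)) ⟩
  (g l + v l) * (n C k) ≡⟨ *-distribʳ-+ (n C k) (g l) (v l) ⟩
  g l * (n C k) + v l * (n C k) ≤⟨ +-monoˡ-≤ (v l * (n C k)) ch ⟩
  g k * (n C l) + v l * (n C k) ∎)
  where
  open ≤-Reasoning
  k = suc j
  l = suc j + i
  G : Family n
  G S = not (V S)
  g = λ l → lev l G
  v = λ l → lev l V
  gv : ∀ l → g l + v l ≡ n C l
  gv l = trans (lev-compl l V) (lev-all n l)
  ch : g l * (n C k) ≤ g k * (n C l)
  ch = subst (λ z → g z * (n C k) ≤ g k * (n C z)) (+-comm i (suc j)) (proj₂ (shadow-chain j n G (not-Down {F = V} u) (lev≤C k G) i))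

-- By `lym` every level from `suc j` on is at least as dense as that one, and these levels carry all
-- the mass except the tail.
lev≤μ : ∀ {n} j α β (V : Family n) → Up V → suc j ≤ n →
  lev (suc j) V * (α + β) ^ n ≤ μ α β V * (n C suc j) + lev (suc j) V * tail α β n (suc j)
lev≤μ {n} j α β V u k≤ with m≤n⇒∃[o]m+o≡n (m≤n⇒m≤1+n k≤)
... | i , eq = begin
  v * (α + β) ^ n ≡⟨ cong (v *_) (sym (binomial-theorem n α β)) ⟩
  v * ∑< (suc n) f ≡⟨ cong (λ z → v * ∑< z f) (sym eq) ⟩
  v * ∑< (k + i) f ≡⟨ cong (v *_) (∑<-split k i f) ⟩
  v * (tail α β n k + ∑< i (λ l → f (k + l))) ≡⟨ *-distribˡ-+ v (tail α β n k) _ ⟩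
  v * tail α β n k + v * ∑< i (λ l → f (k + l)) ≤⟨ +-monoʳ-≤ (v * tail α β n k) main ⟩
  v * tail α β n k + μ α β V * (n C k) ≡⟨ +-comm (v * tail α β n k) _ ⟩
  μ α β V * (n C k) + v * tail α β n k ∎
  where
  open ≤-Reasoning
  k = suc j
  v = lev k V
  f = λ l → wt α β n l * (n C l)
  g = λ l → wt α β n l * lev l V
  l1 : ∀ c x y → c * (x * y) ≡ x * (y * c)
  l1 = solve-∀
  main : v * ∑< i (λ l → f (k + l)) ≤ μ α β V * (n C k)
  main = begin
    v * ∑< i (λ l → f (k + l)) ≡⟨ sym (∑<-*ˡ i v (λ l → f (k + l))) ⟩
    ∑< i (λ l → v * f (k + l)) ≤⟨ ∑<-mono i (λ l _ → begin
      v * f (k + l) ≡⟨ *-swap v (wt α β n (k + l)) (n C (k + l)) ⟩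
      wt α β n (k + l) * (v * (n C (k + l))) ≤⟨ *-monoʳ-≤ (wt α β n (k + l)) (lym j l V u) ⟩
      wt α β n (k + l) * (lev (k + l) V * (n C k)) ≡⟨ sym (l1 (n C k) (wt α β n (k + l)) (lev (k + l) V)) ⟩
      (n C k) * g (k + l) ∎) ⟩
    ∑< i (λ l → (n C k) * g (k + l)) ≡⟨ ∑<-*ˡ i (n C k) (λ l → g (k + l)) ⟩
    (n C k) * ∑< i (λ l → g (k + l)) ≤⟨ *-monoʳ-≤ (n C k) (∑<-shift k i g) ⟩
    (n C k) * ∑< (k + i) g ≡⟨ cong (λ z → (n C k) * ∑< z g) eq ⟩
    (n C k) * ∑< (suc n) g ≡⟨ cong ((n C k) *_) (sym (μ-levels α β V)) ⟩
    (n C k) * μ α β V ≡⟨ *-comm (n C k) _ ⟩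
    μ α β V * (n C k) ∎

-- The binomial tail

-- From here on α/(α + β) = 1/2 - D/(10n), compared with k/n = 1/2 - D/(2n).  The ratio of consecutive terms stays below
-- 2n/(2n + D) for another D/4 levels above k.

tail-step : ∀ k D l → let n = 2 * k + D ; α = 2 * (2 * D) + 10 * k ; β = α + 2 * D in
  4 * suc l ≤ 4 * k + D →
  (2 * n + D) * (wt α β n l * (n C l)) ≤ 2 * n * (wt α β n (suc l) * (n C suc l))
tail-step k D l h = *-cancelˡ-≤ (suc l) (begin
    suc l * ((2 * n + D) * (α ^ l * β ^ (n ∸ l) * (n C l))) ≡⟨ cong (λ z → suc l * ((2 * n + D) * (α ^ l * β ^ z * (n C l)))) n∸l ⟩
    suc l * ((2 * n + D) * (α ^ l * (β * B) * (n C l))) ≡⟨ l1 (suc l) (2 * n + D) (α ^ l) β B (n C l) ⟩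
    (suc l * (2 * n + D) * β) * (α ^ l * B * (n C l)) ≤⟨ *-monoˡ-≤ (α ^ l * B * (n C l)) key ⟩
    (2 * n * α * (n ∸ l)) * (α ^ l * B * (n C l)) ≡⟨ l2 (2 * n) α (n ∸ l) (α ^ l) B (n C l) ⟩
    2 * n * (α * α ^ l * B * ((n ∸ l) * (n C l))) ≡⟨ cong (λ z → 2 * n * (α * α ^ l * B * z)) (sym (C-step n l)) ⟩
    2 * n * (α * α ^ l * B * (suc l * (n C suc l))) ≡⟨ l3 (2 * n) (α * α ^ l * B) (suc l) (n C suc l) ⟩
    suc l * (2 * n * (α * α ^ l * B * (n C suc l))) ∎)
  where
  open ≤-Reasoning
  n = 2 * k + D
  α = 2 * (2 * D) + 10 * k
  β = α + 2 * D
  B = β ^ (n ∸ suc l)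
  l<n : suc l ≤ n
  l<n = *-cancelˡ-≤ 4 (≤-trans h (≤-trans (m≤m+n (4 * k + D) (4 * k + 3 * D)) (≤-reflexive (le k D))))
    where
    le : ∀ k D → 4 * k + D + (4 * k + 3 * D) ≡ 4 * (2 * k + D)
    le = solve-∀
  n∸l : n ∸ l ≡ suc (n ∸ suc l)
  n∸l = +-∸-assoc 1 l<n
  far : 4 * k + 3 * D ≤ 4 * (n ∸ l)
  far = +-cancelʳ-≤ (4 * suc l) _ _ (begin
    4 * k + 3 * D + 4 * suc l ≤⟨ +-monoʳ-≤ (4 * k + 3 * D) h ⟩
    4 * k + 3 * D + (4 * k + D) ≡⟨ le k D ⟩
    4 * n ≡⟨ cong (4 *_) (sym (m∸n+n≡m (<⇒≤ l<n))) ⟩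
    4 * (n ∸ l + l) ≡⟨ *-distribˡ-+ 4 (n ∸ l) l ⟩
    4 * (n ∸ l) + 4 * l ≤⟨ +-monoʳ-≤ (4 * (n ∸ l)) (*-monoʳ-≤ 4 (n≤1+n l)) ⟩
    4 * (n ∸ l) + 4 * suc l ∎)
    where
    le : ∀ k D → 4 * k + 3 * D + (4 * k + D) ≡ 4 * (2 * k + D)
    le = solve-∀
  -- 4k + 3D equals 2n + D, so `far` supplies that factor and it remains to compare (4k + D) β with
  -- 2nα.
  key : suc l * (2 * n + D) * β ≤ 2 * n * α * (n ∸ l)
  key = *-cancelˡ-≤ 4 (begin
    4 * (suc l * (2 * n + D) * β) ≡⟨ e1 (suc l) (2 * n + D) β ⟩
    4 * suc l * β * (2 * n + D) ≤⟨ *-monoˡ-≤ (2 * n + D) (*-monoˡ-≤ β h) ⟩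
    (4 * k + D) * β * (2 * n + D) ≤⟨ *-monoˡ-≤ (2 * n + D) (≤-trans (m≤m+n ((4 * k + D) * β) (2 * k * D + 2 * D * D)) (≤-reflexive (e2 k D))) ⟩
    2 * n * α * (2 * n + D) ≡⟨ cong (2 * n * α *_) (e4 k D) ⟩
    2 * n * α * (4 * k + 3 * D) ≤⟨ *-monoʳ-≤ (2 * n * α) far ⟩
    2 * n * α * (4 * (n ∸ l)) ≡⟨ e3 (2 * n * α) (n ∸ l) ⟩
    4 * (2 * n * α * (n ∸ l)) ∎)
    where
    e1 : ∀ a b c → 4 * (a * b * c) ≡ 4 * a * c * b
    e1 = solve-∀
    e2 : ∀ k D → let n = 2 * k + D ; α = 2 * (2 * D) + 10 * k ; β = α + 2 * D in
      (4 * k + D) * β + (2 * k * D + 2 * D * D) ≡ 2 * n * α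
    e2 = solve-∀
    e3 : ∀ x y → x * (4 * y) ≡ 4 * (x * y)
    e3 = solve-∀
    e4 : ∀ k D → 2 * (2 * k + D) + D ≡ 4 * k + 3 * D
    e4 = solve-∀
  l1 : ∀ s a x β B c → s * (a * (x * (β * B) * c)) ≡ (s * a * β) * (x * B * c)
  l1 = solve-∀
  l2 : ∀ m α d x B c → (m * α * d) * (x * B * c) ≡ m * (α * x * B * (d * c))
  l2 = solve-∀
  l3 : ∀ m y s c → m * (y * (s * c)) ≡ s * (m * (y * c))
  l3 = solve-∀

-- Each term below k is compared with the term m levels higher; the shifted terms are still part of
-- the expansion of (α + β)^n.
tail-bound : ∀ k D m → let n = 2 * k + D ; α = 2 * (2 * D) + 10 * k ; β = α + 2 * D in
  4 * m ≤ D → (2 * n + D) ^ m * tail α β n k ≤ (2 * n) ^ m * (α + β) ^ n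
tail-bound k D m hm = begin
    y ^ m * ∑< k f ≡⟨ sym (∑<-*ˡ k (y ^ m) f) ⟩
    ∑< k (λ l → y ^ m * f l) ≤⟨ ∑<-mono k (λ l l<k → iter m l (≤-trans (≤-reflexive (*-distribˡ-+ 4 m l)) (≤-trans (+-mono-≤ hm (*-monoʳ-≤ 4 (<⇒≤ l<k))) (≤-reflexive (+-comm D (4 * k)))))) ⟩
    ∑< k (λ l → x ^ m * f (m + l)) ≡⟨ ∑<-*ˡ k (x ^ m) (λ l → f (m + l)) ⟩
    x ^ m * ∑< k (λ l → f (m + l)) ≤⟨ *-monoʳ-≤ (x ^ m) (≤-trans (∑<-shift m k f) (≤-trans (∑<-≤ f mk≤n) (≤-reflexive (binomial-theorem n α β)))) ⟩
    x ^ m * (α + β) ^ n ∎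
  where
  open ≤-Reasoning
  n = 2 * k + D
  α = 2 * (2 * D) + 10 * k
  β = α + 2 * D
  x = 2 * n
  y = 2 * n + D
  f = λ l → wt α β n l * (n C l)
  mk≤n : m + k ≤ suc n
  mk≤n = m≤n⇒m≤1+n (≤-trans (+-mono-≤ (≤-trans (m≤m+n m _) hm) (m≤m+n k (k + 0))) (≤-reflexive (+-comm D (2 * k))))
  iter : ∀ m l → 4 * (m + l) ≤ 4 * k + D → y ^ m * f l ≤ x ^ m * f (m + l)
  iter zero l h = ≤-refl
  iter (suc m) l h = begin
    y * y ^ m * f l ≡⟨ *-assoc y (y ^ m) (f l) ⟩
    y * (y ^ m * f l) ≤⟨ *-monoʳ-≤ y (iter m l (≤-trans (*-monoʳ-≤ 4 (n≤1+n (m + l))) h)) ⟩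
    y * (x ^ m * f (m + l)) ≡⟨ *-swap y (x ^ m) _ ⟩
    x ^ m * (y * f (m + l)) ≤⟨ *-monoʳ-≤ (x ^ m) (tail-step k D (m + l) h) ⟩
    x ^ m * (x * f (suc m + l)) ≡⟨ e (x ^ m) x (f (suc m + l)) ⟩
    x * x ^ m * f (suc m + l) ∎
    where
    e : ∀ a x b → a * (x * b) ≡ x * a * b
    e = solve-∀

bernoulli : ∀ x D t → x ^ t * (x + t * D) ≤ x * (x + D) ^ t
bernoulli x D zero = ≤-reflexive (e x)
  where
  e : ∀ x → 1 * (x + 0) ≡ x * 1
  e = solve-∀
bernoulli x D (suc t) = begin
  x * x ^ t * (x + suc t * D) ≤⟨ m≤m+n _ (x ^ t * (t * D * D)) ⟩
  x * x ^ t * (x + suc t * D) + x ^ t * (t * D * D) ≡⟨ e x (x ^ t) t D ⟩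
  (x + D) * (x ^ t * (x + t * D)) ≤⟨ *-monoʳ-≤ (x + D) (bernoulli x D t) ⟩
  (x + D) * (x * (x + D) ^ t) ≡⟨ *-swap (x + D) x _ ⟩
  x * ((x + D) * (x + D) ^ t) ∎
  where
  open ≤-Reasoning
  e : ∀ x y t D → x * y * (x + suc t * D) + y * (t * D * D) ≡ (x + D) * (y * (x + t * D))
  e = solve-∀

-- As tD ≥ 2n, Bernoulli gives (1 + D/(2n))^t ≥ 2: each run of t levels halves the tail, and D/4
-- levels leave room for w runs.
tail-exponential : ∀ k D t w → let n = 2 * k + D ; α = 2 * (2 * D) + 10 * k ; β = α + 2 * D in
  1 ≤ n → 2 * n ≤ t * D → 4 * (t * w) ≤ D → 2 ^ w * tail α β n k ≤ (α + β) ^ n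
tail-exponential k D t w n>0 ht hw = *-cancelˡ-≤-pos (x ^ (t * w)) (^-pos (t * w) x>0) (begin
    x ^ (t * w) * (2 ^ w * τ) ≡⟨ cong (_* (2 ^ w * τ)) (sym (^-*-assoc x t w)) ⟩
    (x ^ t) ^ w * (2 ^ w * τ) ≡⟨ sym (*-assoc ((x ^ t) ^ w) (2 ^ w) τ) ⟩
    (x ^ t) ^ w * 2 ^ w * τ ≡⟨ cong (_* τ) (sym (^-distribʳ-* w (x ^ t) 2)) ⟩
    (x ^ t * 2) ^ w * τ ≤⟨ *-monoˡ-≤ τ (^-monoˡ-≤ w dbl) ⟩
    ((x + D) ^ t) ^ w * τ ≡⟨ cong (_* τ) (^-*-assoc (x + D) t w) ⟩
    (x + D) ^ (t * w) * τ ≤⟨ tail-bound k D (t * w) hw ⟩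
    x ^ (t * w) * (α + β) ^ n ∎)
  where
  open ≤-Reasoning
  n = 2 * k + D
  α = 2 * (2 * D) + 10 * k
  β = α + 2 * D
  x = 2 * n
  τ = tail α β n k
  x>0 : 1 ≤ x
  x>0 = ≤-trans n>0 (m≤m+n n _)
  dbl : x ^ t * 2 ≤ (x + D) ^ t
  dbl = *-cancelˡ-≤-pos x x>0 (begin
    x * (x ^ t * 2) ≡⟨ e x (x ^ t) ⟩
    x ^ t * (x + x) ≤⟨ *-monoʳ-≤ (x ^ t) (+-monoʳ-≤ x ht) ⟩
    x ^ t * (x + t * D) ≤⟨ bernoulli x D t ⟩
    x * (x + D) ^ t ∎)
    where
    e : ∀ x y → x * (y * 2) ≡ y * (x + x)
    e = solve-∀

-- Up-closures, unions and sets avoiding R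

up : ∀ {n} → Family n → Family n
up {zero}  F U           = F U
up {suc n} F (false ∷ U) = up (λ S → F (outside ∷ S)) U
up {suc n} F (true ∷ U)  = up (λ S → F (outside ∷ S)) U ∨ up (λ S → F (inside ∷ S)) U

∨-introʳ : ∀ a {b} → b ≡ true → a ∨ b ≡ true
∨-introʳ true  h = refl
∨-introʳ false h = h

∨-introˡ : ∀ {a} b → a ≡ true → a ∨ b ≡ true
∨-introˡ b refl = refl

up-intro : ∀ {n} (F : Family n) {S U} → S ⊑ U → F S ≡ true → up F U ≡ true
up-intro F [] h = h
up-intro F (keep false s) h = up-intro _ s h
up-intro F (keep true s)  h = ∨-introʳ _ (up-intro _ s h)
up-intro F (add s)        h = ∨-introˡ _ (up-intro _ s h)

up-elim : ∀ {n} (F : Family n) U → up F U ≡ true → Σ (Subset n) λ S → S ⊑ U × F S ≡ true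
up-elim F [] h = [] , [] , h
up-elim F (false ∷ U) h with up-elim _ U h
... | S , s , f = false ∷ S , keep false s , f
up-elim F (true ∷ U) h with up (λ S → F (outside ∷ S)) U in eq
... | true with up-elim _ U eq
...   | S , s , f = false ∷ S , add s , f
up-elim F (true ∷ U) h | false with up-elim _ U h
...   | S , s , f = true ∷ S , keep true s , f

up-Up : ∀ {n} (F : Family n) → Up (up F)
up-Up F {A} s h with up-elim F A h
... | S , s′ , f = up-intro F (⊑-trans s′ s) f

-- A k-set inside a set of size at most k equals it. So level k of the up-closure gives back the
-- family.
up-level : ∀ {n} k (F : Family n) → Uniform k F → ∀ U → ∣ U ∣ ≤ k → up F U ≡ true → F U ≡ true
up-level k F u U h e with up-elim F U e
... | S , s , f with ⊑-size-≡ s (≤-trans h (≤-reflexive (sym (u S f))))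
...   | refl = f

mem-∁ : ∀ {n} (v : Fin n) S → mem v (∁ S) ≡ not (mem v S)
mem-∁ v S = lookup-map v not S

up-Complement-free : ∀ {n} (F : Family n) → Intersecting F → Complement-free (up F)
up-Complement-free F int A p q with up-elim F A p | up-elim F (∁ A) q
... | S₁ , s₁ , f₁ | S₂ , s₂ , f₂ with int S₁ S₂ f₁ f₂
...   | v , v∈ with x∈p∩q⁻ S₁ S₂ v∈
...     | v∈₁ , v∈₂ with mem v A | mem-mono v s₁ ([]=⇒lookup v∈₁) | trans (sym (mem-∁ v A)) (mem-mono v s₂ ([]=⇒lookup v∈₂))
...       | true | _ | ()

anyFin-intro : ∀ {m} (f : Fin m → Bool) i → f i ≡ true → anyFin m f ≡ true
anyFin-intro f zero h rewrite h = refl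
anyFin-intro f (suc i) h with f zero
... | true = refl
... | false = anyFin-intro (λ i → f (suc i)) i h

anyFin-elim : ∀ {m} (f : Fin m → Bool) → anyFin m f ≡ true → Σ (Fin m) λ i → f i ≡ true
anyFin-elim {suc m} f h with f zero in eq
... | true = zero , eq
... | false with anyFin-elim (λ i → f (suc i)) h
...   | i , e = suc i , e

lev-⋃ : ∀ {n m} l (Fs : Fin m → Family n) → lev l (⋃ Fs) ≤ ∑F (λ i → lev l (Fs i))
lev-⋃ {n} {m} l Fs = ≤-trans (∑-mono {n} (λ S → *-monoʳ-≤ (ind (∣ S ∣ ≡ᵇ l)) (pt (λ i → Fs i S))))
  (≤-reflexive (trans (∑-cong {n} (λ S → sym (∑F-*ˡ (ind (∣ S ∣ ≡ᵇ l)) (λ i → ind (Fs i S))))) (sym (∑F-∑ (λ i S → ind (∣ S ∣ ≡ᵇ l) * ind (Fs i S))))))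
  where
  pt : ∀ {m} (f : Fin m → Bool) → ind (anyFin m f) ≤ ∑F (λ i → ind (f i))
  pt {zero} f = z≤n
  pt {suc m} f with f zero
  ... | true = s≤s z≤n
  ... | false = pt (λ i → f (suc i))

μ-⋃ : ∀ {n m} α β (Fs : Fin m → Family n) → μ α β (⋃ Fs) ≤ ∑F (λ i → μ α β (Fs i))
μ-⋃ {n} {zero} α β Fs = ≤-reflexive (z {n})
  where
  z : ∀ {n} → μ {n} α β (λ _ → false) ≡ 0
  z {zero} = refl
  z {suc n} = cong₂ _+_ (trans (cong (β *_) (z {n})) (*-zeroʳ β)) (trans (cong (α *_) (z {n})) (*-zeroʳ α))
μ-⋃ {n} {suc m} α β Fs = ≤-trans (≤-reflexive (μ-cong {n} α β (λ S → if-∨ (Fs zero S)))) (≤-trans (μ-∨ α β (Fs zero) (⋃ (λ i → Fs (suc i)))) (+-monoʳ-≤ _ (μ-⋃ α β (λ i → Fs (suc i)))))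
  where
  if-∨ : ∀ a {b} → (if a then true else b) ≡ a ∨ b
  if-∨ true = refl
  if-∨ false = refl

avoid : ∀ {n} → Subset n → Family n
avoid []      []      = true
avoid (x ∷ R) (u ∷ U) = not (x ∧ u) ∧ avoid R U

avoid-mem : ∀ {n} (R U : Subset n) v → avoid R U ≡ true → mem v R ≡ true → mem v U ≡ false
avoid-mem (true ∷ R) (false ∷ U) zero h e = refl
avoid-mem (x ∷ R) (u ∷ U) (suc v) h e = avoid-mem R U v (∧-right {not (x ∧ u)} h) e

avoid-false : ∀ {n} (R U : Subset n) → avoid R U ≡ false → Σ (Fin n) λ v → mem v R ≡ true × mem v U ≡ true
avoid-false [] [] ()
avoid-false (true ∷ R) (true ∷ U) h = zero , refl , refl
avoid-false (false ∷ R) (u ∷ U) h with avoid-false R U h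
... | v , p , q = suc v , p , q
avoid-false (true ∷ R) (false ∷ U) h with avoid-false R U h
... | v , p , q = suc v , p , q

avoid-Down : ∀ {n} (R : Subset n) → Down (avoid R)
avoid-Down R {A} {B} s h with avoid R A in eq
... | true = refl
... | false with avoid-false R A eq
...   | v , p , q with trans (sym (mem-mono v s q)) (avoid-mem R B v h p)
...     | ()

lev-avoid : ∀ {n} (R : Subset n) l → lev l (avoid R) ≡ (n ∸ ∣ R ∣) C l
lev-avoid [] zero = refl
lev-avoid [] (suc l) = refl
lev-avoid {suc n} (true ∷ R) zero = trans (lev-outside (avoid (true ∷ R))) (lev-avoid R 0)
lev-avoid {suc n} (true ∷ R) (suc l) = trans (cong₂ _+_ (lev-avoid R (suc l)) (trans (∑-cong {n} (λ S → *-zeroʳ (ind (∣ S ∣ ≡ᵇ l)))) (∑-zero {n}))) (+-identityʳ _)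
lev-avoid {suc n} (false ∷ R) zero = trans (lev-outside (avoid (false ∷ R))) (trans (lev-avoid R 0) (trans (C-zero (n ∸ ∣ R ∣)) (sym (C-zero (suc n ∸ ∣ R ∣)))))
lev-avoid {suc n} (false ∷ R) (suc l) = trans (cong₂ _+_ (lev-avoid R (suc l)) (lev-avoid R l))
  (trans (+-comm ((n ∸ ∣ R ∣) C suc l) _) (trans (sym (C-pascal (n ∸ ∣ R ∣) l)) (cong (_C suc l) (sym (+-∸-assoc 1 (∣p∣≤n R))))))

-- On the sets avoiding R this is U ↦ Rᶜ ∖ U; being the identity on R makes it a bijection of the whole cube.
flip : ∀ {n} → Subset n → Subset n → Subset n
flip []          []      = []
flip (true ∷ R)  (u ∷ U) = u ∷ flip R U
flip (false ∷ R) (u ∷ U) = not u ∷ flip R U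

∑-flip : ∀ {n} (R : Subset n) (f : Subset n → ℕ) → ∑ (λ U → f (flip R U)) ≡ ∑ f
∑-flip [] f = refl
∑-flip {suc n} (true ∷ R) f = cong₂ _+_ (∑-flip R (λ U → f (outside ∷ U))) (∑-flip R (λ U → f (inside ∷ U)))
∑-flip {suc n} (false ∷ R) f = trans (cong₂ _+_ (∑-flip R (λ U → f (inside ∷ U))) (∑-flip R (λ U → f (outside ∷ U)))) (+-comm (∑ (λ U → f (inside ∷ U))) _)

flip-avoid : ∀ {n} (R U : Subset n) → avoid R U ≡ true → avoid R (flip R U) ≡ true × ∣ flip R U ∣ + (∣ R ∣ + ∣ U ∣) ≡ n × U ⊑ ∁ (flip R U)
flip-avoid [] [] h = refl , refl , []
flip-avoid (true ∷ R) (false ∷ U) h with flip-avoid R U h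
... | a , b , c = a , trans (+-suc ∣ flip R U ∣ (∣ R ∣ + ∣ U ∣)) (cong suc b) , add c
flip-avoid (false ∷ R) (true ∷ U) h with flip-avoid R U h
... | a , b , c = a , trans (cong (∣ flip R U ∣ +_) (+-suc ∣ R ∣ ∣ U ∣)) (trans (+-suc ∣ flip R U ∣ (∣ R ∣ + ∣ U ∣)) (cong suc b)) , keep true c
flip-avoid (false ∷ R) (false ∷ U) h with flip-avoid R U h
... | a , b , c = a , cong suc b , keep false c

image : ∀ {n m} → (Fin m → Fin n) → Subset n
image {n} {zero}  j = Data.Fin.Subset.⊥
image {n} {suc m} j = ins (j zero) (image (λ i → j (suc i)))

mem-ins : ∀ {n} (v : Fin n) S → mem v (ins v S) ≡ true
mem-ins v S = lookup∘update v S inside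

mem-ins-≢ : ∀ {n} {v w : Fin n} S → ¬ (v ≡ w) → mem v (ins w S) ≡ mem v S
mem-ins-≢ {v = v} {w} S h = lookup∘update′ h S inside

image-intro : ∀ {n m} (j : Fin m → Fin n) i → mem (j i) (image j) ≡ true
image-intro j zero = mem-ins (j zero) (image (λ i → j (suc i)))
image-intro j (suc i) = mem-mono (j (suc i)) (ins-⊒ (j zero) (image (λ i → j (suc i)))) (image-intro (λ i → j (suc i)) i)

image-elim : ∀ {n m} (j : Fin m → Fin n) v → mem v (image j) ≡ true → Σ (Fin m) λ i → j i ≡ v
image-elim {n} {zero} j v h with trans (sym (lookup-⊥ v)) h
  where
  lookup-⊥ : ∀ {n} (v : Fin n) → lookup (Data.Fin.Subset.⊥ {n}) v ≡ false
  lookup-⊥ zero = refl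
  lookup-⊥ (suc v) = lookup-⊥ v
... | ()
image-elim {n} {suc m} j v h with v Data.Fin.≟ j zero
... | yes refl = zero , refl
... | no ne with image-elim (λ i → j (suc i)) v (trans (sym (mem-ins-≢ (image (λ i → j (suc i))) ne)) h)
...   | i , e = suc i , e

image-size : ∀ {n m} (j : Fin m → Fin n) → (∀ {i i′} → j i ≡ j i′ → i ≡ i′) → ∣ image j ∣ ≡ m
image-size {n} {zero} j inj = size-⊥ n
  where
  size-⊥ : ∀ n → ∣ Data.Fin.Subset.⊥ {n} ∣ ≡ 0
  size-⊥ zero = refl
  size-⊥ (suc n) = size-⊥ n
image-size {n} {suc m} j inj = trans (ins-size (j zero) (image (λ i → j (suc i))) fresh) (cong suc (image-size (λ i → j (suc i)) (λ e → suc-inj (inj e))))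
  where
  suc-inj : ∀ {m} {i i′ : Fin m} → suc i ≡ suc i′ → i ≡ i′
  suc-inj refl = refl
  fresh : mem (j zero) (image (λ i → j (suc i))) ≡ false
  fresh with mem (j zero) (image (λ i → j (suc i))) in eq
  ... | false = refl
  ... | true with image-elim (λ i → j (suc i)) (j zero) eq
  ...   | i , e with inj e
  ...     | ()

del-absent : ∀ {n} (v : Fin n) S → mem v S ≡ false → del v S ≡ S
del-absent zero (false ∷ S) h = refl
del-absent (suc v) (x ∷ S) h = cong (x ∷_) (del-absent v S h)

-- Stability of near-extremal unions in the product measure

total-split : ∀ b r n → suc r ≤ n → b ^ n ≡ b ^ r * (b * b ^ (n ∸ suc r))
total-split b r n h = begin
  b ^ n ≡⟨ cong (b ^_) (sym (m+[n∸m]≡n h)) ⟩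
  b ^ (suc r + (n ∸ suc r)) ≡⟨ ^-distribˡ-+-* b (suc r) (n ∸ suc r) ⟩
  b * b ^ r * b ^ (n ∸ suc r) ≡⟨ e b (b ^ r) (b ^ (n ∸ suc r)) ⟩
  b ^ r * (b * b ^ (n ∸ suc r)) ∎
  where
  open ≡-Reasoning
  e : ∀ b x y → b * x * y ≡ x * (b * y)
  e = solve-∀

power-≤-double : ∀ α β r → α ≤ β → (α + β) ^ r ≤ 2 ^ r * β ^ r
power-≤-double α β r h = ≤-trans (^-monoˡ-≤ r (≤-trans (+-monoˡ-≤ β h) (≤-reflexive (e β)))) (≤-reflexive (^-distribʳ-* r 2 β))
  where
  e : ∀ β → β + β ≡ 2 * β
  e = solve-∀

-- Harris gives the intersection measure at least q^m ≥ q^r, which exceeds q^(r+1) by p q^r; as p ≥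
-- 1/4 and q ≥ 1/2, δ cannot be small. This excludes both a union of fewer families and two
-- coinciding dictators.
too-few : ∀ {n m} r α β δ (A : Fin m → Family n) → 1 ≤ α → α ≤ β → α + β ≤ 4 * α → m ≤ r → suc r ≤ n →
  (∀ i → Down (A i)) → (∀ i → β * (α + β) ^ n ≤ (α + β) * μ α β (A i)) →
  μ α β (⋂ A) ≤ β ^ suc r * (α + β) ^ (n ∸ suc r) + δ → (α + β) ^ n ≤ 2 ^ r * 4 * δ
too-few {n} {m} r α β δ A α>0 α≤β b≤4α m≤r r<n d hA hδ with m≤n⇒∃[o]m+o≡n m≤r
... | c , refl = begin
  b ^ n ≡⟨ total-split b r n r<n ⟩
  b ^ r * (b * B) ≤⟨ *-mono-≤ (power-≤-double α β r α≤β) (*-monoˡ-≤ B b≤4α) ⟩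
  2 ^ r * β ^ r * (4 * α * B) ≡⟨ e1 (2 ^ r) (β ^ r) α B ⟩
  2 ^ r * 4 * (β ^ r * (α * B)) ≤⟨ *-monoʳ-≤ (2 ^ r * 4) s2 ⟩
  2 ^ r * 4 * δ ∎
  where
  open ≤-Reasoning
  b = α + β
  B = b ^ (n ∸ suc r)
  P = μ α β (⋂ A)
  s1 : β ^ r * (b * B) ≤ P
  s1 = *-cancelˡ-≤-pos (b ^ r) (^-pos r (≤-trans α>0 (m≤m+n α β))) (begin
    b ^ r * (β ^ r * (b * B)) ≡⟨ *-swap (b ^ r) (β ^ r) (b * B) ⟩
    β ^ r * (b ^ r * (b * B)) ≡⟨ cong (β ^ r *_) (sym (total-split b r n r<n)) ⟩
    β ^ (m + c) * b ^ n ≡⟨ cong (_* b ^ n) (^-distribˡ-+-* β m c) ⟩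
    β ^ m * β ^ c * b ^ n ≡⟨ e2 (β ^ m) (β ^ c) (b ^ n) ⟩
    β ^ c * (β ^ m * b ^ n) ≤⟨ *-mono-≤ (^-monoˡ-≤ c (m≤n+m β α)) (harris-⋂ α β A α>0 d hA) ⟩
    b ^ c * (b ^ m * P) ≡⟨ sym (e2 (b ^ m) (b ^ c) P) ⟩
    b ^ m * b ^ c * P ≡⟨ cong (_* P) (sym (^-distribˡ-+-* b m c)) ⟩
    b ^ (m + c) * P ∎)
    where
    e2 : ∀ x y z → x * y * z ≡ y * (x * z)
    e2 = solve-∀
  s2 : β ^ r * (α * B) ≤ δ
  s2 = +-cancelˡ-≤ (β * β ^ r * B) _ _ (begin
    β * β ^ r * B + β ^ r * (α * B) ≡⟨ e3 α β (β ^ r) B ⟩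
    β ^ r * (b * B) ≤⟨ s1 ⟩
    P ≤⟨ hδ ⟩
    β * β ^ r * B + δ ∎)
    where
    e3 : ∀ α β x B → β * x * B + x * (α * B) ≡ x * ((α + β) * B)
    e3 = solve-∀
  e1 : ∀ x y α B → x * y * (4 * α * B) ≡ x * 4 * (y * (α * B))
  e1 = solve-∀

compl-large : ∀ {n} α β (M : Family n) → (α + β) * μ α β M ≤ α * (α + β) ^ n → β * (α + β) ^ n ≤ (α + β) * μ α β (λ S → not (M S))
compl-large {n} α β M h = +-cancelʳ-≤ (b * μ α β M) _ _ (begin
  β * b ^ n + b * μ α β M ≤⟨ +-monoʳ-≤ (β * b ^ n) h ⟩
  β * b ^ n + α * b ^ n ≡⟨ e α β (b ^ n) ⟩
  b * b ^ n ≡⟨ cong (b *_) (sym (μ-compl α β M)) ⟩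
  b * (μ α β (λ S → not (M S)) + μ α β M) ≡⟨ *-distribˡ-+ b _ (μ α β M) ⟩
  b * μ α β (λ S → not (M S)) + b * μ α β M ∎)
  where
  open ≤-Reasoning
  b = α + β
  e : ∀ α β x → β * x + α * x ≡ (α + β) * x
  e = solve-∀

-- `harris-⋂-at` divides q^(r+1) + τ by q^r, so each complement has measure at most q + 2^r τ.
nearly-extremal : ∀ {n} r α β τ (M : Fin (suc r) → Family n) → 1 ≤ α → α ≤ β → suc r ≤ n → (∀ i → Up (M i)) →
  (∀ i → (α + β) * μ α β (M i) ≤ α * (α + β) ^ n) →
  μ α β (⋂ (λ i S → not (M i S))) ≤ β ^ suc r * (α + β) ^ (n ∸ suc r) + τ →
  ∀ i → α * (α + β) ^ n ≤ (α + β) * μ α β (M i) + (α + β) * (2 ^ r * τ)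
nearly-extremal {n} r α β τ M α>0 α≤β r<n u hM hG i = +-cancelˡ-≤ (b * μA) _ _ (begin
    b * μA + α * T ≤⟨ +-monoˡ-≤ (α * T) s2 ⟩
    β * T + b * (2 ^ r * τ) + α * T ≡⟨ e1 α β T (b * (2 ^ r * τ)) ⟩
    b * T + b * (2 ^ r * τ) ≡⟨ cong (λ z → b * z + b * (2 ^ r * τ)) (sym (μ-compl α β (M i))) ⟩
    b * (μA + μ α β (M i)) + b * (2 ^ r * τ) ≡⟨ e2 b μA (μ α β (M i)) (b * (2 ^ r * τ)) ⟩
    b * μA + (b * μ α β (M i) + b * (2 ^ r * τ)) ∎)
  where
  open ≤-Reasoning
  b = α + β
  T = b ^ n
  B = b ^ (n ∸ suc r)
  μA = μ α β (λ S → not (M i S))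
  s1 : μA ≤ β * (b ^ r * B) + 2 ^ r * τ
  s1 = *-cancelˡ-≤-pos (β ^ r) (^-pos r (≤-trans α>0 α≤β)) (begin
    β ^ r * μA ≤⟨ harris-⋂-at α β (λ i S → not (M i S)) α>0 (λ i → not-Down {F = M i} (u i)) (λ i → compl-large α β (M i) (hM i)) i ⟩
    b ^ r * μ α β (⋂ (λ i S → not (M i S))) ≤⟨ *-monoʳ-≤ (b ^ r) hG ⟩
    b ^ r * (β * β ^ r * B + τ) ≡⟨ e3 (b ^ r) β (β ^ r) B τ ⟩
    β ^ r * (β * (b ^ r * B)) + b ^ r * τ ≤⟨ +-monoʳ-≤ (β ^ r * (β * (b ^ r * B))) (*-monoˡ-≤ τ (power-≤-double α β r α≤β)) ⟩
    β ^ r * (β * (b ^ r * B)) + 2 ^ r * β ^ r * τ ≡⟨ e4 (β ^ r) (β * (b ^ r * B)) (2 ^ r) τ ⟩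
    β ^ r * (β * (b ^ r * B) + 2 ^ r * τ) ∎)
    where
    e3 : ∀ x β y B τ → x * (β * y * B + τ) ≡ y * (β * (x * B)) + x * τ
    e3 = solve-∀
    e4 : ∀ y z x τ → y * z + x * y * τ ≡ y * (z + x * τ)
    e4 = solve-∀
  s2 : b * μA ≤ β * T + b * (2 ^ r * τ)
  s2 = begin
    b * μA ≤⟨ *-monoʳ-≤ b s1 ⟩
    b * (β * (b ^ r * B) + 2 ^ r * τ) ≡⟨ e5 b β (b ^ r) B (2 ^ r * τ) ⟩
    β * (b ^ r * (b * B)) + b * (2 ^ r * τ) ≡⟨ cong (λ z → β * z + b * (2 ^ r * τ)) (sym (total-split b r n r<n)) ⟩
    β * T + b * (2 ^ r * τ) ∎
    where
    e5 : ∀ b β x B y → b * (β * (x * B) + y) ≡ β * (x * (b * B)) + b * y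
    e5 = solve-∀
  e1 : ∀ α β T x → β * T + x + α * T ≡ (α + β) * T + x
  e1 = solve-∀
  e2 : ∀ b x y z → b * (x + y) + z ≡ b * x + (b * y + z)
  e2 = solve-∀

μ-absent : ∀ {n} α β (v : Fin n) → β * (α + β) ^ n ≤ (α + β) * μ α β (λ S → not (mem v S))
μ-absent {n} α β v = begin
  β * (α + β) ^ n ≡⟨ cong (β *_) (sym (μ-all n α β)) ⟩
  β * μ {n} α β all ≤⟨ *-monoʳ-≤ β (μ-mono {n} α β (λ S _ → cong not (mem-del v S))) ⟩
  β * μ α β (λ S → not (mem v (del v S))) ≤⟨ m≤n+m _ _ ⟩
  α * μ α β (λ S → not (mem v (ins v S))) + β * μ α β (λ S → not (mem v (del v S))) ≡⟨ μ-coord α β (λ S → not (mem v S)) v ⟩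
  (α + β) * μ α β (λ S → not (mem v S)) ∎
  where
  open ≤-Reasoning
  mem-del : ∀ {n} (v : Fin n) S → mem v (del v S) ≡ false
  mem-del zero (x ∷ S) = refl
  mem-del (suc v) (x ∷ S) = mem-del v S

section-bound : ∀ α γ n e ξ → 1 ≤ α → 2 ≤ γ → 2 * γ ≤ α → γ * α * e ≤ 2 * n * (α + γ) * ξ → e ≤ 2 * (n * ξ)
section-bound α γ n e ξ α>0 γ≥2 γ≤ h = *-cancelˡ-≤ 2 (begin
  2 * e ≤⟨ *-monoˡ-≤ e γ≥2 ⟩
  γ * e ≤⟨ *-cancelˡ-≤-pos (2 * α) (*-pos {2} (s≤s z≤n) α>0) (begin
    2 * α * (γ * e) ≡⟨ e1 α γ e ⟩
    2 * (γ * α * e) ≤⟨ *-monoʳ-≤ 2 h ⟩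
    2 * (2 * n * (α + γ) * ξ) ≡⟨ e2 n α γ ξ ⟩
    2 * (n * ξ) * (2 * α + 2 * γ) ≤⟨ *-monoʳ-≤ (2 * (n * ξ)) (+-monoʳ-≤ (2 * α) (≤-trans γ≤ (m≤m+n α (α + 0)))) ⟩
    2 * (n * ξ) * (2 * α + 2 * α) ≡⟨ e3 (n * ξ) α ⟩
    2 * α * (2 * (2 * (n * ξ))) ∎) ⟩
  2 * (2 * (n * ξ)) ∎)
  where
  open ≤-Reasoning
  e1 : ∀ α γ e → 2 * α * (γ * e) ≡ 2 * (γ * α * e)
  e1 = solve-∀
  e2 : ∀ n α γ ξ → 2 * (2 * n * (α + γ) * ξ) ≡ 2 * (n * ξ) * (2 * α + 2 * γ)
  e2 = solve-∀
  e3 : ∀ x α → 2 * x * (2 * α + 2 * α) ≡ 2 * α * (2 * (2 * x))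
  e3 = solve-∀

-- If j i = j i′, the r coordinates j x with x ≠ i already form the whole image. A set missing them
-- is unchanged by every `del (j x)`, hence lies in G or in some section, and so q^r would be at
-- most q^(r+1) plus a small error.
dictators-distinct : ∀ {n} r α β τ ε (M : Fin (suc r) → Family n) (j : Fin (suc r) → Fin n) →
  1 ≤ α → α ≤ β → α + β ≤ 4 * α → suc r ≤ n →
  μ α β (⋂ (λ i S → not (M i S))) ≤ β ^ suc r * (α + β) ^ (n ∸ suc r) + τ →
  (∀ i → μ α β (λ S → M i (del (j i) S)) ≤ ε) → 2 ^ r * 4 * (τ + suc r * ε) < (α + β) ^ n →
  ∀ {i i′} → j i ≡ j i′ → i ≡ i′
dictators-distinct {n} r α β τ ε M j α>0 α≤β b≤4α r<n hG small hε {i} {i′} ji≡ with i Data.Fin.≟ i′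
... | yes e = e
... | no i≢i′ = ⊥-elim (<-irrefl refl (≤-trans hε (too-few r α β (τ + suc r * ε) A α>0 α≤β b≤4α ≤-refl r<n
      (λ x → not-Down {F = mem (j (punchIn i x))} (mem-mono (j (punchIn i x)))) (λ x → μ-absent α β (j (punchIn i x))) (begin
        μ α β (⋂ A) ≤⟨ μ-mono {n} α β cover ⟩
        μ α β (λ S → G S ∨ ⋃ V S) ≤⟨ μ-∨ α β G (⋃ V) ⟩
        μ α β G + μ α β (⋃ V) ≤⟨ +-mono-≤ hG (≤-trans (μ-⋃ α β V) (∑F-upper small)) ⟩
        β ^ suc r * b ^ (n ∸ suc r) + τ + suc r * ε ≡⟨ +-assoc (β ^ suc r * b ^ (n ∸ suc r)) τ (suc r * ε) ⟩
        β ^ suc r * b ^ (n ∸ suc r) + (τ + suc r * ε) ∎))))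
  where
  open ≤-Reasoning
  b = α + β
  G = ⋂ (λ i S → not (M i S))
  V : Fin (suc r) → Family n
  V i S = M i (del (j i) S)
  A : Fin r → Family n
  A x S = not (mem (j (punchIn i x)) S)
  absent : ∀ S → ⋂ A S ≡ true → ∀ x → mem (j x) S ≡ false
  absent S h x with i Data.Fin.≟ x
  ... | no i≢x = subst (λ z → mem (j z) S ≡ false) (punchIn-punchOut i≢x) (not-injective-true (⋂-elim A S h (punchOut i≢x)))
  ... | yes refl = subst (λ z → mem z S ≡ false) (sym ji≡) (subst (λ z → mem (j z) S ≡ false) (punchIn-punchOut i≢i′) (not-injective-true (⋂-elim A S h (punchOut i≢i′))))
  cover : ∀ S → ⋂ A S ≡ true → G S ∨ ⋃ V S ≡ true
  cover S h with ⋃ V S in eq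
  ... | true = ∨-introʳ (G S) refl
  ... | false = ∨-introˡ false (⋂-intro (λ i S → not (M i S)) S (λ x → not-true (λ m → absurd x m)))
    where
    absurd : ∀ x → M x S ≡ true → ⊥
    absurd x m with trans (sym eq) (anyFin-intro (λ i → V i S) x (trans (cong (M x) (del-absent (j x) S (absent S h x))) m))
    ... | ()

-- In ε, the factor (α + β) 2^r τ is the deficit ξ left by `nearly-extremal`, and 2n is the loss in
-- `section-bound`.
dictators : ∀ {n} r γ σ τ (M : Fin (suc r) → Family n) → let α = 2 * γ + σ ; β = α + γ ; ε = 2 * (n * ((α + β) * (2 ^ r * τ))) in
  2 ≤ γ → suc r ≤ n → (∀ i → Up (M i)) → (∀ i → Complement-free (M i)) →
  μ α β (⋂ (λ i S → not (M i S))) ≤ β ^ suc r * (α + β) ^ (n ∸ suc r) + τ →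
  8 * (2 ^ r * τ) ≤ (α + β) ^ n → 2 ^ r * 4 * (τ + suc r * ε) < (α + β) ^ n →
  Σ (Fin (suc r) → Fin n) λ j → (∀ {i i′} → j i ≡ j i′ → i ≡ i′) × (∀ i → μ α β (λ S → M i (del (j i) S)) ≤ ε)
dictators {n} r γ σ τ M γ≥2 r<n u c hG h8 hε = j , dictators-distinct r α β τ ε M j α>0 (m≤m+n α γ) b≤4α r<n hG small hε , small
  where
  open ≤-Reasoning
  α = 2 * γ + σ
  β = α + γ
  b = α + β
  T = b ^ n
  ξ = b * (2 ^ r * τ)
  ε = 2 * (n * ξ)
  γ>0 : 1 ≤ γ
  γ>0 = ≤-trans (s≤s z≤n) γ≥2
  2γ≤α : 2 * γ ≤ α
  2γ≤α = m≤m+n (2 * γ) σ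
  α>0 : 1 ≤ α
  α>0 = ≤-trans γ>0 (≤-trans (m≤m+n γ (γ + 0)) 2γ≤α)
  b≤4α : b ≤ 4 * α
  b≤4α = begin
    α + (α + γ) ≤⟨ +-monoʳ-≤ α (+-monoʳ-≤ α (≤-trans (m≤m+n γ (γ + 0)) 2γ≤α)) ⟩
    α + (α + α) ≤⟨ m≤m+n _ α ⟩
    α + (α + α) + α ≡⟨ e α ⟩
    4 * α ∎
    where
    e : ∀ α → α + (α + α) + α ≡ 4 * α
    e = solve-∀
  hM : ∀ i → b * μ α β (M i) ≤ α * T
  hM i = ekr γ σ (M i) γ>0 (u i) (c i)
  2ξ≤ : 2 * ξ ≤ α * T
  2ξ≤ = begin
    2 * (b * (2 ^ r * τ)) ≤⟨ *-monoʳ-≤ 2 (*-monoˡ-≤ (2 ^ r * τ) b≤4α) ⟩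
    2 * (4 * α * (2 ^ r * τ)) ≡⟨ e α (2 ^ r * τ) ⟩
    α * (8 * (2 ^ r * τ)) ≤⟨ *-monoʳ-≤ α h8 ⟩
    α * T ∎
    where
    e : ∀ α x → 2 * (4 * α * x) ≡ α * (8 * x)
    e = solve-∀
  dict : ∀ i → Σ (Fin n) λ v → γ * α * μ α β (λ S → M i (del v S)) ≤ 2 * n * β * ξ
  dict i = dictator γ σ (M i) ξ (≤-trans (s≤s z≤n) r<n) γ>0 (u i) (c i) (nearly-extremal r α β τ M α>0 (m≤m+n α γ) r<n u hM hG i) 2ξ≤
  j : Fin (suc r) → Fin n
  j i = proj₁ (dict i)
  small : ∀ i → μ α β (λ S → M i (del (j i) S)) ≤ ε
  small i = section-bound α γ n _ ξ α>0 γ≥2 2γ≤α (proj₂ (dict i))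

-- Expansion of small families avoiding R

-- The ratio (X - i)/(i + 1) is at least n/(2k), and n/(2k) ≥ (n + D)/n because 2k (n + D) = (n -
-- D)(n + D) = n² - D².
C-growth-step : ∀ k D X i → suc i ≤ k → 2 * k + D + 2 * k ≤ 2 * X →
  (X C i) * (2 * k + D + D) ≤ (2 * k + D) * (X C suc i)
C-growth-step k D X i i<k hX = *-cancelˡ-≤ (2 * suc i) (begin
    2 * suc i * ((X C i) * (n + D)) ≡⟨ e1 (suc i) (X C i) (n + D) ⟩
    (2 * suc i * (n + D)) * (X C i) ≤⟨ *-monoˡ-≤ (X C i) (≤-trans (*-monoˡ-≤ (n + D) (*-monoʳ-≤ 2 i<k)) key) ⟩
    (n * (2 * (X ∸ i))) * (X C i) ≡⟨ e2 n (X ∸ i) (X C i) ⟩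
    2 * n * ((X ∸ i) * (X C i)) ≡⟨ cong (2 * n *_) (sym (C-step X i)) ⟩
    2 * n * (suc i * (X C suc i)) ≡⟨ e3 n (suc i) (X C suc i) ⟩
    2 * suc i * (n * (X C suc i)) ∎)
  where
  open ≤-Reasoning
  n = 2 * k + D
  far : n ≤ 2 * (X ∸ i)
  far = +-cancelʳ-≤ (2 * i) _ _ (begin
    n + 2 * i ≤⟨ +-monoʳ-≤ n (*-monoʳ-≤ 2 (<⇒≤ i<k)) ⟩
    n + 2 * k ≤⟨ hX ⟩
    2 * X ≤⟨ *-monoʳ-≤ 2 (≤-trans (m≤n+m∸n X i) (≤-reflexive (+-comm i (X ∸ i)))) ⟩
    2 * (X ∸ i + i) ≡⟨ *-distribˡ-+ 2 (X ∸ i) i ⟩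
    2 * (X ∸ i) + 2 * i ∎)
  key : 2 * k * (n + D) ≤ n * (2 * (X ∸ i))
  key = begin
    2 * k * (n + D) ≤⟨ m≤m+n _ (D * D) ⟩
    2 * k * (n + D) + D * D ≡⟨ e k D ⟩
    n * n ≤⟨ *-monoʳ-≤ n far ⟩
    n * (2 * (X ∸ i)) ∎
    where
    e : ∀ k D → 2 * k * (2 * k + D + D) + D * D ≡ (2 * k + D) * (2 * k + D)
    e = solve-∀
  e1 : ∀ s c x → 2 * s * (c * x) ≡ (2 * s * x) * c
  e1 = solve-∀
  e2 : ∀ n x c → (n * (2 * x)) * c ≡ 2 * n * (x * c)
  e2 = solve-∀
  e3 : ∀ n s c → 2 * n * (s * c) ≡ 2 * s * (n * c)
  e3 = solve-∀

C-growth : ∀ k D X i j → 1 ≤ 2 * k + D → j + i ≤ k → 2 * k + D + 2 * k ≤ 2 * X →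
  (X C i) * (2 * k + D + j * D) ≤ (2 * k + D) * (X C (j + i))
C-growth k D X i zero n>0 h hX = ≤-reflexive (trans (cong ((X C i) *_) (+-identityʳ _)) (*-comm (X C i) _))
C-growth k D X i (suc j) n>0 h hX = *-cancelˡ-≤-pos n n>0 (begin
  n * ((X C i) * (n + suc j * D)) ≤⟨ m≤m+n _ ((X C i) * (j * D * D)) ⟩
  n * ((X C i) * (n + suc j * D)) + (X C i) * (j * D * D) ≡⟨ e1 n (X C i) j D ⟩
  (X C i) * (n + j * D) * (n + D) ≤⟨ *-monoˡ-≤ (n + D) (C-growth k D X i j n>0 (<⇒≤ h) hX) ⟩
  n * (X C (j + i)) * (n + D) ≡⟨ *-assoc n (X C (j + i)) (n + D) ⟩
  n * ((X C (j + i)) * (n + D)) ≤⟨ *-monoʳ-≤ n (C-growth-step k D X (j + i) h hX) ⟩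
  n * (n * (X C suc (j + i))) ∎)
  where
  open ≤-Reasoning
  n = 2 * k + D
  e1 : ∀ n c j D → n * (c * (n + suc j * D)) + c * (j * D * D) ≡ c * (n + j * D) * (n + D)
  e1 = solve-∀

at : ∀ {n} → ℕ → Family n → Family n
at k F U = (∣ U ∣ ≡ᵇ k) ∧ F U

-- The sets missing R that are disjoint from some member of E. They form a down-set, so
-- `shadow-chain` applies.
boundary : ∀ {n} → Subset n → Family n → Family n
boundary R E U = avoid R U ∧ up E (∁ U)

∁-anti : ∀ {n} {A B : Subset n} → A ⊑ B → ∁ B ⊑ ∁ A
∁-anti [] = []
∁-anti (keep x h) = keep (not x) (∁-anti h)
∁-anti (add h) = add (∁-anti h)

boundary-Down : ∀ {n} (R : Subset n) E → Down (boundary R E)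
boundary-Down R E {A} {B} h e = ∧-both (avoid-Down R h (∧-left e)) (up-Up E (∁-anti h) (∧-right {avoid R B} e))

-- The complement of a member inside Rᶜ is disjoint from it and misses R; `∑-flip` replaces an
-- injectivity argument.
lev-flip : ∀ {n} (R : Subset n) k l (E : Family n) → l + (∣ R ∣ + k) ≡ n → (∀ U → E U ≡ true → avoid R U ≡ true) →
  lev k E ≤ lev l (boundary R (at k E))
lev-flip {n} R k l E hl hE = ≤-trans (∑-mono {n} pt) (≤-reflexive (∑-flip R (λ U → ind (∣ U ∣ ≡ᵇ l) * ind (boundary R (at k E) U))))
  where
  pt : ∀ U → ind (∣ U ∣ ≡ᵇ k) * ind (E U) ≤ ind (∣ flip R U ∣ ≡ᵇ l) * ind (boundary R (at k E) (flip R U))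
  pt U with ∣ U ∣ ≡ᵇ k in eq
  ... | false = z≤n
  ... | true with E U in eqE
  ...   | false = z≤n
  ...   | true with flip-avoid R U (hE U eqE)
  ...     | a , s , i = ≤-reflexive (sym (cong₂ (λ x y → ind x * ind y)
      (subst (λ z → (∣ flip R U ∣ ≡ᵇ z) ≡ true) size (≡ᵇ-refl ∣ flip R U ∣))
      (∧-both a (up-intro (at k E) i (∧-both eq eqE)))))
    where
    size : ∣ flip R U ∣ ≡ l
    size = +-cancelʳ-≡ (∣ R ∣ + ∣ U ∣) _ _ (trans s (trans (sym hl) (cong (λ z → l + (∣ R ∣ + z)) (sym (≡ᵇ-sound ∣ U ∣ k eq)))))

-- Complementing inside Rᶜ puts at least |E| sets into level L = n - r - k of the down-set Y. If
-- level k₁ has fewer than `X C k₁` sets, then `shadow-chain` makes it larger than level L by the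
-- factor (X C k₁)/(X C L). Since X - L = k - 1 - rt, this factor is at least 1 + rtD/n ≥ 1 + 2r,
-- which explains the choice of X.
boundary-large : ∀ {n} k₁ D r t k (R : Subset n) (E : Family n) → let X = n ∸ (r + suc (r * t)) in
  n ≡ 2 * suc k₁ + D → ∣ R ∣ ≡ r → 2 * (r + suc (r * t)) ≤ D → 2 * n ≤ t * D → k ≤ suc k₁ →
  (∀ U → E U ≡ true → avoid R U ≡ true) → 1 ≤ lev k E → 2 * r * lev k E < X C k₁ →
  2 * r * lev k E < lev k₁ (boundary R (at k E))
boundary-large {n} k₁ D r t k R E n≡ R≡ hD ht k≤ hE E>0 small with (n ∸ (r + suc (r * t))) C k₁ ≤? lev k₁ (boundary R (at k E))
... | yes p = ≤-trans small p
... | no p = main k₁ refl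
  where
  open ≤-Reasoning
  s = suc (r * t)
  X = n ∸ (r + s)
  Y = boundary R (at k E)
  L = n ∸ (r + k)
  rs≤D : r + s ≤ D
  rs≤D = ≤-trans (m≤m+n (r + s) (r + s + 0)) hD
  rs≤n : r + s ≤ n
  rs≤n = ≤-trans rs≤D (≤-trans (m≤n+m D (2 * suc k₁)) (≤-reflexive (sym n≡)))
  k₁rk≤n : k₁ + (r + k) ≤ n
  k₁rk≤n = begin
    k₁ + (r + k) ≤⟨ +-mono-≤ (n≤1+n k₁) (+-mono-≤ (≤-trans (m≤m+n r s) rs≤D) k≤) ⟩
    suc k₁ + (D + suc k₁) ≡⟨ e (suc k₁) D ⟩
    2 * suc k₁ + D ≡⟨ sym n≡ ⟩
    n ∎
    where
    e : ∀ k D → k + (D + k) ≡ 2 * k + D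
    e = solve-∀
  L-eq : L + (r + k) ≡ n
  L-eq = m∸n+n≡m (≤-trans (m≤n+m (r + k) k₁) k₁rk≤n)
  X-eq : X + (r + s) ≡ n
  X-eq = m∸n+n≡m rs≤n
  E≤ : lev k E ≤ lev L Y
  E≤ = lev-flip R k L E (trans (cong (λ z → L + (z + k)) R≡) L-eq) hE
  n>0 : 1 ≤ 2 * suc k₁ + D
  n>0 = s≤s z≤n
  hX : 2 * suc k₁ + D + 2 * suc k₁ ≤ 2 * X
  hX = +-cancelʳ-≤ (2 * (r + s)) _ _ (begin
    2 * suc k₁ + D + 2 * suc k₁ + 2 * (r + s) ≤⟨ +-monoʳ-≤ (2 * suc k₁ + D + 2 * suc k₁) hD ⟩
    2 * suc k₁ + D + 2 * suc k₁ + D ≡⟨ e (suc k₁) D ⟩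
    2 * (2 * suc k₁ + D) ≡⟨ cong (2 *_) (trans (sym n≡) (sym X-eq)) ⟩
    2 * (X + (r + s)) ≡⟨ *-distribˡ-+ 2 X (r + s) ⟩
    2 * X + 2 * (r + s) ∎)
    where
    e : ∀ k D → 2 * k + D + 2 * k + D ≡ 2 * (2 * k + D)
    e = solve-∀
  -- By symmetry the lower index is X - L, at least rt below k₁; the successor in s pays for the
  -- case k = k₁ + 1.
  shrink : (X C L) * (n + 2 * r * n) ≤ n * (X C k₁)
  shrink with L ≤? X
  ... | no L>X = ≤-trans (≤-reflexive (cong (_* (n + 2 * r * n)) (k>n⇒nCk≡0 (≰⇒> L>X)))) z≤n
  ... | yes L≤X = begin
    (X C L) * (n + 2 * r * n) ≡⟨ cong (_* (n + 2 * r * n)) (nCk≡nC[n∸k] L≤X) ⟩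
    (X C i) * (n + 2 * r * n) ≤⟨ *-monoʳ-≤ (X C i) (+-monoʳ-≤ n (begin
      2 * r * n ≡⟨ e1 r n ⟩
      r * (2 * n) ≤⟨ *-monoʳ-≤ r ht ⟩
      r * (t * D) ≡⟨ sym (*-assoc r t D) ⟩
      r * t * D ≤⟨ *-monoˡ-≤ D rt≤j ⟩
      j * D ∎)) ⟩
    (X C i) * (n + j * D) ≡⟨ cong (λ z → (X C i) * (z + j * D)) n≡ ⟩
    (X C i) * (2 * suc k₁ + D + j * D) ≤⟨ C-growth (suc k₁) D X i j n>0 (≤-trans (≤-reflexive ji) (n≤1+n k₁)) hX ⟩
    (2 * suc k₁ + D) * (X C (j + i)) ≡⟨ cong₂ (λ a c → a * (X C c)) (sym n≡) ji ⟩
    n * (X C k₁) ∎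
    where
    i = X ∸ L
    j = k₁ ∸ i
    e1 : ∀ r n → 2 * r * n ≡ r * (2 * n)
    e1 = solve-∀
    e2 : ∀ L i r s → L + i + (r + s) ≡ L + (r + (i + s))
    e2 = solve-∀
    is≡k : i + s ≡ k
    is≡k = +-cancelˡ-≡ r _ _ (+-cancelˡ-≡ L _ _ (trans (sym (e2 L i r s)) (trans (cong (_+ (r + s)) (m+[n∸m]≡n L≤X)) (trans X-eq (sym L-eq)))))
    irt≤ : i + r * t ≤ k₁
    irt≤ = ≤-pred (≤-trans (≤-reflexive (trans (sym (+-suc i (r * t))) is≡k)) k≤)
    ji : j + i ≡ k₁
    ji = m∸n+n≡m (≤-trans (m≤m+n i (r * t)) irt≤)
    rt≤j : r * t ≤ j
    rt≤j = m+n≤o⇒m≤o∸n (r * t) (≤-trans (≤-reflexive (+-comm (r * t) i)) irt≤)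
  main : ∀ x → x ≡ k₁ → 2 * r * lev k E < lev k₁ Y
  -- `shadow-chain` starts at a positive level. For k₁ = 0, having fewer than `X C 0` = 1 sets at
  -- level 0 makes Y empty, although E is not.
  main zero refl = ⊥-elim (1+n≰n (≤-trans E>0 (≤-trans E≤ (≤-reflexive (lev-zero L Y (boundary-Down R (at k E))
    (n<1⇒n≡0 (≤-trans (≰⇒> p) (≤-reflexive (C-zero X)))))))))
  main (suc j) refl with m≤n⇒∃[o]m+o≡n (+-cancelʳ-≤ (r + k) _ _ (≤-trans k₁rk≤n (≤-reflexive (sym L-eq))))
  ... | i , eq = ≤-trans (+-monoˡ-≤ (2 * r * lev k E) E>0) (*-cancelˡ-≤-pos (n * (X C k₁)) (*-pos (≤-trans n>0 (≤-reflexive (sym n≡))) Cpos) (begin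
      n * (X C k₁) * (lev k E + 2 * r * lev k E) ≡⟨ e1 n (X C k₁) (lev k E) r ⟩
      lev k E * (X C k₁) * (n + 2 * r * n) ≤⟨ *-monoˡ-≤ (n + 2 * r * n) (≤-trans (*-monoˡ-≤ (X C k₁) E≤) chain) ⟩
      lev k₁ Y * (X C L) * (n + 2 * r * n) ≡⟨ *-assoc (lev k₁ Y) (X C L) (n + 2 * r * n) ⟩
      lev k₁ Y * ((X C L) * (n + 2 * r * n)) ≤⟨ *-monoʳ-≤ (lev k₁ Y) shrink ⟩
      lev k₁ Y * (n * (X C k₁)) ≡⟨ *-comm (lev k₁ Y) _ ⟩
      n * (X C k₁) * lev k₁ Y ∎))
    where
    e1 : ∀ n c x r → n * c * (x + 2 * r * x) ≡ x * c * (n + 2 * r * n)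
    e1 = solve-∀
    Cpos : 1 ≤ X C k₁
    Cpos = ≤-trans (s≤s z≤n) (≰⇒> p)
    chain : lev L Y * (X C k₁) ≤ lev k₁ Y * (X C L)
    chain = subst (λ z → lev z Y * (X C k₁) ≤ lev k₁ Y * (X C z)) (trans (+-comm i (suc j)) eq) (proj₂ (shadow-chain j X Y (boundary-Down R (at k E)) (<⇒≤ (≰⇒> p)) i))

-- Rigidity at level k

maximum : ∀ {m} (f : Fin m → ℕ) → Σ ℕ λ x → (∀ i → f i ≤ x) × (x ≡ 0 ⊎ Σ (Fin m) λ i → f i ≡ x)
maximum {zero} f = 0 , (λ ()) , inj₁ refl
maximum {suc m} f with maximum (λ i → f (suc i))
... | x , h , a with f zero ≤? x
...   | yes p = x , (λ { zero → p ; (suc i) → h i }) , attained a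
  where
  attained : (x ≡ 0 ⊎ Σ (Fin m) λ i → f (suc i) ≡ x) → x ≡ 0 ⊎ Σ (Fin (suc m)) λ i → f i ≡ x
  attained (inj₁ z) = inj₁ z
  attained (inj₂ (i , e)) = inj₂ (suc i , e)
...   | no p = f zero , (λ { zero → ≤-refl ; (suc i) → ≤-trans (h i) (<⇒≤ (≰⇒> p)) }) , inj₂ (zero , refl)

-- The alternative x ≡ 0 covers empty index sets; in `rigidity` it is the case where all families
-- are empty.
maximum₂ : ∀ {m l} (f : Fin m → Fin l → ℕ) → Σ ℕ λ x → (∀ i j → f i j ≤ x) × (x ≡ 0 ⊎ Σ (Fin m) λ i → Σ (Fin l) λ j → f i j ≡ x)
maximum₂ f with maximum (λ i → proj₁ (maximum (f i)))
... | x , h , a = x , (λ i j → ≤-trans (proj₁ (proj₂ (maximum (f i))) j) (h i)) , attained a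
  where
  attained : (x ≡ 0 ⊎ Σ _ λ i → proj₁ (maximum (f i)) ≡ x) → x ≡ 0 ⊎ Σ _ λ i → Σ _ λ j → f i j ≡ x
  attained (inj₁ z) = inj₁ z
  attained (inj₂ (i , e)) with proj₂ (proj₂ (maximum (f i)))
  ... | inj₁ z = inj₁ (trans (sym e) z)
  ... | inj₂ (j , e′) = inj₂ (i , j , trans e′ e)

lev-cover : ∀ {n} l {F G H : Family n} → (∀ S → ∣ S ∣ ≡ l → F S ≡ true → G S ≡ true ⊎ H S ≡ true) → lev l F ≤ lev l G + lev l H
lev-cover {n} l {F} {G} {H} h = ≤-trans (∑-mono {n} (λ S → ind-lev-mono ∣ S ∣ l (pt S))) (≤-reflexive (lev-+ l G H))
  where
  pt : ∀ S → ∣ S ∣ ≡ l → ind (F S) ≤ ind (G S) + ind (H S)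
  pt S e with F S in eq
  ... | false = z≤n
  ... | true with h S e eq
  ...   | inj₁ g rewrite g = s≤s z≤n
  ...   | inj₂ g rewrite g = m≤n+m 1 (ind (G S))

lev-∧-split : ∀ {n} l (F G : Family n) → lev l (λ S → F S ∧ G S) + lev l (λ S → F S ∧ not (G S)) ≤ lev l F
lev-∧-split {n} l F G = ≤-trans (≤-reflexive (sym (lev-+ l (λ S → F S ∧ G S) (λ S → F S ∧ not (G S))))) (∑-mono {n} (λ S → *-monoʳ-≤ (ind (∣ S ∣ ≡ᵇ l)) (pt (F S) (G S))))
  where
  pt : ∀ a b → ind (a ∧ b) + ind (a ∧ not b) ≤ ind a
  pt true true = ≤-refl
  pt true false = ≤-refl
  pt false b = z≤n

lev-link-≤ : ∀ {n} (G : Family n) v j → lev j (link G v) ≤ lev (suc j) G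
lev-link-≤ {n} G v j = ≤-trans (≤-reflexive (lev-link G v j)) (∑-mono {n} (λ S → ≤-trans (*-monoˡ-≤ (ind (∣ S ∣ ≡ᵇ suc j) * ind (G S)) (ind≤1 (mem v S))) (≤-reflexive (+-identityʳ _))))

⋂-not-false : ∀ {n m} (M : Fin m → Family n) S → ⋂ (λ i S → not (M i S)) S ≡ false → Σ (Fin m) λ i → M i S ≡ true
⋂-not-false {m = suc m} M S h with M zero S in eq
... | true = zero , eq
... | false with ⋂-not-false (λ i → M (suc i)) S h
...   | i , e = suc i , e

ins-⊑ : ∀ {n} (v : Fin n) {A B} → A ⊑ B → mem v B ≡ true → ins v A ⊑ B
ins-⊑ zero (keep .true h) refl = keep true h
ins-⊑ zero (add h) e = keep true h
ins-⊑ (suc v) (keep x h) e = keep x (ins-⊑ v h e)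
ins-⊑ (suc v) (add h) e = add (ins-⊑ v h e)

∁-ins-del : ∀ {n} (v : Fin n) S → ∁ (ins v S) ≡ del v (∁ S)
∁-ins-del zero (x ∷ S) = refl
∁-ins-del (suc v) (x ∷ S) = cong (not x ∷_) (∁-ins-del v S)

≡true⊎false : ∀ a → a ≡ true ⊎ a ≡ false
≡true⊎false true = inj₁ refl
≡true⊎false false = inj₂ refl

-- fam i zero and fam i (suc x) hold the sets S of F_i missing j_i, with S ∩ R = ∅ and, after removal of j_x, with
-- S ∩ R = {j_x}.  For the most numerous of these families, its boundary consists of sets U with U ∪ {j_i} ∉ F_i; these
-- are lost from F unless counted by some fam i′ (suc i), so |boundary| ≤ 2r · maximum, contradicting boundary-large.
rigidity : ∀ {n} k₁ D r t (M : Fin r → Family n) (j : Fin r → Fin n) →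
  let G = ⋂ (λ i S → not (M i S)) ; R = image j in
  n ≡ 2 * suc k₁ + D → 2 * (r + suc (r * t)) ≤ D → 2 * n ≤ t * D →
  (∀ i → Up (M i)) → (∀ i → Complement-free (M i)) → (∀ {i i′} → j i ≡ j i′ → i ≡ i′) →
  lev (suc k₁) G ≤ (n ∸ r) C suc k₁ →
  (∀ i → 2 * r * lev (suc k₁) (λ S → M i (del (j i) S)) < (n ∸ (r + suc (r * t))) C k₁) →
  ∀ S → ∣ S ∣ ≡ suc k₁ → (avoid R S ≡ true → G S ≡ true) × (G S ≡ true → avoid R S ≡ true)
rigidity {n} k₁ D r t M j n≡ hD ht u c inj hG small = conclude (maximum₂ cnt)
  where
  k = suc k₁
  G : Family n
  G = ⋂ (λ i S → not (M i S))
  R : Subset n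
  R = image j
  R≡ : ∣ R ∣ ≡ r
  R≡ = image-size j inj
  V : Fin r → Family n
  V i S = M i (del (j i) S)
  fam : Fin r → Fin (suc r) → Family n
  fam i zero U = avoid R U ∧ V i U
  fam i (suc x) U = avoid R U ∧ V i (ins (j x) U)
  size : Fin (suc r) → ℕ
  size zero = k
  size (suc _) = k₁
  cnt : Fin r → Fin (suc r) → ℕ
  cnt i x = lev (size x) (fam i x)
  size≤ : ∀ x → size x ≤ k
  size≤ zero = ≤-refl
  size≤ (suc _) = n≤1+n k₁
  fam-avoid : ∀ i x U → fam i x U ≡ true → avoid R U ≡ true
  fam-avoid i zero U h = ∧-left h
  fam-avoid i (suc x) U h = ∧-left h
  absent : ∀ U i → avoid R U ≡ true → mem (j i) U ≡ false
  absent U i h = avoid-mem R U (j i) h (image-intro j i)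
  cnt≤ : ∀ i x → cnt i x ≤ lev k (V i)
  cnt≤ i zero = lev-mono k {fam i zero} {V i} (λ S _ h → ∧-right {avoid R S} h)
  cnt≤ i (suc x) = ≤-trans (lev-mono k₁ {fam i (suc x)} {link (V i) (j x)} (λ S _ h → ∧-both (cong not (absent S x (∧-left h))) (∧-right {avoid R S} h)))
    (lev-link-≤ (V i) (j x) k₁)
  Miss : Family n
  Miss S = G S ∧ not (avoid R S)
  -- By `hG`, G has no more k-sets than `avoid R`. So the members of G meeting R are no more
  -- numerous than the avoiding sets that G lacks, and each of the latter is in some `fam i zero`.
  miss≤ : lev k Miss ≤ ∑F (λ i → cnt i zero)
  miss≤ = +-cancelˡ-≤ (lev k (λ S → G S ∧ avoid R S)) _ _ (begin
    lev k (λ S → G S ∧ avoid R S) + lev k Miss ≤⟨ lev-∧-split k G (avoid R) ⟩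
    lev k G ≤⟨ hG ⟩
    (n ∸ r) C k ≡⟨ cong (λ z → (n ∸ z) C k) (sym R≡) ⟩
    (n ∸ ∣ R ∣) C k ≡⟨ sym (lev-avoid R k) ⟩
    lev k (avoid R) ≤⟨ lev-cover k {avoid R} {λ S → G S ∧ avoid R S} {⋃ (λ i → fam i zero)} cover ⟩
    lev k (λ S → G S ∧ avoid R S) + lev k (⋃ (λ i → fam i zero)) ≤⟨ +-monoʳ-≤ (lev k (λ S → G S ∧ avoid R S)) (lev-⋃ k (λ i → fam i zero)) ⟩
    lev k (λ S → G S ∧ avoid R S) + ∑F (λ i → cnt i zero) ∎)
    where
    open ≤-Reasoning
    cover : ∀ S → ∣ S ∣ ≡ k → avoid R S ≡ true → G S ∧ avoid R S ≡ true ⊎ ⋃ (λ i → fam i zero) S ≡ true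
    cover S _ h with ≡true⊎false (G S)
    ... | inj₁ g = inj₁ (∧-both g h)
    ... | inj₂ g with ⋂-not-false M S g
    ...   | i , m = inj₂ (anyFin-intro (λ i → fam i zero S) i (∧-both h (trans (cong (M i) (del-absent (j i) S (absent S i h))) m)))
  -- The complement of U with j i added contains S, or S with j x added, up to the point j i that
  -- `V i` ignores. By complement-freeness U with j i added is then not in `M i`.
  inner : ∀ i x S U → avoid R U ≡ true → S ⊑ ∁ U → fam i x S ≡ true → M i (∁ (ins (j i) U)) ≡ true
  inner i zero S U a s f = subst (λ z → M i z ≡ true) (sym (∁-ins-del (j i) U)) (u i (del-mono (j i) s) (∧-right {avoid R S} f))
  inner i (suc x) S U a s f = subst (λ z → M i z ≡ true) (sym (∁-ins-del (j i) U))
    (u i (del-mono (j i) (ins-⊑ (j x) s (trans (mem-∁ (j x) U) (cong not (absent U x a))))) (∧-right {avoid R S} f))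
  -- Let U′ be U with j i added; it meets R. If U′ is in G, then `Miss` counts it. Otherwise some
  -- `M i′` contains it, where i′ ≠ i by `inner`; j i′ is not in U′, so U is in `fam i′ (suc i)`.
  boundary≤ : ∀ i x → lev k₁ (boundary R (at (size x) (fam i x))) ≤ lev k Miss + ∑F (λ i′ → cnt i′ (suc i))
  boundary≤ i x = begin
    lev k₁ (boundary R (at (size x) (fam i x))) ≤⟨ lev-cover k₁ {boundary R (at (size x) (fam i x))} {link Miss (j i)} {⋃ (λ i′ → fam i′ (suc i))} cover ⟩
    lev k₁ (link Miss (j i)) + lev k₁ (⋃ (λ i′ → fam i′ (suc i))) ≤⟨ +-mono-≤ (lev-link-≤ Miss (j i) k₁) (lev-⋃ k₁ (λ i′ → fam i′ (suc i))) ⟩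
    lev k Miss + ∑F (λ i′ → cnt i′ (suc i)) ∎
    where
    open ≤-Reasoning
    meets : ∀ U → avoid R (ins (j i) U) ≡ false
    meets U with ≡true⊎false (avoid R (ins (j i) U))
    ... | inj₂ h = h
    ... | inj₁ h with trans (sym (mem-ins (j i) U)) (absent (ins (j i) U) i h)
    ...   | ()
    cover : ∀ U → ∣ U ∣ ≡ k₁ → boundary R (at (size x) (fam i x)) U ≡ true → link Miss (j i) U ≡ true ⊎ ⋃ (λ i′ → fam i′ (suc i)) U ≡ true
    cover U _ h with ≡true⊎false (G (ins (j i) U))
    ... | inj₁ g = inj₁ (∧-both (cong not (absent U i (∧-left h))) (∧-both g (cong not (meets U))))
    ... | inj₂ g with ⋂-not-false M (ins (j i) U) g | up-elim (at (size x) (fam i x)) (∁ U) (∧-right {avoid R U} h)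
    ...   | i′ , m | S , s , f with i′ Data.Fin.≟ i
    ...     | yes refl = ⊥-elim (c i (ins (j i) U) m (inner i x S U (∧-left h) s (∧-right {∣ S ∣ ≡ᵇ size x} f)))
    ...     | no i′≢i = inj₂ (anyFin-intro (λ i′ → fam i′ (suc i) U) i′ (∧-both (∧-left h)
              (trans (cong (M i′) (del-absent (j i′) (ins (j i) U) (trans (mem-ins-≢ U (λ e → i′≢i (inj e))) (absent U i′ (∧-left h))))) m)))
  conclude : (Σ ℕ λ x → (∀ i y → cnt i y ≤ x) × (x ≡ 0 ⊎ Σ (Fin r) λ i → Σ (Fin (suc r)) λ y → cnt i y ≡ x)) →
    ∀ S → ∣ S ∣ ≡ k → (avoid R S ≡ true → G S ≡ true) × (G S ≡ true → avoid R S ≡ true)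
  conclude (suc x , h , inj₂ (i , y , e)) S _ = ⊥-elim (<-irrefl refl (begin-strict
    2 * r * cnt i y <⟨ boundary-large k₁ D r t (size y) R (fam i y) n≡ R≡ hD ht (size≤ y) (fam-avoid i y)
                         (≤-trans (s≤s z≤n) (≤-reflexive (sym e))) (≤-trans (s≤s (*-monoʳ-≤ (2 * r) (cnt≤ i y))) (small i)) ⟩
    lev k₁ (boundary R (at (size y) (fam i y))) ≤⟨ boundary≤ i y ⟩
    lev k Miss + ∑F (λ i′ → cnt i′ (suc i)) ≤⟨ +-mono-≤ (≤-trans miss≤ (∑F-upper (λ i′ → h i′ zero))) (∑F-upper (λ i′ → h i′ (suc i))) ⟩
    r * suc x + r * suc x ≡⟨ e2 r (suc x) ⟩
    2 * r * suc x ≡⟨ cong (2 * r *_) (sym e) ⟩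
    2 * r * cnt i y ∎))
    where
    open ≤-Reasoning
    e2 : ∀ r x → r * x + r * x ≡ 2 * r * x
    e2 = solve-∀
  -- No avoiding k-set is outside G, and then `miss≤` rules out k-sets of G that meet R.
  conclude (zero , h , _) S eq = to , from
    where
    to : avoid R S ≡ true → G S ≡ true
    to a with ≡true⊎false (G S)
    ... | inj₁ g = g
    ... | inj₂ g with ⋂-not-false M S g
    ...   | i , m = ⊥-elim (1+n≰n (≤-trans (subst (λ z → 1 ≤ lev z (fam i zero)) eq (lev-pos (fam i zero) S (∧-both a (trans (cong (M i) (del-absent (j i) S (absent S i a))) m)))) (h i zero)))
    from : G S ≡ true → avoid R S ≡ true
    from g with ≡true⊎false (avoid R S)
    ... | inj₁ a = a
    ... | inj₂ a = ⊥-elim (1+n≰n (≤-trans (subst (λ z → 1 ≤ lev z Miss) eq (lev-pos Miss S (∧-both g (cong not a))))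
          (≤-trans miss≤ (≤-trans (∑F-upper (λ i → h i zero)) (≤-reflexive (*-zeroʳ r))))))
  conclude (suc x , h , inj₁ ()) S _

-- From the measure back to level k

C-shrink-step : ∀ N i → 3 * i ≤ 2 * suc N → suc N C i ≤ 3 * (N C i)
C-shrink-step N i h = *-cancelˡ-≤ (suc N) (begin
    suc N * (suc N C i) ≤⟨ *-monoˡ-≤ (suc N C i) key ⟩
    3 * (suc N ∸ i) * (suc N C i) ≡⟨ *-assoc 3 (suc N ∸ i) (suc N C i) ⟩
    3 * ((suc N ∸ i) * (suc N C i)) ≡⟨ cong (3 *_) (C-top-step N i) ⟩
    3 * (suc N * (N C i)) ≡⟨ *-swap 3 (suc N) (N C i) ⟩
    suc N * (3 * (N C i)) ∎)
  where
  open ≤-Reasoning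
  key : suc N ≤ 3 * (suc N ∸ i)
  key = +-cancelʳ-≤ (3 * i) _ _ (begin
    suc N + 3 * i ≤⟨ +-monoʳ-≤ (suc N) h ⟩
    suc N + 2 * suc N ≡⟨⟩
    3 * suc N ≤⟨ *-monoʳ-≤ 3 (≤-trans (m≤n+m∸n (suc N) i) (≤-reflexive (+-comm i (suc N ∸ i)))) ⟩
    3 * (suc N ∸ i + i) ≡⟨ *-distribˡ-+ 3 (suc N ∸ i) i ⟩
    3 * (suc N ∸ i) + 3 * i ∎)

C-shrink : ∀ N c i → 3 * i ≤ 2 * N → (c + N) C i ≤ 3 ^ c * (N C i)
C-shrink N zero i h = ≤-reflexive (sym (+-identityʳ _))
C-shrink N (suc c) i h = begin
  suc (c + N) C i ≤⟨ C-shrink-step (c + N) i (≤-trans h (*-monoʳ-≤ 2 (≤-trans (m≤n+m N c) (n≤1+n (c + N))))) ⟩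
  3 * ((c + N) C i) ≤⟨ *-monoʳ-≤ 3 (C-shrink N c i h) ⟩
  3 * (3 ^ c * (N C i)) ≡⟨ sym (*-assoc 3 (3 ^ c) (N C i)) ⟩
  3 ^ suc c * (N C i) ∎
  where open ≤-Reasoning

μ-few : ∀ {n} r k α β (G : Family n) → r ≤ n → k ≤ n → (∀ i → lev (k + i) G ≤ (n ∸ r) C (k + i)) →
  μ α β G ≤ β ^ r * (α + β) ^ (n ∸ r) + tail α β n k
μ-few r k α β G r≤n k≤n h with m≤n⇒∃[o]m+o≡n r≤n
... | n′ , refl rewrite m+n∸m≡n r n′ = μ-small-levels r n′ k α β G k≤n h

-- With 2τ ≤ T, `lev≤μ` yields v ≤ 2e (n C k)/T. Passing from `n C k` to `X C k₁` costs a factor n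
-- for the lower index and 3 for each of the c steps of the upper one.
section-small : ∀ {n} k₁ c r ε₁ τ T X e v → let k = suc k₁ in
  n ≡ c + X → 3 * k₁ ≤ 2 * X → 2 * τ ≤ T →
  v * T ≤ e * (n C k) + v * τ → e ≤ ε₁ → 4 * (r * (ε₁ * (n * 3 ^ c))) < T → 2 * r * v < X C k₁
section-small {n} k₁ c r ε₁ τ T X e v n≡ hX hτ hv he hT = *-cancelˡ-< T _ _ (begin-strict
    T * (2 * r * v) ≡⟨ e1 T r v ⟩
    2 * r * (v * T) ≤⟨ *-monoʳ-≤ (2 * r) s1 ⟩
    2 * r * (2 * (e * (n C k))) ≤⟨ *-monoʳ-≤ (2 * r) (*-monoʳ-≤ 2 (*-mono-≤ he s2)) ⟩
    2 * r * (2 * (ε₁ * (n * (3 ^ c * (X C k₁))))) ≡⟨ e2 r ε₁ n (3 ^ c) (X C k₁) ⟩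
    4 * (r * (ε₁ * (n * 3 ^ c))) * (X C k₁) <⟨ *-monoˡ-< (X C k₁) {{>-nonZero (C-pos k₁≤X)}} hT ⟩
    T * (X C k₁) ∎)
  where
  open ≤-Reasoning
  k = suc k₁
  k₁≤X : k₁ ≤ X
  k₁≤X = *-cancelˡ-≤ 2 (≤-trans (*-monoˡ-≤ k₁ {2} {3} (s≤s (s≤s z≤n))) hX)
  s1 : v * T ≤ 2 * (e * (n C k))
  s1 = +-cancelʳ-≤ (v * T) _ _ (begin
    v * T + v * T ≤⟨ +-mono-≤ hv hv ⟩
    e * (n C k) + v * τ + (e * (n C k) + v * τ) ≡⟨ e3 (e * (n C k)) v τ ⟩
    2 * (e * (n C k)) + v * (2 * τ) ≤⟨ +-monoʳ-≤ (2 * (e * (n C k))) (*-monoʳ-≤ v hτ) ⟩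
    2 * (e * (n C k)) + v * T ∎)
    where
    e3 : ∀ x v τ → x + v * τ + (x + v * τ) ≡ 2 * x + v * (2 * τ)
    e3 = solve-∀
  s2 : n C k ≤ n * (3 ^ c * (X C k₁))
  s2 = begin
    n C k ≤⟨ m≤m+n (n C k) (k₁ * (n C k)) ⟩
    suc k₁ * (n C suc k₁) ≡⟨ C-step n k₁ ⟩
    (n ∸ k₁) * (n C k₁) ≤⟨ *-mono-≤ (m∸n≤m n k₁) (≤-trans (≤-reflexive (cong (_C k₁) n≡)) (C-shrink X c k₁ hX)) ⟩
    n * (3 ^ c * (X C k₁)) ∎
  e1 : ∀ T r v → T * (2 * r * v) ≡ 2 * r * (v * T)
  e1 = solve-∀
  e2 : ∀ r ε n x y → 2 * r * (2 * (ε * (n * (x * y)))) ≡ 4 * (r * (ε * (n * x))) * y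
  e2 = solve-∀

-- Up-closures add nothing at level k, so G is there the complement of the union.
hitting-structure : ∀ {n m} k (Fs : Fin m → Family n) (R : Subset n) → let G = ⋂ (λ i S → not (up (Fs i) S)) in
  (∀ i → Uniform k (Fs i)) →
  (∀ S → ∣ S ∣ ≡ k → (avoid R S ≡ true → G S ≡ true) × (G S ≡ true → avoid R S ≡ true)) →
  ∀ S → (⋃ Fs S ≡ true → ∣ S ∣ ≡ k × Nonempty (S ∩ R)) × (∣ S ∣ ≡ k → Nonempty (S ∩ R) → ⋃ Fs S ≡ true)
hitting-structure {n} k Fs R uni rigid S = to , from
  where
  M = λ i → up (Fs i)
  to : ⋃ Fs S ≡ true → ∣ S ∣ ≡ k × Nonempty (S ∩ R)
  to h with anyFin-elim (λ i → Fs i S) h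
  ... | i , f with ≡true⊎false (avoid R S)
  ...   | inj₂ a = uni i S f , meet (avoid-false R S a)
    where
    meet : Σ (Fin n) (λ v → mem v R ≡ true × mem v S ≡ true) → Nonempty (S ∩ R)
    meet (v , p , q) = v , x∈p∩q⁺ (lookup⇒[]= v S q , lookup⇒[]= v R p)
  ...   | inj₁ a with trans (sym (not-injective-true (⋂-elim (λ i S → not (M i S)) S (proj₁ (rigid S (uni i S f)) a) i))) (up-intro (Fs i) (⊑-refl S) f)
  ...     | ()
  from : ∣ S ∣ ≡ k → Nonempty (S ∩ R) → ⋃ Fs S ≡ true
  from s (v , v∈) with ≡true⊎false (⋂ (λ i S → not (M i S)) S)
  ... | inj₁ g with trans (sym ([]=⇒lookup (proj₁ (x∈p∩q⁻ S R v∈)))) (avoid-mem R S v (proj₂ (rigid S s) g) ([]=⇒lookup (proj₂ (x∈p∩q⁻ S R v∈))))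
  ...   | ()
  from s (v , v∈) | inj₂ g with ⋂-not-false M S g
  ... | i , f = anyFin-intro (λ i → Fs i S) i (up-level k (Fs i) (uni i) S (≤-reflexive s) f)

-- Everything by which the tail τ gets multiplied is dominated by 84 r p² n³ y, where p = 2^(r-1), y = 3^c.
tail-consequences : ∀ r₁ p n y τ T b → let r = suc r₁ ; ε = 2 * (n * (b * (p * τ))) in
  1 ≤ p → 1 ≤ n → 1 ≤ y → b ≡ 10 * n → 84 * (r * (p * p * (n * n * n * y))) * τ < T →
  8 * (p * τ) < T × p * 4 * (τ + r * ε) < T × 4 * (r * (ε * (n * y))) < T
tail-consequences r₁ p n y τ T b p>0 n>0 y>0 refl hT =
    subst (_< T) (*-assoc 8 p τ) (le (8 * p) (*-mono-≤ {8} {84} (m≤m+n 8 76) base-r))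
  , subst (_< T) (sym (e₁ p τ r n)) (le (4 * p + 80 * (r * (p * p * (n * n)))) (begin
      4 * p + 80 * (r * (p * p * (n * n))) ≤⟨ +-mono-≤ (*-monoʳ-≤ 4 base-r) (*-monoʳ-≤ 80 (*-monoʳ-≤ r (*-monoʳ-≤ (p * p) (begin
        n * n ≡⟨ sym (*-identityʳ (n * n)) ⟩
        n * n * 1 ≤⟨ *-monoʳ-≤ (n * n) (*-pos n>0 y>0) ⟩
        n * n * (n * y) ≡⟨ sym (*-assoc (n * n) n y) ⟩
        n * n * n * y ∎)))) ⟩
      4 * Z + 80 * Z ≡⟨ sym (*-distribʳ-+ Z 4 80) ⟩
      84 * Z ∎))
  , subst (_< T) (sym (e₂ p τ r n y)) (le (80 * (r * (p * (n * n * n * y)))) (*-mono-≤ {80} {84} (m≤m+n 80 4)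
      (*-monoʳ-≤ r (*-monoˡ-≤ (n * n * n * y) (≤-trans (≤-reflexive (sym (*-identityʳ p))) (*-monoʳ-≤ p p>0))))))
  where
  open ≤-Reasoning
  r = suc r₁
  Z = r * (p * p * (n * n * n * y))
  le : ∀ x → x ≤ 84 * Z → x * τ < T
  le x h = ≤-<-trans (*-monoˡ-≤ τ h) hT
  base-r : p ≤ Z
  base-r = begin
    p ≡⟨ sym (*-identityʳ p) ⟩
    p * 1 ≤⟨ *-monoʳ-≤ p p>0 ⟩
    p * p ≡⟨ sym (*-identityʳ (p * p)) ⟩
    p * p * 1 ≤⟨ *-monoʳ-≤ (p * p) (*-pos (*-pos (*-pos n>0 n>0) n>0) y>0) ⟩
    p * p * (n * n * n * y) ≤⟨ m≤m+n _ (r₁ * (p * p * (n * n * n * y))) ⟩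
    Z ∎
  e₁ : ∀ p τ r n → p * 4 * (τ + r * (2 * (n * (10 * n * (p * τ))))) ≡ (4 * p + 80 * (r * (p * p * (n * n)))) * τ
  e₁ = solve-∀
  e₂ : ∀ p τ r n y → 4 * (r * (2 * (n * (10 * n * (p * τ))) * (n * y))) ≡ 80 * (r * (p * (n * n * n * y))) * τ
  e₂ = solve-∀

Conclusion : ∀ {n m} → ℕ → ℕ → (Fin m → Family n) → Set
Conclusion {n} r k Fs = Σ (Subset n) λ R → ∣ R ∣ ≡ r ×
  (∀ S → (⋃ Fs S ≡ true → ∣ S ∣ ≡ k × Nonempty (S ∩ R)) × (∣ S ∣ ≡ k → Nonempty (S ∩ R) → ⋃ Fs S ≡ true))

structure : ∀ {n m} k₁ D r₁ t (Fs : Fin m → Family n) →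
  let k = suc k₁ ; r = suc r₁ ; c = r + suc (r * t) ; α = 2 * (2 * D) + 10 * k ; β = α + 2 * D ; p = 2 ^ r₁ in
  n ≡ 2 * k + D → 1 ≤ D → 2 * c ≤ D → 2 * n ≤ t * D →
  84 * (r * (p * p * (n * n * n * 3 ^ c))) * tail α β n k < (α + β) ^ n →
  m ≤ r → (∀ i → Uniform k (Fs i)) → (∀ i → Intersecting (Fs i)) →
  lev k (⋂ (λ i S → not (up (Fs i) S))) ≤ (n ∸ r) C k → Conclusion r k Fs
structure {n} k₁ D r₁ t Fs n≡ D>0 hD ht hT m≤r uni int hG = cases (m≤n⇒m<n∨m≡n m≤r) Fs uni int hG
  where
  k = suc k₁
  r = suc r₁
  c = r + suc (r * t)
  γ = 2 * D
  α = 2 * γ + 10 * k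
  β = α + γ
  b = α + β
  T = b ^ n
  τ = tail α β n k
  X = n ∸ c
  p = 2 ^ r₁
  ε = 2 * (n * (b * (p * τ)))
  γ≥2 : 2 ≤ γ
  γ≥2 = *-monoʳ-≤ 2 D>0
  γ>0 : 1 ≤ γ
  γ>0 = ≤-trans (s≤s z≤n) γ≥2
  α>0 : 1 ≤ α
  α>0 = ≤-trans γ>0 (≤-trans (m≤m+n γ (γ + 0)) (m≤m+n (2 * γ) (10 * k)))
  b≤4α : b ≤ 4 * α
  b≤4α = ≤-trans (m≤m+n _ (α + (γ + 10 * k))) (≤-reflexive (e γ (10 * k)))
    where
    e : ∀ γ s → let α = 2 * γ + s in α + (α + γ) + (α + (γ + s)) ≡ 4 * α
    e = solve-∀
  c≤n : c ≤ n
  c≤n = ≤-trans (≤-trans (m≤m+n c (c + 0)) hD) (≤-trans (m≤n+m D (2 * k)) (≤-reflexive (sym n≡)))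
  r≤n : r ≤ n
  r≤n = ≤-trans (m≤m+n r _) c≤n
  k≤n : k ≤ n
  k≤n = ≤-trans (m≤m+n k _) (≤-trans (m≤m+n (2 * k) D) (≤-reflexive (sym n≡)))
  b≡ : b ≡ 10 * n
  b≡ = trans (e k D) (cong (10 *_) (sym n≡))
    where
    e : ∀ k D → let γ = 2 * D ; α = 2 * γ + 10 * k in α + (α + γ) ≡ 10 * (2 * k + D)
    e = solve-∀
  n≡cX : n ≡ c + X
  n≡cX = sym (m+[n∸m]≡n c≤n)
  hX : 3 * k₁ ≤ 2 * X
  hX = +-cancelʳ-≤ (2 * c) _ _ (begin
    3 * k₁ + 2 * c ≤⟨ +-mono-≤ (≤-trans (*-monoʳ-≤ 3 (n≤1+n k₁)) (*-monoˡ-≤ k {3} {4} (m≤m+n 3 1))) (≤-trans hD (m≤m+n D (D + 0))) ⟩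
    4 * k + 2 * D ≡⟨ e k D ⟩
    2 * (2 * k + D) ≡⟨ cong (2 *_) (trans (sym n≡) n≡cX) ⟩
    2 * (c + X) ≡⟨ *-distribˡ-+ 2 c X ⟩
    2 * c + 2 * X ≡⟨ +-comm (2 * c) (2 * X) ⟩
    2 * X + 2 * c ∎)
    where
    open ≤-Reasoning
    e : ∀ k D → 4 * k + 2 * D ≡ 2 * (2 * k + D)
    e = solve-∀
  facts : 8 * (p * τ) < T × p * 4 * (τ + r * ε) < T × 4 * (r * (ε * (n * 3 ^ c))) < T
  facts = tail-consequences r₁ p n (3 ^ c) τ T b (^-pos {2} r₁ (s≤s z≤n)) (≤-trans (s≤s z≤n) k≤n) (^-pos {3} c (s≤s z≤n)) b≡ hT
  μG : ∀ {m} (Fs : Fin m → Family n) → lev k (⋂ (λ i S → not (up (Fs i) S))) ≤ (n ∸ r) C k →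
    μ α β (⋂ (λ i S → not (up (Fs i) S))) ≤ β ^ r * b ^ (n ∸ r) + τ
  μG Fs hG = μ-few r k α β (⋂ (λ i S → not (up (Fs i) S))) r≤n k≤n
    (λ i → subst (λ z → lev z (⋂ (λ i S → not (up (Fs i) S))) ≤ (n ∸ r) C z) (+-comm i k)
      (proj₁ (shadow-chain k₁ (n ∸ r) (⋂ (λ i S → not (up (Fs i) S))) (⋂-Down _ (λ i → not-Down {F = up (Fs i)} (up-Up (Fs i)))) hG i)))
  2τ≤T : 2 * τ ≤ T
  2τ≤T = ≤-trans (*-mono-≤ {2} {8} (m≤m+n 2 6) (≤-trans (≤-reflexive (sym (*-identityˡ τ))) (*-monoˡ-≤ τ (^-pos {2} r₁ (s≤s z≤n))))) (<⇒≤ (proj₁ facts))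
  cases : ∀ {m} → m < r ⊎ m ≡ r → (Fs : Fin m → Family n) → (∀ i → Uniform k (Fs i)) → (∀ i → Intersecting (Fs i)) →
    lev k (⋂ (λ i S → not (up (Fs i) S))) ≤ (n ∸ r) C k → Conclusion r k Fs
  -- Fewer than r families leave measure at least q^(r-1) uncovered, but `μG` allows only q^r + τ.
  cases (inj₁ m<r) Fs uni int hG = ⊥-elim (<-irrefl refl (≤-<-trans
    (too-few r₁ α β τ (λ i S → not (up (Fs i) S)) α>0 (m≤m+n α γ) b≤4α (≤-pred m<r) r≤n (λ i → not-Down {F = up (Fs i)} (up-Up (Fs i)))
           (λ i → compl-large α β (up (Fs i)) (ekr γ (10 * k) (up (Fs i)) γ>0 (up-Up (Fs i)) (up-Complement-free (Fs i) (int i)))) (μG Fs hG))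
    (≤-<-trans (*-monoʳ-≤ (p * 4) (m≤m+n τ (r * ε))) (proj₁ (proj₂ facts)))))
  cases (inj₂ refl) Fs uni int hG = finish
    (dictators r₁ γ (10 * k) τ (λ i → up (Fs i)) γ≥2 r≤n (λ i → up-Up (Fs i)) (λ i → up-Complement-free (Fs i) (int i)) (μG Fs hG)
      (<⇒≤ (proj₁ facts)) (proj₁ (proj₂ facts)))
    where
    finish : (Σ (Fin r → Fin n) λ j → (∀ {i i′} → j i ≡ j i′ → i ≡ i′) × (∀ i → μ α β (λ S → up (Fs i) (del (j i) S)) ≤ ε)) → Conclusion r k Fs
    finish (j , inj , small) = image j , image-size j inj , hitting-structure k Fs (image j) uni
      (rigidity k₁ D r t (λ i → up (Fs i)) j n≡ hD ht (λ i → up-Up (Fs i)) (λ i → up-Complement-free (Fs i) (int i)) inj hG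
        (λ i → section-small k₁ c r ε τ T X (μ α β (λ S → up (Fs i) (del (j i) S))) (lev k (λ S → up (Fs i) (del (j i) S))) n≡cX hX 2τ≤T
          (lev≤μ k₁ α β (λ S → up (Fs i) (del (j i) S)) (λ h → up-Up (Fs i) (del-mono (j i) h)) k≤n) (small i) (proj₂ (proj₂ facts))))

-- Choice of the parameters

cube : ∀ x → x ^ 3 ≡ x * x * x
cube x = e x
  where
  e : ∀ x → x * (x * (x * 1)) ≡ x * x * x
  e = solve-∀

cube-mono-< : ∀ {x y} → x < y → x * x * x < y * y * y
cube-mono-< h = *-mono-< (*-mono-< h h) h

cube-cancel : ∀ {x y} → x * x * x ≤ y * y * y → x ≤ y
cube-cancel {x} {y} h with x ≤? y
... | yes p = p
... | no p = ⊥-elim (<-irrefl refl (≤-trans (cube-mono-< (≰⇒> p)) h))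

-- A stand-in for a logarithm: v ≤ 2^v gives n³ ≤ 2^(9v), and v of order n^(1/3) is still small
-- enough for `exponent-fits`.
cube-root : ∀ n → Σ ℕ λ v → n ≤ v * v * v × v * v * v ≤ 8 * n
cube-root zero = 0 , z≤n , z≤n
cube-root (suc n) with cube-root n
... | v , h , g with suc n ≤? v * v * v
...   | yes p = v , p , ≤-trans g (*-monoʳ-≤ 8 (n≤1+n n))
...   | no p = suc v , ≤-trans (s≤s h) (cube-mono-< (n<1+n v)) , ≤-trans (grow v) (*-monoʳ-≤ 8 (≰⇒> p))
  where
  e : ∀ u → (2 + u) * (2 + u) * (2 + u) + (7 * (u * u * u) + 18 * (u * u) + 12 * u + 8) ≡ 8 * (1 + (1 + u) * (1 + u) * (1 + u))
  e = solve-∀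
  grow : ∀ v → suc v * suc v * suc v ≤ 8 * suc (v * v * v)
  grow zero = s≤s z≤n
  grow (suc u) = ≤-trans (m≤m+n _ _) (≤-reflexive (e u))

n<2^n : ∀ n → n < 2 ^ n
n<2^n zero = s≤s z≤n
n<2^n (suc n) = begin
  suc (suc n) ≤⟨ s≤s (n<2^n n) ⟩
  1 + 2 ^ n ≤⟨ +-mono-≤ (^-pos {2} n (s≤s z≤n)) (m≤m+n (2 ^ n) 0) ⟩
  2 ^ suc n ∎
  where open ≤-Reasoning

exponential-dominates : ∀ A n v c → n ≤ v * v * v → A * (n * n * n * 3 ^ c) < 2 ^ (A + (9 * v + 2 * c))
exponential-dominates A n v c h = begin-strict
  A * (n * n * n * 3 ^ c) <⟨ ≤-<-trans (*-monoʳ-≤ A (*-mono-≤ n³ 3^c)) (*-monoˡ-< (2 ^ (9 * v) * 2 ^ (2 * c)) {{>-nonZero (*-pos (^-pos {2} (9 * v) (s≤s z≤n)) (^-pos {2} (2 * c) (s≤s z≤n)))}} (n<2^n A)) ⟩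
  2 ^ A * (2 ^ (9 * v) * 2 ^ (2 * c)) ≡⟨ cong (2 ^ A *_) (sym (^-distribˡ-+-* 2 (9 * v) (2 * c))) ⟩
  2 ^ A * 2 ^ (9 * v + 2 * c) ≡⟨ sym (^-distribˡ-+-* 2 A (9 * v + 2 * c)) ⟩
  2 ^ (A + (9 * v + 2 * c)) ∎
  where
  open ≤-Reasoning
  z = 2 ^ v
  v≤z : v ≤ z
  v≤z = <⇒≤ (n<2^n v)
  n≤ : n ≤ z * z * z
  n≤ = ≤-trans h (*-mono-≤ (*-mono-≤ v≤z v≤z) v≤z)
  e : ∀ z → (z * z * z) * (z * z * z) * (z * z * z) ≡ z * (z * (z * (z * (z * (z * (z * (z * (z * 1))))))))
  e = solve-∀
  n³ : n * n * n ≤ 2 ^ (9 * v)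
  n³ = ≤-trans (*-mono-≤ (*-mono-≤ n≤ n≤) n≤) (≤-reflexive (trans (e z) (trans (^-*-assoc 2 v 9) (cong (2 ^_) (*-comm v 9)))))
  3^c : 3 ^ c ≤ 2 ^ (2 * c)
  3^c = ≤-trans (^-monoˡ-≤ c {3} {4} (s≤s (s≤s (s≤s z≤n)))) (≤-reflexive (^-*-assoc 2 2 c))

two-products : ∀ x y → 2 * (x * y) ≤ x * x + y * y
two-products x y with ≤-total x y
... | inj₁ h with m≤n⇒∃[o]m+o≡n h
...   | z , refl = ≤-trans (m≤m+n _ (z * z)) (≤-reflexive (e x z))
  where
  e : ∀ x z → 2 * (x * (x + z)) + z * z ≡ x * x + (x + z) * (x + z)
  e = solve-∀
two-products x y | inj₂ h with m≤n⇒∃[o]m+o≡n h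
...   | z , refl = ≤-trans (m≤m+n _ (z * z)) (≤-reflexive (e y z))
  where
  e : ∀ y z → 2 * ((y + z) * y) + z * z ≡ (y + z) * (y + z) + y * y
  e = solve-∀

-- From n² ≤ 8k² + 2D²: the k² part is paid by the gap hypothesis, the D² part by c ≤ D, which
-- follows from it as k ≥ 1.
gap-cubed : ∀ Γ c k D → let n = 2 * k + D in 1 ≤ k → 1 ≤ c → 16 * Γ ≤ c → c * c * c * (k * k) ≤ D * D * D → Γ * (n * n) ≤ D * D * D
gap-cubed Γ c k D k>0 c>0 hΓ h = *-cancelˡ-≤ 2 (begin
    2 * (Γ * (n * n)) ≤⟨ *-monoʳ-≤ 2 (*-monoʳ-≤ Γ n²) ⟩
    2 * (Γ * (2 * (2 * k * (2 * k)) + 2 * (D * D))) ≡⟨ e1 Γ k D ⟩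
    16 * Γ * (k * k) + 4 * Γ * (D * D) ≤⟨ +-mono-≤ (≤-trans (*-monoˡ-≤ (k * k) (≤-trans hΓ c≤c³)) h) (≤-trans (*-monoˡ-≤ (D * D) (≤-trans (*-monoˡ-≤ Γ {4} {16} (m≤m+n 4 12)) (≤-trans hΓ c≤D))) (≤-reflexive (e2 D))) ⟩
    D * D * D + D * D * D ≡⟨ e3 (D * D * D) ⟩
    2 * (D * D * D) ∎)
  where
  open ≤-Reasoning
  n = 2 * k + D
  n² : n * n ≤ 2 * (2 * k * (2 * k)) + 2 * (D * D)
  n² = begin
    n * n ≡⟨ e (2 * k) D ⟩
    2 * k * (2 * k) + D * D + 2 * (2 * k * D) ≤⟨ +-monoʳ-≤ (2 * k * (2 * k) + D * D) (two-products (2 * k) D) ⟩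
    2 * k * (2 * k) + D * D + (2 * k * (2 * k) + D * D) ≡⟨ e′ (2 * k * (2 * k)) (D * D) ⟩
    2 * (2 * k * (2 * k)) + 2 * (D * D) ∎
    where
    e : ∀ x y → (x + y) * (x + y) ≡ x * x + y * y + 2 * (x * y)
    e = solve-∀
    e′ : ∀ x y → x + y + (x + y) ≡ 2 * x + 2 * y
    e′ = solve-∀
  c≤c³ : c ≤ c * c * c
  c≤c³ = ≤-trans (≤-reflexive (sym (*-identityˡ c))) (*-monoˡ-≤ c (*-pos c>0 c>0))
  c≤D : c ≤ D
  c≤D = cube-cancel (≤-trans (≤-trans (≤-reflexive (sym (*-identityʳ (c * c * c)))) (*-monoʳ-≤ (c * c * c) (*-pos k>0 k>0))) h)
  e1 : ∀ Γ k D → 2 * (Γ * (2 * (2 * k * (2 * k)) + 2 * (D * D))) ≡ 16 * Γ * (k * k) + 4 * Γ * (D * D)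
  e1 = solve-∀
  e2 : ∀ D → D * (D * D) ≡ D * D * D
  e2 = solve-∀
  e3 : ∀ x → x + x ≡ 2 * x
  e3 = solve-∀

-- As t is of order n/D and v of order n^(1/3), the requirements t² ≤ D and t v ≤ D both amount, up
-- to constants, to n² ≤ D³.
exponent-fits : ∀ Λ n D t v → let P = 12 * Λ in 1 ≤ Λ → 1 ≤ D → P * P * P * (n * n) ≤ D * D * D →
  t * D ≤ 3 * n → v * v * v ≤ 8 * n → Λ * (t * (t + v)) ≤ D
exponent-fits Λ n D t v Λ>0 D>0 hΓ ht hv = *-cancelˡ-≤ 2 (begin
    2 * (Λ * (t * (t + v))) ≡⟨ e1 Λ t v ⟩
    2 * Λ * (t * t) + 2 * Λ * (t * v) ≤⟨ +-mono-≤ first second ⟩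
    D + D ≡⟨ e2 D ⟩
    2 * D ∎)
  where
  open ≤-Reasoning
  P = 12 * Λ
  P>0 : 1 ≤ P
  P>0 = *-pos {12} (s≤s z≤n) Λ>0
  first : 2 * Λ * (t * t) ≤ D
  first = *-cancelˡ-≤-pos (D * D) (*-pos D>0 D>0) (begin
    D * D * (2 * Λ * (t * t)) ≡⟨ a1 D Λ t ⟩
    2 * Λ * (t * D * (t * D)) ≤⟨ *-monoʳ-≤ (2 * Λ) (*-mono-≤ ht ht) ⟩
    2 * Λ * (3 * n * (3 * n)) ≤⟨ m≤m+n _ (6 * Λ * (n * n)) ⟩
    2 * Λ * (3 * n * (3 * n)) + 6 * Λ * (n * n) ≡⟨ a2 Λ n ⟩
    P * 2 * (n * n) ≤⟨ *-monoˡ-≤ (n * n) (≤-trans (*-monoʳ-≤ P (≤-trans (s≤s (s≤s z≤n)) (*-mono-≤ {12} {P} (≤-trans (≤-reflexive (sym (*-identityʳ 12))) (*-monoʳ-≤ 12 Λ>0)) P>0))) (≤-reflexive (sym (*-assoc P P P)))) ⟩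
    P * P * P * (n * n) ≤⟨ hΓ ⟩
    D * D * D ∎)
    where
    a1 : ∀ D Λ t → D * D * (2 * Λ * (t * t)) ≡ 2 * Λ * (t * D * (t * D))
    a1 = solve-∀
    a2 : ∀ Λ n → 2 * Λ * (3 * n * (3 * n)) + 6 * Λ * (n * n) ≡ 12 * Λ * 2 * (n * n)
    a2 = solve-∀
  n²≤ : n * n ≤ D * D * D
  n²≤ = ≤-trans (≤-trans (≤-reflexive (sym (*-identityˡ (n * n)))) (*-monoˡ-≤ (n * n) (*-pos (*-pos P>0 P>0) P>0))) hΓ
  -- Cubed because of v³ ≤ 8n. The constants 2³, 3³ and 8 multiply to 12³, hence P = 12Λ.
  second : 2 * Λ * (t * v) ≤ D
  second = cube-cancel (*-cancelˡ-≤-pos (D * D * D) (*-pos (*-pos D>0 D>0) D>0) (begin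
    D * D * D * (2 * Λ * (t * v) * (2 * Λ * (t * v)) * (2 * Λ * (t * v))) ≡⟨ a1 D Λ t v ⟩
    2 * Λ * (2 * Λ) * (2 * Λ) * (t * D * (t * D) * (t * D) * (v * v * v)) ≤⟨ *-monoʳ-≤ (2 * Λ * (2 * Λ) * (2 * Λ)) (*-mono-≤ (*-mono-≤ (*-mono-≤ ht ht) ht) hv) ⟩
    2 * Λ * (2 * Λ) * (2 * Λ) * (3 * n * (3 * n) * (3 * n) * (8 * n)) ≡⟨ a2 Λ n ⟩
    P * P * P * (n * n) * (n * n) ≤⟨ *-mono-≤ hΓ n²≤ ⟩
    D * D * D * (D * D * D) ∎))
    where
    a1 : ∀ D Λ t v → D * D * D * (2 * Λ * (t * v) * (2 * Λ * (t * v)) * (2 * Λ * (t * v))) ≡ 2 * Λ * (2 * Λ) * (2 * Λ) * (t * D * (t * D) * (t * D) * (v * v * v))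
    a1 = solve-∀
    a2 : ∀ Λ n → 2 * Λ * (2 * Λ) * (2 * Λ) * (3 * n * (3 * n) * (3 * n) * (8 * n)) ≡ 12 * Λ * (12 * Λ) * (12 * Λ) * (n * n) * (n * n)
    a2 = solve-∀
  e1 : ∀ Λ t v → 2 * (Λ * (t * (t + v))) ≡ 2 * Λ * (t * t) + 2 * Λ * (t * v)
  e1 = solve-∀
  e2 : ∀ x → x + x ≡ 2 * x
  e2 = solve-∀

ceiling-quotient : ∀ n D → 1 ≤ D → D ≤ n → Σ ℕ λ t → 1 ≤ t × 2 * n ≤ t * D × t * D ≤ 3 * n
-- Quotient plus one rather than a true ceiling; D ≤ n absorbs the excess.
ceiling-quotient n D@(suc _) _ D≤n = suc (2 * n / D) , s≤s z≤n
  , (begin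
      2 * n ≡⟨ m≡m%n+[m/n]*n (2 * n) D ⟩
      2 * n % D + 2 * n / D * D ≤⟨ +-monoˡ-≤ (2 * n / D * D) (<⇒≤ (m%n<n (2 * n) D)) ⟩
      D + 2 * n / D * D ∎)
  , +-mono-≤ D≤n (m/n*n≤m (2 * n) D)
  where open ≤-Reasoning

parameters : ∀ A r k D → let n = 2 * k + D ; Λ = 4 * (A + (4 * r + 11)) ; P = 12 * Λ in
  1 ≤ D → P * P * P * (n * n) ≤ D * D * D →
  Σ ℕ λ t → Σ ℕ λ w → 2 * n ≤ t * D × 2 * (r + suc (r * t)) ≤ D × 4 * (t * w) ≤ D × A * (n * n * n * 3 ^ (r + suc (r * t))) < 2 ^ w
parameters A r k D D>0 h = choose (ceiling-quotient n D D>0 (m≤n+m D (2 * k))) (cube-root n)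
  where
  open ≤-Reasoning
  n = 2 * k + D
  -- Since t ≥ 1, the exponent w is at most Λ₀ (t + v): A from A, 4r + 2 from 2c, and 9 from 9v.
  Λ₀ = A + (4 * r + 11)
  choose : (Σ ℕ λ t → 1 ≤ t × 2 * n ≤ t * D × t * D ≤ 3 * n) → (Σ ℕ λ v → n ≤ v * v * v × v * v * v ≤ 8 * n) →
    Σ ℕ λ t → Σ ℕ λ w → 2 * n ≤ t * D × 2 * (r + suc (r * t)) ≤ D × 4 * (t * w) ≤ D × A * (n * n * n * 3 ^ (r + suc (r * t))) < 2 ^ w
  choose (t@(suc t₁) , t>0 , t≥ , t≤) (v , v≥ , v≤) = t , w , t≥ , 2c≤ , 4tw≤ , exponential-dominates A n v c v≥
    where
    c = r + suc (r * t)
    -- The three summands pay for A, n³ and 3^c.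
    w = A + (9 * v + 2 * c)
    e : ∀ A r t₁ v → let t = 1 + t₁ in
      A + (9 * v + 2 * (r + (1 + r * t))) + (A * t₁ + (2 * r + 2) * t₁ + 9 * t + (A + (4 * r + 2)) * v) ≡ (A + (4 * r + 11)) * (t + v)
    e = solve-∀
    w≤ : w ≤ Λ₀ * (t + v)
    w≤ = ≤-trans (m≤m+n w _) (≤-reflexive (e A r t₁ v))
    e′ : ∀ t Λ₀ x → 4 * (t * (Λ₀ * x)) ≡ 4 * Λ₀ * (t * x)
    e′ = solve-∀
    4tw≤ : 4 * (t * w) ≤ D
    4tw≤ = begin
      4 * (t * w) ≤⟨ *-monoʳ-≤ 4 (*-monoʳ-≤ t w≤) ⟩
      4 * (t * (Λ₀ * (t + v))) ≡⟨ e′ t Λ₀ (t + v) ⟩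
      4 * Λ₀ * (t * (t + v)) ≤⟨ exponent-fits (4 * Λ₀) n D t v (*-pos {4} (s≤s z≤n) (≤-trans (≤-trans (s≤s z≤n) (m≤n+m 11 (4 * r))) (m≤n+m (4 * r + 11) A))) D>0 h t≤ v≤ ⟩
      D ∎
    2c≤ : 2 * c ≤ D
    2c≤ = begin
      2 * c ≤⟨ m≤n+m (2 * c) (9 * v) ⟩
      9 * v + 2 * c ≤⟨ m≤n+m (9 * v + 2 * c) A ⟩
      w ≤⟨ m≤m+n w (t₁ * w) ⟩
      t * w ≤⟨ m≤m+n (t * w) _ ⟩
      4 * (t * w) ≤⟨ 4tw≤ ⟩
      D ∎

-- From a large union to the bound and the equality case

⋃-Uniform : ∀ {n m} k (Fs : Fin m → Family n) → (∀ i → Uniform k (Fs i)) → Uniform k (⋃ Fs)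
⋃-Uniform k Fs uni S h with anyFin-elim (λ i → Fs i S) h
... | i , f = uni i S f

-- A k-set in G is not a member of the union, and a large union leaves few such sets.
unhit-few : ∀ {n m} k c (Fs : Fin m → Family n) → (∀ i → Uniform k (Fs i)) →
  n C k ∸ c ≤ card (⋃ Fs) → lev k (⋂ (λ i S → not (up (Fs i) S))) ≤ c
unhit-few {n} k c Fs uni h = +-cancelʳ-≤ (card (⋃ Fs)) _ _ (begin
  lev k G + card (⋃ Fs) ≡⟨ cong (lev k G +_) (card-uniform k (⋃ Fs) (⋃-Uniform k Fs uni)) ⟩
  lev k G + lev k (⋃ Fs) ≤⟨ +-monoˡ-≤ (lev k (⋃ Fs)) (lev-mono k {G} {λ S → not (⋃ Fs S)} (λ S _ g → not-true (λ f → unhit S g (anyFin-elim (λ i → Fs i S) f)))) ⟩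
  lev k (λ S → not (⋃ Fs S)) + lev k (⋃ Fs) ≡⟨ trans (lev-compl k (⋃ Fs)) (lev-all n k) ⟩
  n C k ≤⟨ m≤n+m∸n (n C k) c ⟩
  c + (n C k ∸ c) ≤⟨ +-monoʳ-≤ c h ⟩
  c + card (⋃ Fs) ∎)
  where
  open ≤-Reasoning
  G = ⋂ (λ i S → not (up (Fs i) S))
  unhit : ∀ S → G S ≡ true → (Σ _ λ i → Fs i S ≡ true) → ⊥
  unhit S g (i , f) with trans (sym (not-injective-true (⋂-elim (λ i S → not (up (Fs i) S)) S g i))) (up-intro (Fs i) (⊑-refl S) f)
  ... | ()

hitting-card : ∀ {n m} r k (Fs : Fin m → Family n) → (∀ i → Uniform k (Fs i)) → Conclusion r k Fs → card (⋃ Fs) ≤ n C k ∸ (n ∸ r) C k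
hitting-card {n} r k Fs uni (R , R≡ , hR) = m+n≤o⇒m≤o∸n (card (⋃ Fs)) (begin
  card (⋃ Fs) + (n ∸ r) C k ≡⟨ cong₂ _+_ (card-uniform k (⋃ Fs) (⋃-Uniform k Fs uni)) (trans (cong (λ z → (n ∸ z) C k) (sym R≡)) (sym (lev-avoid R k))) ⟩
  lev k (⋃ Fs) + lev k (avoid R) ≤⟨ +-monoˡ-≤ (lev k (avoid R)) (lev-mono k {⋃ Fs} {λ S → not (avoid R S)} (λ S _ f → not-true (λ a → hit S (proj₂ (proj₁ (hR S) f)) a))) ⟩
  lev k (λ S → not (avoid R S)) + lev k (avoid R) ≡⟨ trans (lev-compl k (avoid R)) (lev-all n k) ⟩
  n C k ∎)
  where
  open ≤-Reasoning
  hit : ∀ S → Nonempty (S ∩ R) → avoid R S ≡ true → ⊥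
  hit S (v , v∈) a with trans (sym ([]=⇒lookup (proj₁ (x∈p∩q⁻ S R v∈)))) (avoid-mem R S v a ([]=⇒lookup (proj₂ (x∈p∩q⁻ S R v∈))))
  ... | ()

scaled-< : ∀ Q W τ T → 1 ≤ T → Q < W → W * τ ≤ T → Q * τ < T
-- With τ = 0 strictness can only come from T ≥ 1.
scaled-< Q W zero    T T>0 h g = ≤-trans (s≤s (≤-reflexive (*-zeroʳ Q))) T>0
scaled-< Q W (suc τ) T T>0 h g = ≤-trans (*-monoˡ-< (suc τ) h) g

large-union-structure : ∀ r₁ → let r = suc r₁ in Σ ℕ λ c → 0 < c ×
  (∀ n k D → 1 ≤ k → n ≡ 2 * k + D → c ^ 3 * k ^ 2 ≤ D ^ 3 →
    ∀ m → m ≤ r → (Fs : Fin m → Family n) → (∀ i → Uniform k (Fs i)) → (∀ i → Intersecting (Fs i)) →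
    n C k ∸ (n ∸ r) C k ≤ card (⋃ Fs) → Conclusion r k Fs)
large-union-structure r₁ = c , c>0 , body
  where
  r = suc r₁
  p = 2 ^ r₁
  -- The factor from `tail-consequences` that is independent of n; c below then meets the demand 16
  -- Γ ≤ c of `gap-cubed` with Γ = P³.
  A = 84 * (r * (p * p))
  P = 12 * (4 * (A + (4 * r + 11)))
  c = suc (16 * (P * P * P))
  c>0 : 0 < c
  c>0 = s≤s z≤n
  body : ∀ n k D → 1 ≤ k → n ≡ 2 * k + D → c ^ 3 * k ^ 2 ≤ D ^ 3 →
    ∀ m → m ≤ r → (Fs : Fin m → Family n) → (∀ i → Uniform k (Fs i)) → (∀ i → Intersecting (Fs i)) →
    n C k ∸ (n ∸ r) C k ≤ card (⋃ Fs) → Conclusion r k Fs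
  body n k@(suc k₁) D _ n≡ h m m≤r Fs uni int large = go (parameters A r k D D>0 (gap-cubed (P * P * P) c k D (s≤s z≤n) c>0 (n≤1+n _) h′))
    where
    h′ : c * c * c * (k * k) ≤ D * D * D
    h′ = subst₂ _≤_ (cong₂ _*_ (cube c) (cong (k *_) (*-identityʳ k))) (cube D) h
    D>0 : 1 ≤ D
    D>0 = cube-cancel (≤-trans (*-pos (*-pos (*-pos c>0 c>0) c>0) (s≤s z≤n)) h′)
    N = 2 * k + D
    α = 2 * (2 * D) + 10 * k
    β = α + 2 * D
    e : ∀ r p x → 84 * (r * p) * x ≡ 84 * (r * (p * x))
    e = solve-∀
    go : (Σ ℕ λ t → Σ ℕ λ w → 2 * N ≤ t * D × 2 * (r + suc (r * t)) ≤ D × 4 * (t * w) ≤ D × A * (N * N * N * 3 ^ (r + suc (r * t))) < 2 ^ w) → Conclusion r k Fs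
    go (t , w , t≥ , 2c≤ , 4tw≤ , dom) = structure k₁ D r₁ t Fs n≡ D>0 2c≤ (subst (λ z → 2 * z ≤ t * D) (sym n≡) t≥)
      (subst (λ z → 84 * (r * (p * p * (z * z * z * 3 ^ (r + suc (r * t))))) * tail α β z k < (α + β) ^ z) (sym n≡)
        (scaled-< _ (2 ^ w) (tail α β N k) ((α + β) ^ N) (^-pos N α+β>0)
          (subst (_< 2 ^ w) (e r (p * p) (N * N * N * 3 ^ (r + suc (r * t)))) dom)
          (tail-exponential k D t w (s≤s z≤n) t≥ 4tw≤)))
      m≤r uni int (unhit-few k ((n ∸ r) C k) Fs uni large)
      where
      α+β>0 : 1 ≤ α + β
      α+β>0 = ≤-trans (*-pos {10} {k} (s≤s z≤n) (s≤s z≤n)) (≤-trans (m≤n+m (10 * k) (2 * (2 * D))) (m≤m+n α β))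

theorem1p3 : (r : ℕ) → 2 ≤ r →
    Σ ℕ λ c → 0 < c ×
    ((n k : ℕ) → 1 ≤ n → 1 ≤ k →
    2 * k ≤ n → c ^ 3 * k ^ 2 ≤ (n ∸ 2 * k) ^ 3 →
    (m : ℕ) → m ≤ r → (Fs : Fin m → Family n) →
    ((i : Fin m) → Uniform k (Fs i)) → ((i : Fin m) → Intersecting (Fs i)) →
    (card (⋃ Fs) ≤ n C k ∸ (n ∸ r) C k)
    × (card (⋃ Fs) ≡ n C k ∸ (n ∸ r) C k →
    Σ (Subset n) λ R → ∣ R ∣ ≡ r ×
    ((S : Subset n) → (⋃ Fs S ≡ true → ∣ S ∣ ≡ k × Nonempty (S ∩ R))
    × (∣ S ∣ ≡ k → Nonempty (S ∩ R) → ⋃ Fs S ≡ true))))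
theorem1p3 (suc r₁) _ = from (large-union-structure r₁)
  where
  r = suc r₁
  from : (Σ ℕ λ c → 0 < c × (∀ n k D → 1 ≤ k → n ≡ 2 * k + D → c ^ 3 * k ^ 2 ≤ D ^ 3 →
      ∀ m → m ≤ r → (Fs : Fin m → Family n) → (∀ i → Uniform k (Fs i)) → (∀ i → Intersecting (Fs i)) →
      n C k ∸ (n ∸ r) C k ≤ card (⋃ Fs) → Conclusion r k Fs)) → _
  from (c , c>0 , f) = c , c>0 , λ n k _ k>0 2k≤n h m m≤r Fs uni int →
    let large = f n k (n ∸ 2 * k) k>0 (sym (m+[n∸m]≡n 2k≤n)) h m m≤r Fs uni int in
      bound k Fs uni large (n C k ∸ (n ∸ r) C k ≤? card (⋃ Fs))
    , λ e → large (≤-reflexive (sym e))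
    where
    -- Either the union is below the claimed value, or it is a hitting family and its size is known.
    bound : ∀ {n m} k (Fs : Fin m → Family n) → (∀ i → Uniform k (Fs i)) → (n C k ∸ (n ∸ r) C k ≤ card (⋃ Fs) → Conclusion r k Fs) →
      Dec (n C k ∸ (n ∸ r) C k ≤ card (⋃ Fs)) → card (⋃ Fs) ≤ n C k ∸ (n ∸ r) C k
    bound k Fs uni large (yes p) = hitting-card r k Fs uni (large p)
    bound k Fs uni large (no p) = <⇒≤ (≰⇒> p)
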